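{- Let $q\ge 6$ be a prime power and let $\bar{\mathcal C}$ be an $\mathbb F_q$-conic in an $\mathbb F_q$-subplane $\bar\pi$ of $\mathrm{PG}(2,q^3)$ that is secant to $\ell_\infty$. In the exact-at-infinity Bruck-Bose representation in $\mathrm{PG}(6,q)$, the curve $\mathcal V([\mathcal C])$ decomposes into a non-degenerate conic $\mathcal N_2$ (which lies in a plane of $\mathrm{PG}(6,q)$, not contained in $\Sigma_\infty$, that meets $q+1$ spread planes of $\mathcal S$), together with two planes in $\Sigma_\infty$ (possibly repeated, possibly in the extension $\Sigma_\infty^{\star\star}\setminus\Sigma_\infty$).
   Context: **$\mathbb F_q$-conics.** An $\mathbb F_q$-subplane of $\mathrm{PG}(2,q^3)$ is a subplane of order $q$; it is secant, tangent or exterior to a line if it meets it in $q+1$, $1$ or $0$ points. An $\mathbb F_q$-conic is a non-degenerate conic of an $\mathbb F_q$-subplane. For an $\mathbb F_q$-conic $\bar{\mathcal C}$, $\bar{\mathcal C}^{+}$ is the unique non-degenerate conic of $\mathrm{PG}(2,q^3)$ containing it, and $\bar{\mathcal C}^{++}$ the unique non-degenerate conic of $\mathrm{PG}(2,q^6)$ containing $\bar{\mathcal C}^+$. A line $\ell_\infty$ of $\mathrm{PG}(2,q^3)$ is fixed as line at infinity. **Conjugacy.** For an $\mathbb F_q$-subplane $\bar\pi$, $\bar{\mathsf c}_\pi$ is the collineation $\bar X\mapsto B\bar X^q$ ($B\in\mathrm{GL}(3,q^3)$) of $\mathrm{PG}(2,q^3)$ that has order 3 and fixes $\bar\pi$ pointwise;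 the same formula defines it on $\mathrm{PG}(2,q^6)$, where it has order 6. **Bose representation.** Embed $\mathrm{PG}(8,q)\subset\mathrm{PG}(8,q^3)\subset\mathrm{PG}(8,q^6)$; $X^q$ is obtained by raising coordinates to the $q$-th power. For a subspace or variety $\mathcal K$ given over $\mathbb F_q$, $\mathcal K^\star$ and $\mathcal K^{\star\star}$ denote the pointsets over $\mathbb F_{q^3}$ and $\mathbb F_{q^6}$ of the same equations; for a subspace $\Sigma$ of $\mathrm{PG}(8,q^3)$, $\Sigma^{\star\star}$ is its extension to $\mathrm{PG}(8,q^6)$. Let $\Gamma$ be a plane of $\mathrm{PG}(8,q^3)$ disjoint from $\mathrm{PG}(8,q)$ such that $\Gamma,\Gamma^q,\Gamma^{q^2}$ span $\mathrm{PG}(8,q^3)$. The planes $[\![X]\!]=\langle X,X^q,X^{q^2}\rangle\cap\mathrm{PG}(8,q)$, $X\in\Gamma$, form a regular 2-spread of $\mathrm{PG}(8,q)$. Identify $\mathrm{PG}(2,q^3)$ with $\Gamma$ (and $\mathrm{PG}(2,q^6)$ with $\Gamma^{\star\star}$) by a linear isomorphism, $\bar X\leftrightarrow X$; dropping the bar denotes the corresponding object in $\Gamma$ or $\Gamma^{\star\star}$ (so $\mathcal C,\mathcal C^+,\mathcal C^{++},\mathsf c_\pi$). **Scroll-planes.** For $X\in\Gamma^{\star\star}$, the $\pi$-scroll-plane is $(\!(X)\!)_\pi=\langle X,(X^{\mathsf c_\pi^5})^q,(X^{\mathsf c_\pi^4})^{q^2}\rangle$; for $X\in\Gamma$ this is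 $\langle X,(X^{\mathsf c_\pi^2})^q,(X^{\mathsf c_\pi})^{q^2}\rangle$. **Exact-at-infinity Bruck-Bose representation.** Let $g\subset\Gamma$ be the line corresponding to $\ell_\infty$, $\Sigma_\infty=\langle g,g^q,g^{q^2}\rangle\cap\mathrm{PG}(8,q)$ (a 5-space), and $\Sigma_{6,q}\cong\mathrm{PG}(6,q)$ a 6-space of $\mathrm{PG}(8,q)$ containing $\Sigma_\infty$ as its hyperplane at infinity. The planes $[\![X]\!]$, $X\in g$, form a regular 2-spread $\mathcal S$ of $\Sigma_\infty$, with transversal lines $g,g^q,g^{q^2}$; its elements are the spread planes. For a point $\bar X$ let $[X]=[\![X]\!]\cap\Sigma_{6,q}$: a point of $\Sigma_{6,q}\setminus\Sigma_\infty$ if $\bar X\notin\ell_\infty$, the spread plane $[\![X]\!]$ if $\bar X\in\ell_\infty$. $[\mathcal C]$ is the set of points lying in the $[X]$, $\bar X\in\bar{\mathcal C}$. **Varieties.** It is known that the pointset of $\{[\![X]\!]:X\in\mathcal C\}$ is an intersection $\mathcal V([\![\mathcal C]\!])$ of nine quadrics of $\mathrm{PG}(8,q)$, that $\mathcal V([\![\mathcal C]\!])^\star$ is the set of points on the planes $(\!(X)\!)_\pi$, $X\in\mathcal C^+$, and $\mathcal V([\![\mathcal C]\!])^{\star\star}$ is the set of points on the planes $(\!(X)\!)_\pi$, $X\in\mathcal C^{++}$. Put $\mathcal V([\mathcal C])=\mathcal V([\![\mathcal C]\!])\cap\Sigma_{6,q}$ (its pointset is $[\mathcal C]$), with extensions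 $\mathcal V([\mathcal C])^\star=\mathcal V([\![\mathcal C]\!])^\star\cap\Sigma_{6,q}^\star$ and $\mathcal V([\mathcal C])^{\star\star}=\mathcal V([\![\mathcal C]\!])^{\star\star}\cap\Sigma_{6,q}^{\star\star}$. -}

module Defs where

open import Algebra.Bundles using (CommutativeRing)
open import Algebra.Structures using (IsCommutativeRing)
import Algebra.Properties.Semiring.Exp as SemiringExp
import Algebra.Properties.Monoid.Sum as MonoidSum
open import Data.Fin.Base using (Fin)
open import Data.Nat.Base as ℕ using (ℕ; suc)
open import Data.Nat.GeneralisedArithmetic using (fold)
open import Data.Nat.Primality using (Prime)
open import Data.Product.Base using (∃; ∃₂; _×_)
open import Data.Vec.Functional using (Vector; map; _++_; _∷_; [])
open import Function.Bundles using (_↔_; _⇔_)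
open import Level using (Level; 0ℓ)
open import Relation.Binary.Core using (Rel)
open import Relation.Binary.PropositionalEquality.Core using (_≡_; _≢_)
open import Relation.Nullary.Negation.Core using (¬_)
open import Relation.Unary using (Pred; _∈_; _⊆_; _⊥_; _≐_; _∩_; _≬_)

IsPrimePower : ℕ → Set
IsPrimePower q = ∃₂ λ p k → Prime p × q ≡ p ℕ.^ suc k

record FiniteField (order : ℕ) : Set₁ where
  infixl 7 _*_
  infixl 6 _+_
  field
    Carrier           : Set
    _+_ _*_           : Carrier → Carrier → Carrier
    -_                : Carrier → Carrier
    0# 1#             : Carrier
    isCommutativeRing : IsCommutativeRing _≡_ _+_ _*_ -_ 0# 1#
    1≢0               : 1# ≢ 0#
    inverse           : ∀ x → x ≢ 0# → ∃ λ y → x * y ≡ 1#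
    enumeration       : Fin order ↔ Carrier

  commutativeRing : CommutativeRing 0ℓ 0ℓ
  commutativeRing = record { isCommutativeRing = isCommutativeRing }

-- P has exactly k elements, counted up to ≈.
HasCardinality : ∀ {a ℓ p : Level} {A : Set a} → Rel A ℓ → Pred A p → ℕ → Set _
HasCardinality {A = A} _≈_ P k = ∃ λ (f : Fin k → A) →
  (∀ i → P (f i)) × (∀ i j → f i ≈ f j → i ≡ j) × (∀ x → P x → ∃ λ i → x ≈ f i)

-- Everything takes place inside projective spaces over K = 𝔽_{q⁶}.  The
-- spaces over 𝔽_q and 𝔽_{q³} are the sets of points with homogeneous
-- coordinates in the corresponding subfield of K.  An object given over a
-- subfield is identified with its extension to K, so that its points over
-- the smaller field are recovered by intersecting with PG k.
module Geometry (q : ℕ) (K : FiniteField (q ℕ.^ 6)) where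

  open FiniteField K public
  open CommutativeRing commutativeRing using (semiring; +-monoid)
  open SemiringExp semiring using (_^_) public
  open MonoidSum +-monoid using (sum) public

  private
    variable
      n d k : ℕ

  -- The subfield 𝔽_{q^k}, for k dividing 6.
  𝔽 : ℕ → Pred Carrier 0ℓ
  𝔽 k x = x ^ (q ℕ.^ k) ≡ x

  Vec : ℕ → Set
  Vec n = Vector Carrier n

  EntriesIn : ℕ → Pred (Vec n) 0ℓ
  EntriesIn k v = ∀ i → v i ∈ 𝔽 k

  infix 4 _∼_
  _∼_ : Rel (Vec n) 0ℓ
  v ∼ w = ∃ λ c → c ≢ 0# × (∀ i → v i ≡ c * w i)

  -- Points of PG(n - 1, q⁶); equality of points is ∼ on coordinates.
  record Point (n : ℕ) : Set where
    field
      coords  : Vec n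
      nonzero : ∃ λ i → coords i ≢ 0#
  open Point public

  infix 4 _≈ₚ_
  _≈ₚ_ : Rel (Point n) 0ℓ
  X ≈ₚ Y = coords X ∼ coords Y

  PointSet : ℕ → Set₁
  PointSet n = Pred (Point n) 0ℓ

  -- PG(n - 1, q^k) as a subset of PG(n - 1, q⁶).
  PG : ℕ → PointSet n
  PG k X = ∃ λ v → EntriesIn k v × coords X ∼ v

  -- (X^{q^m}), coordinatewise.
  frob : ℕ → Vec n → Vec n
  frob m v i = v i ^ (q ℕ.^ m)

  combination : Vector (Vec n) d → Vec d → Vec n
  combination b c i = sum (λ j → c j * b j i)

  ⟨_⟩ : Vector (Vec n) d → PointSet n
  ⟨ b ⟩ X = ∃ λ c → ∀ i → coords X i ≡ combination b c i

  Independent : Pred (Vector (Vec n) d) 0ℓ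
  Independent b = ∀ c → (∀ i → combination b c i ≡ 0#) → ∀ j → c j ≡ 0#

  -- A subspace of PG(n - 1, q^k) of projective dimension d - 1.
  record Subspace (k n d : ℕ) : Set where
    field
      basis       : Vector (Vec n) d
      rational    : ∀ j → EntriesIn k (basis j)
      independent : Independent basis
  open Subspace public

  ⟦_⟧ : Subspace k n d → PointSet n
  ⟦ S ⟧ = ⟨ basis S ⟩

  Matrix : ℕ → Set
  Matrix n = Fin n → Fin n → Carrier

  infixr 7 _·_
  _·_ : Matrix n → Vec n → Vec n
  (M · x) i = sum (λ j → M i j * x j)

  GL : ℕ → Pred (Matrix n) 0ℓ
  GL k M = (∀ i j → M i j ∈ 𝔽 k) ×
    ∃ λ N → (∀ x i → (N · M · x) i ≡ x i) × (∀ x i → (M · N · x) i ≡ x i)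

  -- The quadratic form Σᵢⱼ Aᵢⱼ xᵢ xⱼ; A need not be symmetric, so every
  -- quadratic form arises, also in characteristic 2.
  quadratic : Matrix n → Vec n → Carrier
  quadratic A x = sum (λ i → sum (λ j → A i j * x i * x j))

  -- V is a vertex (singular point) of the quadric A = 0: both the form and
  -- its polarisation against every vector vanish at V.  This is the criterion
  -- for A to be equivalent to a form in fewer variables.
  Vertex : Matrix n → PointSet n
  Vertex A V = ∀ x → quadratic A (λ i → x i + coords V i) ≡ quadratic A x

  -- A non-degenerate conic of PG(2, q^k).
  record Conic (k : ℕ) : Set where
    field
      form          : Matrix 3
      rational      : ∀ i j → form i j ∈ 𝔽 k
      nondegenerate : ∀ V → ¬ (V ∈ Vertex form)
  open Conic public using (form)

  pts : Conic k → PointSet 3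
  pts D X = quadratic (form D) (coords X) ≡ 0#

  -- D is the unique non-degenerate conic of PG(2, q^k) containing S.
  record IsUniqueConicThrough (S : PointSet 3) (D : Conic k) : Set where
    field
      contains : S ⊆ pts D
      unique   : (D′ : Conic k) → S ⊆ pts D′ → pts D ∩ PG k ≐ pts D′ ∩ PG k

  -- The image of a conic under the coordinate system of a plane of PG(8, q).
  conicIn : Subspace 1 9 3 → Conic 1 → PointSet 9
  conicIn Π D X = ∃ λ Y → Y ∈ pts D × coords X ∼ combination (basis Π) (coords Y)

  Line : Set
  Line = Subspace 3 3 2

  Secant : PointSet 3 → Line → Set
  Secant π ℓ = HasCardinality _≈ₚ_ (π ∩ ⟦ ℓ ⟧ ∩ PG 3) (suc q)

  -- A subplane of PG(2, q³) of order q.  Its lines are the lines of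
  -- PG(2, q³) joining two of its points.
  record IsSubplane (π : PointSet 3) : Set where
    field
      respects : ∀ {X Y} → X ≈ₚ Y → X ∈ π → Y ∈ π
      inPG     : π ⊆ PG 3

    IsLine : Line → Set
    IsLine ℓ = ∃₂ λ X Y → X ∈ π ∩ ⟦ ℓ ⟧ × Y ∈ π ∩ ⟦ ℓ ⟧ × ¬ (X ≈ₚ Y)

    field
      meet       : ∀ ℓ m → IsLine ℓ → IsLine m → ∃ λ X → X ∈ π ∩ ⟦ ℓ ⟧ ∩ ⟦ m ⟧
      quadrangle : ∃ λ (Q : Fin 4 → Point 3) → (∀ i → Q i ∈ π) ×
        (∀ i j k → i ≢ j → j ≢ k → i ≢ k →
          (ℓ : Line) → ¬ (Q i ∈ ⟦ ℓ ⟧ × Q j ∈ ⟦ ℓ ⟧ × Q k ∈ ⟦ ℓ ⟧))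
      order      : ∀ ℓ → IsLine ℓ → Secant π ℓ

  -- C is a non-degenerate conic of the subplane π: in suitable homogeneous
  -- coordinates for PG(2, q³) the points of π are those of PG(2, q), and C is
  -- a non-degenerate conic of PG(2, q).
  record IsConicOfSubplane (π C : PointSet 3) : Set where
    field
      M      : Matrix 3
      inGL   : M ∈ GL 3
      conic  : Conic 1
      plane  : π ≐ λ X → ∃ λ Y → Y ∈ PG 1 × coords X ∼ M · coords Y
      points : C ≐ λ X → ∃ λ Y → Y ∈ pts conic ∩ PG 1 × coords X ∼ M · coords Y

  -- The collineation X ↦ B X^q of order 3 on PG(2, q³) fixing π pointwise.
  record Conjugacy (π : PointSet 3) : Set where
    field
      B    : Matrix 3
      inGL : B ∈ GL 3

    c : Vec 3 → Vec 3
    c x = B · frob 1 x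

    c^ : ℕ → Vec 3 → Vec 3
    c^ m x = fold x c m

    IdentityOnPG : ℕ → Set
    IdentityOnPG m = (X : Point 3) → X ∈ PG 3 → c^ m (coords X) ∼ coords X

    field
      order-3 : IdentityOnPG 3 × ¬ IdentityOnPG 1 × ¬ IdentityOnPG 2
      fixes   : (X : Point 3) → X ∈ π → c (coords X) ∼ coords X

  -- b, b^q, b^{q²} taken together.
  conjugates : Vector (Vec n) d → Vector (Vec n) (d ℕ.+ (d ℕ.+ d))
  conjugates b = b ++ (map (frob 1) b ++ map (frob 2) b)

  -- The linear isomorphism from PG(2, q³) to Γ is the one taking the standard
  -- basis to the basis of Γ; any isomorphism arises by choice of that basis.
  record BoseRepresentation : Set where
    field
      Γ        : Subspace 3 9 3
      disjoint : ⟦ Γ ⟧ ⊥ PG 1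
      spanning : ∀ X → X ∈ ⟨ conjugates (basis Γ) ⟩

    toΓ : Vec 3 → Vec 9
    toΓ = combination (basis Γ)

    ⟦[_]⟧ : Point 3 → PointSet 9
    ⟦[ X ]⟧ = ⟨ conjugates (toΓ (coords X) ∷ []) ⟩ ∩ PG 1

    module _ {π : PointSet 3} (κ : Conjugacy π) where
      open Conjugacy κ

      scrollPlane : Point 3 → PointSet 9
      scrollPlane X = ⟨ toΓ x ∷ frob 1 (toΓ (c^ 5 x)) ∷ frob 2 (toΓ (c^ 4 x)) ∷ [] ⟩
        where x = coords X

  -- Σ∞ = ⟨g, g^q, g^{q²}⟩ ∩ PG(8, q), where toΓ ∘ basis ℓ∞ spans g, and a
  -- 6-space of PG(8, q) through it.
  record BruckBose (bose : BoseRepresentation) (ℓ∞ : Line) : Set where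
    open BoseRepresentation bose
    field
      Σ∞      : Subspace 1 9 6
      Σ∞-def  : ⟦ Σ∞ ⟧ ∩ PG 1 ≐ ⟨ conjugates (map toΓ (basis ℓ∞)) ⟩ ∩ PG 1
      Σ₆      : Subspace 1 9 7
      Σ∞⊆Σ₆   : ⟦ Σ∞ ⟧ ∩ PG 1 ⊆ ⟦ Σ₆ ⟧

    IsSpreadPlane : Pred (PointSet 9) 0ℓ
    IsSpreadPlane S = ∃ λ X → X ∈ ⟦ ℓ∞ ⟧ ∩ PG 3 × S ≐ ⟦[ X ]⟧

    SpreadPlaneMeeting : PointSet 9 → Pred (PointSet 9) 0ℓ
    SpreadPlaneMeeting T S = IsSpreadPlane S × S ≬ T

  -- The variety of PG(8, q) with pointset {⟦[ X ]⟧ : X ∈ C}: an intersection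
  -- of nine quadrics whose points over 𝔽_{q³} and 𝔽_{q⁶} are those of the
  -- scroll-planes of C⁺ and of C⁺⁺.
  record BoseVariety (bose : BoseRepresentation) {π : PointSet 3} (κ : Conjugacy π)
                     (C : PointSet 3) (C⁺ : Conic 3) (C⁺⁺ : Conic 6) : Set where
    open BoseRepresentation bose
    field
      quadric  : Fin 9 → Matrix 9
      rational : ∀ m i j → quadric m i j ∈ 𝔽 1

    𝒱 : PointSet 9
    𝒱 X = ∀ m → quadratic (quadric m) (coords X) ≡ 0#

    field
      points   : 𝒱 ∩ PG 1 ≐ λ Z → ∃ λ X → X ∈ C × Z ∈ ⟦[ X ]⟧
      points⋆  : 𝒱 ∩ PG 3 ≐
        (λ Z → ∃ λ X → X ∈ pts C⁺ ∩ PG 3 × Z ∈ scrollPlane κ X) ∩ PG 3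
      points⋆⋆ : 𝒱 ≐ λ Z → ∃ λ X → X ∈ pts C⁺⁺ × Z ∈ scrollPlane κ X

  IsRealPlane : Subspace 6 9 3 → Set
  IsRealPlane Π = ∃ λ (Π₀ : Subspace 1 9 3) → ⟦ Π ⟧ ≐ ⟦ Π₀ ⟧

{-# OPTIONS --safe #-}

-- In a frame of PG(2, q³) in which π is PG(2, q), C has an equation over 𝔽_q and ℓ∞
-- is y₀ = 0, the points of PG(8, q⁶) become 3 × 3 matrices z, the row zᵢ being taken
-- in the frame of Γ^{qⁱ}.  The scroll-plane of the point y then consists of the rank
-- one matrices s ⊗ y, so 𝒱 is {s ⊗ y : y ∈ C⁺⁺}; Σ∞ is zᵢ₀ = 0, and Σ₆ is given by
-- (zᵢ₀)ᵢ ∝ τ = (θ, θ^q, θ^{q²}) for some θ ∈ 𝔽_{q³}.  A point s ⊗ y of 𝒱 in Σ₆ off Σ∞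
-- has s ∝ τ, which gives a conic in the plane τ ⊗ y; a point of Σ∞ has y₀ = 0, so
-- that y is one of the two points of C⁺⁺ on ℓ∞, given by a quadratic equation over
-- 𝔽_q, which splits in 𝔽_{q⁶}.  Dimension arguments are replaced by the pigeonhole
-- principle over the finite field.
module Submission where

open import Defs
open import Algebra.Bundles using (AbelianGroup; CommutativeRing)
open import Algebra.Structures using (IsCommutativeRing)
import Algebra.Construct.DirectProduct as DirectProduct
import Algebra.Properties.CommutativeMonoid.Sum as CommutativeMonoidSum
import Algebra.Properties.CommutativeSemigroup as CommutativeSemigroupProperties
import Algebra.Properties.CommutativeSemiring.Binomial as Binomial
import Algebra.Properties.CommutativeSemiring.Exp as Exp
import Algebra.Properties.Ring as RingProperties
import Algebra.Properties.Semiring.Mult as Mult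
import Algebra.Properties.Semiring.Sum as Sum
import Algebra.Solver.Ring.NaturalCoefficients.Default as Solver
open import Data.Empty using (⊥-elim)
open import Data.Fin.Base using (Fin; zero; suc; fromℕ; fromℕ<; inject₁; punchIn; combine;
  funToFin; finToFun; splitAt; _↑ˡ_; _↑ʳ_)
import Data.Fin.Properties as Fin
open import Data.Fin.Permutation using (permutation)
open import Data.Nat.Base as ℕ using (ℕ; zero; suc)
import Data.Nat.Properties as ℕ
open import Data.Nat.Combinatorics using (nCk≡n!/k![n-k]!; k![n∸k]!∣n!; nCn≡1)
  renaming (_C_ to _choose_)
open import Data.Nat.Divisibility using (_∣_; divides; ∣⇒≤; ∣-refl; ∣m⇒∣m*n)
open import Data.Nat.DivMod using (m/n*n≡m)
open import Data.Nat.Primality using (Prime; euclidsLemma; prime⇒nonTrivial)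
open import Data.Product.Base using (∃; ∃₂; _×_; _,_; proj₁; proj₂)
open import Data.Sum.Base using (_⊎_; inj₁; inj₂; [_,_]) renaming (map to map⊎)
open import Data.Vec.Functional using (Vector; _∷_; []; _++_; map)
open import Data.Vec.Functional.Properties using (lookup-++ˡ; lookup-++ʳ)
open import Data.Vec.Functional.Relation.Unary.All.Properties using (++⁺)
open import Function.Base using (_∘_; id; _$_)
open import Function.Bundles using (Inverse)
open import Level using (0ℓ)
open import Relation.Binary.Definitions using (DecidableEquality)
open import Relation.Binary.PropositionalEquality as ≡ using (_≡_; _≢_; _≗_; cong; cong₂; subst)
open import Relation.Nullary.Decidable.Core using (Dec; yes; no; map′)
open import Relation.Nullary.Negation.Core using (¬_; contradiction)
open import Relation.Unary using (_∈_; _⊆_; _⊈_; _⊥_; _≐_; _∩_; _∪_)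

-- The exponents in the scroll-plane are what produces rank one matrices. In a frame of π the map
-- `c` is, up to a scalar, the q-power map on coordinates. Hence (X^{c⁵})^q and (X^{c⁴})^{q²} have
-- coordinates y^{q⁶} = y in the conjugate frames, the same y as X. A spread plane carries multiples
-- of y, y^q, y^{q²} in its rows instead; both shapes coincide when y is over 𝔽_q, which is how the
-- spread planes meeting τ ⊗ y are counted. Rationality over 𝔽_q is also read off the rows. The
-- q-power map raises all entries to the power q and moves each row to the next, so the 𝔽_q-points
-- are the matrices with rows w, w^q, w^{q²}, w over 𝔽_{q³}. This gives the shape of τ and decides
-- whether a plane s ⊗ y at infinity is real or has no 𝔽_q-point. The main obstacle is the splitting
-- in 𝔽_{q⁶}: K is known only through its number of elements, so a root has to come from counting. A
-- hypothetical irreducible quadratic is refuted in the larger ring K[ω]. For this reason the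
-- Frobenius and polynomial lemmas are stated for commutative rings with setoid equality and then
-- used both over K and over K[ω].

-- Binomial coefficients modulo a prime, and additivity of the p-th power.

prime∣!⇒≤ : ∀ {p} → Prime p → ∀ n → p ∣ n ℕ.! → p ℕ.≤ n
prime∣!⇒≤ p-prime zero p∣1 =
  contradiction (∣⇒≤ p∣1) (ℕ.<⇒≱ (ℕ.nonTrivial⇒n>1 _ {{prime⇒nonTrivial p-prime}}))
prime∣!⇒≤ p-prime (suc n) p∣ with euclidsLemma (suc n) (n ℕ.!) p-prime p∣
... | inj₁ p∣1+n = ∣⇒≤ p∣1+n
... | inj₂ p∣n!  = ℕ.m≤n⇒m≤1+n (prime∣!⇒≤ p-prime n p∣n!)

-- The prime p divides p! = C(p, k) k! (p - k)!, but neither of the two factorials, whose factors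
-- are all smaller than p.
prime∣nCk : ∀ {p k} → Prime p → 0 ℕ.< k → k ℕ.< p → p ∣ p choose k
prime∣nCk {p} {k} p-prime 0<k k<p =
  [ id
  , (λ p∣k![p-k]! → ⊥-elim
      ([ (λ p∣k! → ℕ.<⇒≱ k<p (prime∣!⇒≤ p-prime k p∣k!))
       , (λ p∣! → ℕ.<⇒≱ p∸k<p (prime∣!⇒≤ p-prime (p ℕ.∸ k) p∣!))
       ] (euclidsLemma (k ℕ.!) _ p-prime p∣k![p-k]!)))
  ] (euclidsLemma (p choose k) _ p-prime (subst (p ∣_) (≡.sym C*!≡!) (p∣p! p-prime)))
  where
  instance
    _ = k ℕ.!* (p ℕ.∸ k) !≢0
  C*!≡! : (p choose k) ℕ.* (k ℕ.! ℕ.* (p ℕ.∸ k) ℕ.!) ≡ p ℕ.!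
  C*!≡! = ≡.trans (cong (λ c → c ℕ.* (k ℕ.! ℕ.* (p ℕ.∸ k) ℕ.!)) (nCk≡n!/k![n-k]! (ℕ.<⇒≤ k<p)))
                  (m/n*n≡m (k![n∸k]!∣n! (ℕ.<⇒≤ k<p)))
  p∸k<p : p ℕ.∸ k ℕ.< p
  p∸k<p = ℕ.∸-monoʳ-< 0<k (ℕ.<⇒≤ k<p)
  p∣p! : ∀ {p} → Prime p → p ∣ p ℕ.!
  p∣p! {zero}  0-prime = contradiction (prime⇒nonTrivial 0-prime) λ ()
  p∣p! {suc n} _ = ∣m⇒∣m*n (n ℕ.!) ∣-refl

module Frobenius (R : CommutativeRing 0ℓ 0ℓ) {p : ℕ} (p-prime : Prime p) where
  open CommutativeRing R hiding (zero)
  open Exp commutativeSemiring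
  open Mult semiring renaming (_×_ to _·_)
  open Sum semiring
  open import Relation.Binary.Reasoning.Setoid setoid

  module _ (char : p · 1# ≈ 0#) where

    ∣-×≈0 : ∀ {n} x → p ∣ n → n · x ≈ 0#
    ∣-×≈0 {n} x (divides m ≡.refl) = begin
      (m ℕ.* p) · x     ≈⟨ ×-assocˡ x m p ⟨
      m · (p · x)       ≈⟨ ×-congʳ m (×-congʳ p (*-identityˡ x)) ⟨
      m · (p · (1# * x)) ≈⟨ ×-congʳ m (×-assoc-* p 1# x) ⟨
      m · (p · 1# * x)  ≈⟨ ×-congʳ m (trans (*-congʳ char) (zeroˡ x)) ⟩
      m · 0#            ≈⟨ sum-replicate m ⟨
      sum (λ (_ : Fin m) → 0#) ≈⟨ sum-replicate-zero m ⟩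
      0#                ∎

    -- In the binomial expansion every term except the two outer ones has a coefficient divisible by
    -- p.
    ^p-homo-+ : ∀ x y → (x + y) ^ p ≈ x ^ p + y ^ p
    ^p-homo-+ x y = go p-prime (Binomial.theorem commutativeSemiring p x y) ∣-×≈0
      where
      open Binomial commutativeSemiring using (binomialTerm; binomialExpansion)
      -- `p` is a module parameter; `go` abstracts over it so that it can be split as `suc n`, and
      -- takes the facts about the old `p` as arguments.
      go : ∀ {p} → Prime p → (x + y) ^ p ≈ binomialExpansion x y p →
           (∀ {n} x → p ∣ n → n · x ≈ 0#) → (x + y) ^ p ≈ x ^ p + y ^ p
      go {zero}  0-prime _ _ = contradiction (prime⇒nonTrivial 0-prime) λ ()
      go {suc n} p-prime expand p× = begin
        (x + y) ^ suc n
          ≈⟨ expand ⟩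
        term zero + sum (term ∘ suc)
          ≈⟨ +-cong first (sum-init-last (term ∘ suc)) ⟩
        y ^ suc n + (sum (term ∘ suc ∘ inject₁) + term (suc (fromℕ n)))
          ≈⟨ +-congˡ (+-cong (trans (sum-cong-≋ middle) (sum-replicate-zero n)) final) ⟩
        y ^ suc n + (0# + x ^ suc n)
          ≈⟨ +-congˡ (+-identityˡ _) ⟩
        y ^ suc n + x ^ suc n
          ≈⟨ +-comm _ _ ⟩
        x ^ suc n + y ^ suc n ∎
        where
        term = binomialTerm x y (suc n)
        first : term zero ≈ y ^ suc n
        first = trans (×-homo-1 _) (*-identityˡ _)
        middle : ∀ i → term (suc (inject₁ i)) ≈ 0#
        middle i = p× _ (prime∣nCk p-prime (ℕ.s≤s ℕ.z≤n)
          (ℕ.s≤s (subst (λ m → m ℕ.< n) (≡.sym (Fin.toℕ-inject₁ i)) (Fin.toℕ<n i))))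
        final : term (suc (fromℕ n)) ≈ x ^ suc n
        final rewrite Fin.toℕ-fromℕ n | nCn≡1 (suc n) | ℕ.n∸n≡0 n =
          trans (×-homo-1 _) (*-identityʳ _)

    ^pᵐ-homo-+ : ∀ m x y → (x + y) ^ (p ℕ.^ m) ≈ x ^ (p ℕ.^ m) + y ^ (p ℕ.^ m)
    ^pᵐ-homo-+ zero x y =
      trans (*-identityʳ _) (sym (+-cong (*-identityʳ x) (*-identityʳ y)))
    ^pᵐ-homo-+ (suc m) x y = begin
      (x + y) ^ (p ℕ.* p ℕ.^ m)             ≈⟨ ^-assocʳ (x + y) p _ ⟨
      ((x + y) ^ p) ^ (p ℕ.^ m)             ≈⟨ ^-congˡ (p ℕ.^ m) (^p-homo-+ x y) ⟩
      (x ^ p + y ^ p) ^ (p ℕ.^ m)           ≈⟨ ^pᵐ-homo-+ m _ _ ⟩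
      (x ^ p) ^ (p ℕ.^ m) + (y ^ p) ^ (p ℕ.^ m) ≈⟨ +-cong (^-assocʳ x p _) (^-assocʳ y p _) ⟩
      x ^ (p ℕ.^ suc m) + y ^ (p ℕ.^ suc m) ∎

-- Roots of polynomials over a ring without zero divisors.

NoZeroDivisors : CommutativeRing 0ℓ 0ℓ → Set
NoZeroDivisors R = ∀ {x y} → x * y ≈ 0# → ¬ x ≈ 0# → y ≈ 0#
  where open CommutativeRing R

module Polynomials (R : CommutativeRing 0ℓ 0ℓ) (noZeroDivisors : NoZeroDivisors R) where
  open CommutativeRing R hiding (zero)
  open RingProperties ring
  open import Relation.Binary.Reasoning.Setoid setoid

  eval : ∀ {n} → (Fin n → Carrier) → Carrier → Carrier
  eval {zero}  a x = 0#
  eval {suc n} a x = a zero + x * eval (a ∘ suc) x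

  -- Synthetic division by X - r.
  quotient : ∀ {n} → Carrier → (Fin (suc n) → Carrier) → Fin n → Carrier
  quotient {suc n} r a zero    = eval (a ∘ suc) r
  quotient {suc n} r a (suc i) = quotient r (a ∘ suc) i

  division : ∀ {n} r (a : Fin (suc n) → Carrier) x →
             eval a x ≈ eval a r + (x - r) * eval (quotient r a) x
  division {zero} r a x = begin
    a zero + x * 0#               ≈⟨ +-congˡ (trans (zeroʳ x) (sym (zeroʳ r))) ⟩
    a zero + r * 0#               ≈⟨ +-identityʳ _ ⟨
    a zero + r * 0# + 0#          ≈⟨ +-congˡ (zeroʳ _) ⟨
    a zero + r * 0# + (x - r) * 0# ∎
  division {suc n} r a x = begin
    a zero + x * eval (a ∘ suc) x
      ≈⟨ +-congˡ (*-congˡ (division r (a ∘ suc) x)) ⟩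
    a zero + x * (e + (x - r) * Q)
      ≈⟨ +-congˡ (distribˡ x e _) ⟩
    a zero + (x * e + x * ((x - r) * Q))
      ≈⟨ +-congˡ (+-cong x*e (trans (sym (*-assoc x _ Q)) (trans (*-congʳ (*-comm x _)) (*-assoc _ x Q)))) ⟩
    a zero + ((r * e + (x - r) * e) + (x - r) * (x * Q))
      ≈⟨ +-congˡ (+-assoc _ _ _) ⟩
    a zero + (r * e + ((x - r) * e + (x - r) * (x * Q)))
      ≈⟨ +-assoc _ _ _ ⟨
    a zero + r * e + ((x - r) * e + (x - r) * (x * Q))
      ≈⟨ +-congˡ (distribˡ (x - r) e (x * Q)) ⟨
    a zero + r * e + (x - r) * (e + x * Q) ∎
    where
    e = eval (a ∘ suc) r
    Q = eval (quotient r (a ∘ suc)) x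
    x*e : x * e ≈ r * e + (x - r) * e
    x*e = begin
      x * e                  ≈⟨ *-congʳ (xyx⁻¹≈y r x) ⟨
      (r + x - r) * e        ≈⟨ *-congʳ (+-assoc r x (- r)) ⟩
      (r + (x - r)) * e      ≈⟨ distribʳ e r _ ⟩
      r * e + (x - r) * e    ∎

  -- The first coefficient of the quotient is the value at r of the tail of `a`. Its vanishing
  -- reduces a(r) = 0 to `a zero` ≈ 0 and supplies the hypothesis for the tail.
  quotient-vanishing : ∀ {n} r (a : Fin (suc n) → Carrier) → eval a r ≈ 0# →
                       (∀ i → quotient r a i ≈ 0#) → ∀ i → a i ≈ 0#
  quotient-vanishing {zero} r a a[r]≈0 _ zero = trans (sym (trans (+-congˡ (zeroʳ r)) (+-identityʳ _))) a[r]≈0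
  quotient-vanishing {suc n} r a a[r]≈0 q≈0 zero = begin
    a zero            ≈⟨ +-identityʳ _ ⟨
    a zero + 0#       ≈⟨ +-congˡ (trans (*-congˡ (q≈0 zero)) (zeroʳ r)) ⟨
    eval a r          ≈⟨ a[r]≈0 ⟩
    0#                ∎
  quotient-vanishing {suc n} r a a[r]≈0 q≈0 (suc i) =
    quotient-vanishing r (a ∘ suc) (q≈0 zero) (q≈0 ∘ suc) i

  -- Induction on the number of coefficients: after division by X - x₀ the quotient vanishes at the
  -- remaining points, since their differences from x₀ are nonzero. The bound is applied to X^N - X
  -- over K[ω] and to a Vandermonde system over K.
  distinctRoots : ∀ {n} (a x : Fin n → Carrier) → (∀ {i j} → x i ≈ x j → i ≡ j) →
                  (∀ i → eval a (x i) ≈ 0#) → ∀ i → a i ≈ 0#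
  distinctRoots {suc n} a x x-inj root =
    quotient-vanishing r a (root zero) (distinctRoots (quotient r a) (x ∘ suc) (Fin.suc-injective ∘ x-inj) λ i →
      noZeroDivisors (trans (sym (+-identityˡ _)) (trans (+-congʳ (sym (root zero)))
        (trans (sym (division r a (x (suc i)))) (root (suc i)))))
      λ x-r≈0 → case (x-inj (x∙y⁻¹≈ε⇒x≈y _ _ x-r≈0)))
    where
    r = x zero
    case : ∀ {i : Fin n} → ¬ suc i ≡ zero
    case ()

-- Action of an endomorphism on the roots of u² = b u + c.

record Endomorphism (R : CommutativeRing 0ℓ 0ℓ) : Set where
  open CommutativeRing R
  field
    φ      : Carrier → Carrier
    φ-cong : ∀ {x y} → x ≈ y → φ x ≈ φ y
    φ-+    : ∀ x y → φ (x + y) ≈ φ x + φ y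
    φ-*    : ∀ x y → φ (x * y) ≈ φ x * φ y

module QuadraticRoots (R : CommutativeRing 0ℓ 0ℓ) (noZeroDivisors : NoZeroDivisors R)
  (_≈?_ : ∀ x y → Dec (CommutativeRing._≈_ R x y)) (b c : CommutativeRing.Carrier R) where
  open CommutativeRing R hiding (zero)
  open RingProperties ring
  open import Relation.Binary.Reasoning.Setoid setoid

  IsRoot : Carrier → Set
  IsRoot u = u * u ≈ b * u + c

  -- Subtracting the two equations gives (u - v)(u + v - b) = 0.
  roots : ∀ {u v} → IsRoot u → IsRoot v → u ≈ v ⊎ u + v ≈ b
  roots {u} {v} u-root v-root with (u - v) ≈? 0#
  ... | yes d≈0 = inj₁ (x∙y⁻¹≈ε⇒x≈y _ _ d≈0)
  ... | no d≉0 = inj₂ (x∙y⁻¹≈ε⇒x≈y _ _ (noZeroDivisors (begin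
      d * (u + v - b)
        ≈⟨ x[y-z]≈xy-xz d (u + v) b ⟩
      d * (u + v) - d * b
        ≈⟨ +-congˡ (-‿cong (trans (*-comm d b) (sym d[u+v]≈bd))) ⟩
      d * (u + v) - d * (u + v)
        ≈⟨ -‿inverseʳ _ ⟩
      0# ∎) d≉0))
    where
    d = u - v
    d+v≈u : d + v ≈ u
    d+v≈u = //-rightDividesˡ v u
    d[u+v]≈bd : d * (u + v) ≈ b * d
    -- With v² added, both sides become u² = b u + c, so that no difference has to be expanded.
    d[u+v]≈bd = +-cancelʳ (v * v) _ _ (begin
      d * (u + v) + v * v           ≈⟨ +-congʳ (*-congˡ (+-comm u v)) ⟩
      d * (v + u) + v * v           ≈⟨ +-congʳ (distribˡ d v u) ⟩
      d * v + d * u + v * v         ≈⟨ +-congʳ (+-comm _ _) ⟩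
      d * u + d * v + v * v         ≈⟨ +-assoc _ _ _ ⟩
      d * u + (d * v + v * v)       ≈⟨ +-congˡ (trans (sym (distribʳ v d v)) (trans (*-congʳ d+v≈u) (*-comm u v))) ⟩
      d * u + v * u                 ≈⟨ trans (sym (distribʳ u d v)) (*-congʳ d+v≈u) ⟩
      u * u                         ≈⟨ u-root ⟩
      b * u + c                     ≈⟨ +-congʳ (trans (*-congˡ (sym d+v≈u)) (distribˡ b d v)) ⟩
      b * d + b * v + c             ≈⟨ +-assoc _ _ _ ⟩
      b * d + (b * v + c)           ≈⟨ +-congˡ v-root ⟨
      b * d + v * v                 ∎)

  module _ (Φ : Endomorphism R) where
    open Endomorphism Φ

    φ-root : φ b ≈ b → φ c ≈ c → ∀ {u} → IsRoot u → IsRoot (φ u)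
    φ-root φb≈b φc≈c {u} u-root = begin
      φ u * φ u       ≈⟨ φ-* u u ⟨
      φ (u * u)       ≈⟨ φ-cong u-root ⟩
      φ (b * u + c)   ≈⟨ φ-+ _ _ ⟩
      φ (b * u) + φ c ≈⟨ +-cong (trans (φ-* b u) (*-congʳ φb≈b)) φc≈c ⟩
      b * φ u + c     ∎

    -- The root φ r is either r itself or b - r. In the second case φ (φ r) = b - φ r = r, because φ
    -- fixes b.
    φφr≈r : φ b ≈ b → φ c ≈ c → ∀ {r} → IsRoot r → φ (φ r) ≈ r
    φφr≈r φb≈b φc≈c {r} r-root with roots (φ-root φb≈b φc≈c r-root) r-root
    ... | inj₁ φr≈r   = trans (φ-cong φr≈r) φr≈r
    ... | inj₂ φr+r≈b = +-cancelʳ (φ r) _ _ (begin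
      φ (φ r) + φ r   ≈⟨ φ-+ (φ r) r ⟨
      φ (φ r + r)     ≈⟨ φ-cong φr+r≈b ⟩
      φ b             ≈⟨ φb≈b ⟩
      b               ≈⟨ φr+r≈b ⟨
      φ r + r         ≈⟨ +-comm (φ r) r ⟩
      r + φ r         ∎)

open ≡ using (refl; sym; trans; module ≡-Reasoning)

-- Arithmetic of a finite field: decidable equality, characteristic, x^order = x.

module FieldProperties {order : ℕ} (K : FiniteField order) where
  open FiniteField K
  open CommutativeRing commutativeRing public
    hiding (Carrier; _+_; _*_; -_; 0#; 1#; zero; refl; sym; trans; setoid; reflexive; isEquivalence;
            _≈_; _≉_; isPartialEquivalence)
  open RingProperties ring public
  open ≡-Reasoning

  elements : Fin order → Carrier
  elements = Inverse.to enumeration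

  index : Carrier → Fin order
  index = Inverse.from enumeration

  elements-index : ∀ x → elements (index x) ≡ x
  elements-index x = Inverse.inverseˡ enumeration refl

  index-elements : ∀ i → index (elements i) ≡ i
  index-elements i = Inverse.inverseʳ enumeration refl

  infix 4 _≟_
  _≟_ : DecidableEquality Carrier
  x ≟ y = map′ (λ eq → trans (sym (elements-index x)) (trans (cong elements eq) (elements-index y)))
               (cong index) (index x Fin.≟ index y)

  inv : ∀ x → x ≢ 0# → Carrier
  inv x x≢0 = proj₁ (inverse x x≢0)

  inv-inverseʳ : ∀ x (x≢0 : x ≢ 0#) → x * inv x x≢0 ≡ 1#
  inv-inverseʳ x x≢0 = proj₂ (inverse x x≢0)

  inv-inverseˡ : ∀ x (x≢0 : x ≢ 0#) → inv x x≢0 * x ≡ 1#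
  inv-inverseˡ x x≢0 = trans (*-comm _ x) (inv-inverseʳ x x≢0)

  *-cancel-inv : ∀ x (x≢0 : x ≢ 0#) y → x * (inv x x≢0 * y) ≡ y
  *-cancel-inv x x≢0 y = trans (sym (*-assoc x _ y)) (trans (cong (_* y) (inv-inverseʳ x x≢0)) (*-identityˡ y))

  inv-cancel-* : ∀ x (x≢0 : x ≢ 0#) y → inv x x≢0 * (x * y) ≡ y
  inv-cancel-* x x≢0 y = trans (sym (*-assoc _ x y)) (trans (cong (_* y) (inv-inverseˡ x x≢0)) (*-identityˡ y))

  noZeroDivisors : ∀ {x y} → x * y ≡ 0# → x ≢ 0# → y ≡ 0#
  noZeroDivisors {x} {y} xy≡0 x≢0 =
    trans (sym (inv-cancel-* x x≢0 y)) (trans (cong (inv x x≢0 *_) xy≡0) (zeroʳ _))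

  *-≢0 : ∀ {x y} → x ≢ 0# → y ≢ 0# → x * y ≢ 0#
  *-≢0 x≢0 y≢0 xy≡0 = y≢0 (noZeroDivisors xy≡0 x≢0)

  inv-≢0 : ∀ x (x≢0 : x ≢ 0#) → inv x x≢0 ≢ 0#
  inv-≢0 x x≢0 inv≡0 = 1≢0 (trans (sym (inv-inverseʳ x x≢0)) (trans (cong (x *_) inv≡0) (zeroʳ x)))

  *-cancelˡ-≢0 : ∀ {x} → x ≢ 0# → ∀ {y z} → x * y ≡ x * z → y ≡ z
  *-cancelˡ-≢0 {x} x≢0 {y} {z} eq =
    trans (sym (inv-cancel-* x x≢0 y)) (trans (cong (inv x x≢0 *_) eq) (inv-cancel-* x x≢0 z))

module _ {order : ℕ} (K : FiniteField order) where
  open FiniteField K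
  open FieldProperties K
  open Exp commutativeSemiring
  open ≡-Reasoning
  private
    module + = Sum semiring
    module × = Mult semiring

  ^-≢0 : ∀ {x} n → x ≢ 0# → x ^ n ≢ 0#
  ^-≢0 zero    x≢0 = 1≢0
  ^-≢0 (suc n) x≢0 = *-≢0 x≢0 (^-≢0 n x≢0)

  -- Translation by 1 permutes the field, so the sum of all elements does not change when 1 is added
  -- to each of them.
  order×1≡0 : order ×.× 1# ≡ 0#
  order×1≡0 = +-cancelˡ (+.sum elements) _ _ (begin
    +.sum elements + order ×.× 1#          ≡⟨ cong (+.sum elements +_) (+.sum-replicate order) ⟨
    +.sum elements + +.sum (λ (_ : Fin order) → 1#) ≡⟨ +.∑-distrib-+ elements _ ⟨
    +.sum (λ i → elements i + 1#)          ≡⟨ +.sum-cong-≗ (λ i → elements-index (elements i + 1#)) ⟨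
    +.sum (λ i → elements (index (elements i + 1#))) ≡⟨ +.sum-permute elements translation ⟨
    +.sum elements                         ≡⟨ +-identityʳ _ ⟨
    +.sum elements + 0# ∎)
    where
    translation = permutation
      (λ i → index (elements i + 1#)) (λ i → index (elements i - 1#))
      (λ i → trans (cong index (trans (cong (_+ 1#) (elements-index _)) (//-rightDividesˡ 1# _))) (index-elements i))
      (λ i → trans (cong index (trans (cong (_- 1#) (elements-index _)) (//-rightDividesʳ 1# _))) (index-elements i))

module _ {n : ℕ} (K : FiniteField (suc n)) where
  open FiniteField K
  open FieldProperties K
  open Exp commutativeSemiring
  open ≡-Reasoning
  private
    module ∏ = CommutativeMonoidSum *-commutativeMonoid

  -- Multiplication by x ≢ 0 permutes the nonzero elements; unit x y is the factor
  -- by which it changes y in a product over all elements where 0 counts as 1.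
  private
    unit : Carrier → Carrier → Carrier
    unit x y with y ≟ 0#
    ... | yes _ = 1#
    ... | no  _ = x

    unit-0 : ∀ x {y} → y ≡ 0# → unit x y ≡ 1#
    unit-0 x {y} y≡0 with y ≟ 0#
    ... | yes _  = refl
    ... | no y≢0 = contradiction y≡0 y≢0

    unit-≢0 : ∀ x {y} → y ≢ 0# → unit x y ≡ x
    unit-≢0 x {y} y≢0 with y ≟ 0#
    ... | yes y≡0 = contradiction y≡0 y≢0
    ... | no _    = refl

  -- The product `P` of the nonzero elements is invariant under the dilation by x, which also
  -- contributes one factor x for each of the n nonzero elements. As `P` is nonzero, it cancels.
  ^order-nonzero : ∀ x → x ≢ 0# → x ^ n ≡ 1#
  ^order-nonzero x x≢0 = begin
    x ^ n                                ≡⟨ ∏.sum-replicate n ⟨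
    ∏.sum (λ (_ : Fin n) → x)            ≡⟨ ∏.sum-cong-≗ rest ⟨
    ∏.sum (λ i → unit x (elements (punchIn 0ᵢ i))) ≡⟨ *-identityˡ _ ⟨
    1# * ∏rest                           ≡⟨ cong (_* ∏rest) (unit-0 x (elements-index 0#)) ⟨
    unit x (elements 0ᵢ) * ∏rest         ≡⟨ ∏.sum-remove {i = 0ᵢ} (unit x ∘ elements) ⟨
    ∏.sum (unit x ∘ elements)            ≡⟨ *-cancelˡ-≢0 P≢0 P*≡P ⟩
    1#                                   ∎
    where
    0ᵢ = index 0#
    ∏rest = ∏.sum (λ i → unit x (elements (punchIn 0ᵢ i)))
    elements≢0 : ∀ i → i ≢ 0ᵢ → elements i ≢ 0#
    elements≢0 i i≢0 e≡0 = i≢0 (trans (sym (index-elements i)) (cong index e≡0))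
    rest : ∀ i → unit x (elements (punchIn 0ᵢ i)) ≡ x
    rest i = unit-≢0 x (elements≢0 _ (Fin.punchInᵢ≢i 0ᵢ i))
    h : Carrier → Carrier
    h y = unit y y
    P = ∏.sum (h ∘ elements)
    h≢0 : ∀ y → h y ≢ 0#
    h≢0 y hy≡0 with y ≟ 0#
    ... | yes _  = 1≢0 hy≡0
    ... | no y≢0 = y≢0 hy≡0
    ∏≢0 : ∀ {m} (f : Fin m → Carrier) → (∀ i → f i ≢ 0#) → ∏.sum f ≢ 0#
    ∏≢0 {zero}  f f≢0 = 1≢0
    ∏≢0 {suc m} f f≢0 = *-≢0 (f≢0 zero) (∏≢0 (f ∘ suc) (f≢0 ∘ suc))
    P≢0 : P ≢ 0#
    P≢0 = ∏≢0 (h ∘ elements) (h≢0 ∘ elements)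
    h-* : ∀ y → h (x * y) ≡ h y * unit x y
    h-* y with y ≟ 0#
    ... | yes y≡0 = trans (unit-0 _ (trans (cong (x *_) y≡0) (zeroʳ x))) (sym (*-identityʳ 1#))
    ... | no y≢0  = trans (unit-≢0 _ (*-≢0 x≢0 y≢0)) (*-comm x y)
    x⁻¹ = inv x x≢0
    dilation = permutation (λ i → index (x * elements i)) (λ i → index (x⁻¹ * elements i))
      (λ i → trans (cong index (trans (cong (x *_) (elements-index _)) (*-cancel-inv x x≢0 _))) (index-elements i))
      (λ i → trans (cong index (trans (cong (x⁻¹ *_) (elements-index _)) (inv-cancel-* x x≢0 _))) (index-elements i))
    P*≡P : P * ∏.sum (unit x ∘ elements) ≡ P * 1#
    P*≡P = begin
      P * ∏.sum (unit x ∘ elements) ≡⟨ ∏.∑-distrib-+ (h ∘ elements) (unit x ∘ elements) ⟨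
      ∏.sum (λ i → h (elements i) * unit x (elements i)) ≡⟨ ∏.sum-cong-≗ (h-* ∘ elements) ⟨
      ∏.sum (λ i → h (x * elements i)) ≡⟨ ∏.sum-cong-≗ (λ i → cong h (elements-index (x * elements i))) ⟨
      ∏.sum (λ i → h (elements (index (x * elements i)))) ≡⟨ ∏.sum-permute (h ∘ elements) dilation ⟨
      P                             ≡⟨ *-identityʳ P ⟨
      P * 1#                        ∎

^order : ∀ {order} (K : FiniteField order) →
  let open FiniteField K
      open Exp (CommutativeRing.commutativeSemiring commutativeRing)
  in ∀ x → x ^ order ≡ x
^order {zero}  K x = contradiction (Inverse.from (FiniteField.enumeration K) x) Fin.¬Fin0
^order {suc n} K x with FieldProperties._≟_ K x (FiniteField.0# K)
... | yes refl = FieldProperties.zeroˡ K _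
... | no x≢0   = trans (cong (x *_) (^order-nonzero K x x≢0)) (FieldProperties.*-identityʳ K x)
  where open FiniteField K

-- Adjoining a root of a quadratic.

-- The ring K[ω] with ω² = b ω + c; (x , y) stands for x + y ω.
module QuadraticExtension {order : ℕ} (K : FiniteField order) (b c : FiniteField.Carrier K) where
  open FiniteField K
  open FieldProperties K
  open ≡-Reasoning
  open Solver commutativeSemiring

  private
    additive : AbelianGroup 0ℓ 0ℓ
    additive = DirectProduct.abelianGroup +-abelianGroup +-abelianGroup

    module + = AbelianGroup additive

  infixl 7 _⊗_
  _⊗_ : Carrier × Carrier → Carrier × Carrier → Carrier × Carrier
  (x , y) ⊗ (x′ , y′) = x * x′ + c * (y * y′) , x * y′ + y * x′ + b * (y * y′)

  isCommutativeRing′ : IsCommutativeRing +._≈_ +._∙_ _⊗_ +._⁻¹ (0# , 0#) (1# , 0#)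
  isCommutativeRing′ = record
    { isRing = record
      { +-isAbelianGroup = +.isAbelianGroup
      ; *-cong = λ { (refl , refl) (refl , refl) → refl , refl }
      ; *-assoc = λ { (x₁ , y₁) (x₂ , y₂) (x₃ , y₃) →
          solve 8 (λ b c x₁ y₁ x₂ y₂ x₃ y₃ →
            (x₁ :* x₂ :+ c :* (y₁ :* y₂)) :* x₃ :+ c :* ((x₁ :* y₂ :+ y₁ :* x₂ :+ b :* (y₁ :* y₂)) :* y₃)
            := x₁ :* (x₂ :* x₃ :+ c :* (y₂ :* y₃)) :+ c :* (y₁ :* (x₂ :* y₃ :+ y₂ :* x₃ :+ b :* (y₂ :* y₃))))
            refl b c x₁ y₁ x₂ y₂ x₃ y₃
        , solve 8 (λ b c x₁ y₁ x₂ y₂ x₃ y₃ →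
            (x₁ :* x₂ :+ c :* (y₁ :* y₂)) :* y₃ :+ (x₁ :* y₂ :+ y₁ :* x₂ :+ b :* (y₁ :* y₂)) :* x₃
              :+ b :* ((x₁ :* y₂ :+ y₁ :* x₂ :+ b :* (y₁ :* y₂)) :* y₃)
            := x₁ :* (x₂ :* y₃ :+ y₂ :* x₃ :+ b :* (y₂ :* y₃)) :+ y₁ :* (x₂ :* x₃ :+ c :* (y₂ :* y₃))
              :+ b :* (y₁ :* (x₂ :* y₃ :+ y₂ :* x₃ :+ b :* (y₂ :* y₃))))
            refl b c x₁ y₁ x₂ y₂ x₃ y₃ }
      ; *-identity =
          (λ { (x , y) →
            solve 3 (λ c x y → con 1 :* x :+ c :* (con 0 :* y) := x) refl c x y
          , solve 3 (λ b x y → con 1 :* y :+ con 0 :* x :+ b :* (con 0 :* y) := y) refl b x y })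
        , (λ { (x , y) →
            solve 3 (λ c x y → x :* con 1 :+ c :* (y :* con 0) := x) refl c x y
          , solve 3 (λ b x y → x :* con 0 :+ y :* con 1 :+ b :* (y :* con 0) := y) refl b x y })
      ; distrib =
          (λ { (x₁ , y₁) (x₂ , y₂) (x₃ , y₃) →
            solve 7 (λ c x₁ y₁ x₂ y₂ x₃ y₃ →
              x₁ :* (x₂ :+ x₃) :+ c :* (y₁ :* (y₂ :+ y₃))
              := (x₁ :* x₂ :+ c :* (y₁ :* y₂)) :+ (x₁ :* x₃ :+ c :* (y₁ :* y₃)))
              refl c x₁ y₁ x₂ y₂ x₃ y₃
          , solve 7 (λ b x₁ y₁ x₂ y₂ x₃ y₃ →
              x₁ :* (y₂ :+ y₃) :+ y₁ :* (x₂ :+ x₃) :+ b :* (y₁ :* (y₂ :+ y₃))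
              := (x₁ :* y₂ :+ y₁ :* x₂ :+ b :* (y₁ :* y₂)) :+ (x₁ :* y₃ :+ y₁ :* x₃ :+ b :* (y₁ :* y₃)))
              refl b x₁ y₁ x₂ y₂ x₃ y₃ })
        , (λ { (x₁ , y₁) (x₂ , y₂) (x₃ , y₃) →
            solve 7 (λ c x₁ y₁ x₂ y₂ x₃ y₃ →
              (x₂ :+ x₃) :* x₁ :+ c :* ((y₂ :+ y₃) :* y₁)
              := (x₂ :* x₁ :+ c :* (y₂ :* y₁)) :+ (x₃ :* x₁ :+ c :* (y₃ :* y₁)))
              refl c x₁ y₁ x₂ y₂ x₃ y₃
          , solve 7 (λ b x₁ y₁ x₂ y₂ x₃ y₃ →
              (x₂ :+ x₃) :* y₁ :+ (y₂ :+ y₃) :* x₁ :+ b :* ((y₂ :+ y₃) :* y₁)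
              := (x₂ :* y₁ :+ y₂ :* x₁ :+ b :* (y₂ :* y₁)) :+ (x₃ :* y₁ :+ y₃ :* x₁ :+ b :* (y₃ :* y₁)))
              refl b x₁ y₁ x₂ y₂ x₃ y₃ })
      }
    ; *-comm = λ { (x , y) (x′ , y′) →
        solve 5 (λ c x y x′ y′ → x :* x′ :+ c :* (y :* y′) := x′ :* x :+ c :* (y′ :* y)) refl c x y x′ y′
      , solve 5 (λ b x y x′ y′ → x :* y′ :+ y :* x′ :+ b :* (y :* y′) := x′ :* y :+ y′ :* x :+ b :* (y′ :* y)) refl b x y x′ y′ }
    }

  extension : CommutativeRing 0ℓ 0ℓ
  extension = record { isCommutativeRing = isCommutativeRing′ }

  module _ (rootless : ∀ t → t * t ≢ b * t + c) where
    private module R = CommutativeRing extension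

    -- If (x + yω)(z + wω) = 0, then (x + yt)(z + wt) = yw(t² - bt - c) as polynomials in t. For y,
    -- w ≠ 0, evaluation at t = -z/w exhibits a root in K; otherwise one factor is a scalar.
    extension-noZeroDivisors : ∀ {u v} → u R.* v R.≈ R.0# → ¬ u R.≈ R.0# → v R.≈ R.0#
    extension-noZeroDivisors {x , y} {z , w} (xz+cyw≡0 , xw+yz+byw≡0) u≢0 with y ≟ 0# | w ≟ 0#
    ... | yes refl | _ =
        noZeroDivisors (trans (solve 4 (λ c x z w → x :* z := x :* z :+ c :* (con 0 :* w)) refl c x z w) xz+cyw≡0) x≢0
      , noZeroDivisors (trans (solve 4 (λ b x z w → x :* w := x :* w :+ con 0 :* z :+ b :* (con 0 :* w)) refl b x z w) xw+yz+byw≡0) x≢0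
      where x≢0 = λ x≡0 → u≢0 (x≡0 , refl)
    ... | no y≢0 | yes refl =
      noZeroDivisors (trans (solve 4 (λ b x y z → y :* z := x :* con 0 :+ y :* z :+ b :* (y :* con 0)) refl b x y z) xw+yz+byw≡0) y≢0 , refl
    ... | no y≢0 | no w≢0 = contradiction s-root (rootless s)
      where
      s = - (z * inv w w≢0)
      sw+z≡0 : s * w + z ≡ 0#
      sw+z≡0 = begin
        s * w + z    ≡⟨ cong (_+ z) (-‿distribˡ-* _ w) ⟨
        - (z * inv w w≢0 * w) + z ≡⟨ cong (λ e → - e + z) (trans (*-assoc z _ w) (trans (cong (z *_) (inv-inverseˡ w w≢0)) (*-identityʳ z))) ⟩
        - z + z      ≡⟨ -‿inverseˡ z ⟩
        0#           ∎
      -- y w (s² - b s - c) vanishes modulo the two coordinates of u v = 0.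
      s-root : s * s ≡ b * s + c
      s-root = *-cancelˡ-≢0 (*-≢0 y≢0 w≢0) (+-cancelʳ (x * (s * w + z) + s * (y * (s * w + z) ) ) _ _ (begin
        y * w * (s * s) + (x * (s * w + z) + s * (y * (s * w + z)))
          ≡⟨ cong (y * w * (s * s) +_) (trans (cong (λ e → x * e + s * (y * e)) sw+z≡0)
               (solve 3 (λ x y s → x :* con 0 :+ s :* (y :* con 0) := con 0) refl x y s)) ⟩
        y * w * (s * s) + 0#
          ≡⟨ cong (y * w * (s * s) +_) (trans (cong₂ (λ e f → e + s * f) xz+cyw≡0 xw+yz+byw≡0)
               (solve 1 (λ s → con 0 :+ s :* con 0 := con 0) refl s)) ⟨
        y * w * (s * s) + ((x * z + c * (y * w)) + s * (x * w + y * z + b * (y * w)))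
          ≡⟨ solve 7 (λ b c x y z w s →
               y :* w :* (s :* s) :+ ((x :* z :+ c :* (y :* w)) :+ s :* (x :* w :+ y :* z :+ b :* (y :* w)))
               := y :* w :* (b :* s :+ c) :+ (x :* (s :* w :+ z) :+ s :* (y :* (s :* w :+ z)))) refl b c x y z w s ⟩
        y * w * (b * s + c) + (x * (s * w + z) + s * (y * (s * w + z))) ∎))

-- Powers of the Frobenius map, and quadratics over 𝔽_q splitting in K.

-- If t² = b t + c had no root in 𝔽_{q⁶}, then adjoining a root ω would give a
-- field.  Since b, c ∈ 𝔽_q, ω^q is one of the two roots ω, b - ω, hence
-- ω^{q²} = ω and X^{q⁶} - X would have q⁶ + 1 roots in that field.
module FrobeniusMap {q : ℕ} (q-primePower : IsPrimePower q) (K : FiniteField (q ℕ.^ 6)) where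
  open Geometry q K
  open FieldProperties K
  open Exp commutativeSemiring using (^-distrib-*; ^-assocʳ; ^-congʳ)
  open ≡-Reasoning
  private
    p e : ℕ
    p = proj₁ q-primePower
    e = suc (proj₁ (proj₂ q-primePower))
    p-prime : Prime p
    p-prime = proj₁ (proj₂ (proj₂ q-primePower))
    q≡pᵉ : q ≡ p ℕ.^ e
    q≡pᵉ = proj₂ (proj₂ (proj₂ q-primePower))
    module × = Mult semiring

    q^m≡p^em : ∀ m → q ℕ.^ m ≡ p ℕ.^ (e ℕ.* m)
    q^m≡p^em m = trans (cong (ℕ._^ m) q≡pᵉ) (ℕ.^-*-assoc p e m)

    ×1-^ : ∀ m → (p ℕ.^ m) ×.× 1# ≡ (p ×.× 1#) ^ m
    ×1-^ zero    = +-identityʳ 1#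
    ×1-^ (suc m) = trans (×.×1-homo-* p (p ℕ.^ m)) (cong (p ×.× 1# *_) (×1-^ m))

    -- The element (p · 1)^{6e} = q⁶ · 1 is zero, whereas powers of a nonzero field element are
    -- nonzero.
    char : p ×.× 1# ≡ 0#
    char with p ×.× 1# ≟ 0#
    ... | yes p≡0 = p≡0
    ... | no  p≢0 = contradiction
      (trans (sym (×1-^ (e ℕ.* 6))) (trans (×.×-congˡ (sym (q^m≡p^em 6))) (order×1≡0 K)))
      (^-≢0 K (e ℕ.* 6) p≢0)

  fr : ℕ → Carrier → Carrier
  fr m x = x ^ (q ℕ.^ m)

  fr-+ : ∀ m x y → fr m (x + y) ≡ fr m x + fr m y
  fr-+ m x y = subst (λ n → (x + y) ^ n ≡ x ^ n + y ^ n) (sym (q^m≡p^em m))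
    (Frobenius.^pᵐ-homo-+ commutativeRing p-prime char (e ℕ.* m) x y)

  fr-* : ∀ m x y → fr m (x * y) ≡ fr m x * fr m y
  fr-* m x y = ^-distrib-* x y (q ℕ.^ m)

  fr-fr : ∀ m n x → fr n (fr m x) ≡ fr (m ℕ.+ n) x
  fr-fr m n x = trans (^-assocʳ x (q ℕ.^ m) (q ℕ.^ n)) (^-congʳ x (sym (ℕ.^-distribˡ-+-* q m n)))

  fr-6 : ∀ x → fr 6 x ≡ x
  fr-6 = ^order K

  fr-1# : ∀ m → fr m 1# ≡ 1#
  fr-1# m = 1^ (q ℕ.^ m)
    where
    1^ : ∀ n → 1# ^ n ≡ 1#
    1^ zero    = refl
    1^ (suc n) = trans (*-identityˡ _) (1^ n)

  fr-0# : ∀ m → fr m 0# ≡ 0#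
  fr-0# m = +-identityˡ-unique _ _ (trans (sym (fr-+ m 0# 0#)) (cong (fr m) (+-identityˡ 0#)))

  fr-neg : ∀ m x → fr m (- x) ≡ - fr m x
  fr-neg m x = +-inverseʳ-unique _ _
    (trans (sym (fr-+ m x (- x))) (trans (cong (fr m) (-‿inverseʳ x)) (fr-0# m)))

  fr-sum : ∀ m {n} (f : Fin n → Carrier) → fr m (sum f) ≡ sum (fr m ∘ f)
  fr-sum m {zero}  f = fr-0# m
  fr-sum m {suc n} f = trans (fr-+ m _ _) (cong (fr m (f zero) +_) (fr-sum m (f ∘ suc)))

  fr-≢0 : ∀ m {x} → x ≢ 0# → fr m x ≢ 0#
  fr-≢0 m = ^-≢0 K (q ℕ.^ m)

  module _ {b c : Carrier} (b∈𝔽 : fr 1 b ≡ b) (c∈𝔽 : fr 1 c ≡ c) where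
    private
      module NoRoot (rootless : ∀ t → t * t ≢ b * t + c) where
        open QuadraticExtension K b c
        open Solver commutativeSemiring using (solve; con; _:=_; _:+_; _:*_)
        private module R = CommutativeRing extension
        module RExp = Exp R.commutativeSemiring
        module R× = Mult R.semiring
        open Polynomials extension (extension-noZeroDivisors rootless) using (eval; distinctRoots)

        ι : Carrier → R.Carrier
        ι x = x , 0#

        ω : R.Carrier
        ω = 0# , 1#

        ι-+ : ∀ x y → ι (x + y) R.≈ ι x R.+ ι y
        ι-+ x y = refl , sym (+-identityʳ 0#)

        ι-* : ∀ x y → ι (x * y) R.≈ ι x R.* ι y
        ι-* x y = sym (solve 3 (λ c x y → x :* y :+ c :* (con 0 :* con 0) := x :* y) refl c x y)
                , sym (solve 3 (λ b x y → x :* con 0 :+ con 0 :* y :+ b :* (con 0 :* con 0) := con 0) refl b x y)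

        ι-^ : ∀ x n → ι (x ^ n) R.≈ ι x RExp.^ n
        ι-^ x zero    = refl , refl
        ι-^ x (suc n) = R.trans (ι-* x (x ^ n)) (R.*-congˡ (ι-^ x n))

        ι-× : ∀ n → n R×.× R.1# R.≈ ι (n ×.× 1#)
        ι-× zero    = refl , refl
        ι-× (suc n) = R.trans (R.+-congˡ (ι-× n)) (R.sym (ι-+ 1# (n ×.× 1#)))

        φ : R.Carrier → R.Carrier
        φ u = u RExp.^ (q ℕ.^ 1)

        φ-+ : ∀ u v → φ (u R.+ v) R.≈ φ u R.+ φ v
        φ-+ u v = subst (λ n → (u R.+ v) RExp.^ n R.≈ u RExp.^ n R.+ v RExp.^ n) (sym (q^m≡p^em 1))
          (Frobenius.^pᵐ-homo-+ extension p-prime (R.trans (ι-× p) (char , refl)) (e ℕ.* 1) u v)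

        φ-* : ∀ u v → φ (u R.* v) R.≈ φ u R.* φ v
        φ-* u v = RExp.^-distrib-* u v (q ℕ.^ 1)

        φ-cong : ∀ {u v} → u R.≈ v → φ u R.≈ φ v
        φ-cong = RExp.^-congˡ (q ℕ.^ 1)

        φ-ι : ∀ {x} → fr 1 x ≡ x → φ (ι x) R.≈ ι x
        φ-ι {x} x∈𝔽 = R.trans (R.sym (ι-^ x (q ℕ.^ 1))) (x∈𝔽 , refl)

        ω-root : ω R.* ω R.≈ ι b R.* ω R.+ ι c
        ω-root =
            solve 2 (λ b c → con 0 :* con 0 :+ c :* (con 1 :* con 1) := b :* con 0 :+ c :* (con 0 :* con 1) :+ c) refl b c
          , solve 1 (λ b → con 0 :* con 1 :+ con 1 :* con 0 :+ b :* (con 1 :* con 1)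
                           := b :* con 1 :+ con 0 :* con 0 :+ b :* (con 0 :* con 1) :+ con 0) refl b

        _R≟_ : ∀ u v → Dec (u R.≈ v)
        (x , y) R≟ (x′ , y′) with x ≟ x′ | y ≟ y′
        ... | yes x≡x′ | yes y≡y′ = yes (x≡x′ , y≡y′)
        ... | no  x≢x′ | _        = no λ { (eq , _) → x≢x′ eq }
        ... | yes _    | no  y≢y′ = no λ { (_ , eq) → y≢y′ eq }

        φφω≈ω : φ (φ ω) R.≈ ω
        φφω≈ω = QuadraticRoots.φφr≈r extension (extension-noZeroDivisors rootless) _R≟_ (ι b) (ι c)
          (record { φ = φ ; φ-cong = λ {u} {v} → φ-cong {u} {v} ; φ-+ = φ-+ ; φ-* = φ-* })
          (φ-ι {b} b∈𝔽) (φ-ι {c} c∈𝔽) ω-root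

        ω^q²ᵐ≈ω : ∀ m → ω RExp.^ ((q ℕ.^ 2) ℕ.^ m) R.≈ ω
        ω^q²ᵐ≈ω zero    = R.*-identityʳ ω
        ω^q²ᵐ≈ω (suc m) = R.trans (R.sym (RExp.^-assocʳ ω (q ℕ.^ 2) _))
          (R.trans (RExp.^-congˡ ((q ℕ.^ 2) ℕ.^ m) ω^q²≈ω) (ω^q²ᵐ≈ω m))
          where
          ω^q²≈ω : ω RExp.^ (q ℕ.^ 2) R.≈ ω
          ω^q²≈ω = R.trans (RExp.^-congʳ ω (ℕ.^-distribˡ-+-* q 1 1))
            (R.trans (R.sym (RExp.^-assocʳ ω (q ℕ.^ 1) (q ℕ.^ 1))) φφω≈ω)

        ω^q⁶≈ω : ω RExp.^ (q ℕ.^ 6) R.≈ ω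
        ω^q⁶≈ω = subst (λ n → ω RExp.^ n R.≈ ω) (ℕ.^-*-assoc q 2 3) (ω^q²ᵐ≈ω 3)

        monomial : ∀ n → Fin (suc n) → R.Carrier
        monomial zero    = λ _ → R.1#
        monomial (suc n) = R.0# ∷ monomial n

        eval-monomial : ∀ n u → eval (monomial n) u R.≈ u RExp.^ n
        eval-monomial zero    u = R.trans (R.+-congˡ (R.zeroʳ u)) (R.+-identityʳ R.1#)
        eval-monomial (suc n) u = R.trans (R.+-identityˡ _) (R.*-congˡ (eval-monomial n u))

        points : Fin (suc (q ℕ.^ 6)) → R.Carrier
        points = ω ∷ (ι ∘ elements)

        points-injective : ∀ {i j} → points i R.≈ points j → i ≡ j
        points-injective {zero}  {zero}  _       = refl
        points-injective {zero}  {suc j} (_ , 1≡0) = contradiction 1≡0 1≢0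
        points-injective {suc i} {zero}  (_ , 0≡1) = contradiction (sym 0≡1) 1≢0
        points-injective {suc i} {suc j} (eq , _) =
          cong suc (trans (sym (index-elements i)) (trans (cong index eq) (index-elements j)))

        points-fixed : ∀ i → points i RExp.^ (q ℕ.^ 6) R.≈ points i
        points-fixed zero    = ω^q⁶≈ω
        points-fixed (suc i) = R.trans (R.sym (ι-^ (elements i) (q ℕ.^ 6))) (^order K (elements i) , refl)

        -- X^N - X has N + 1 coefficients, so N + 1 distinct roots would annihilate all of them,
        -- including the -1 at X. The exponent is a variable so that it can be split; 1 < N keeps
        -- the terms X and X^N apart.
        tooManyRoots : ∀ {N} → 1 ℕ.< N → (x : Fin (suc N) → R.Carrier) →
          (∀ {i j} → x i R.≈ x j → i ≡ j) → ¬ (∀ i → x i RExp.^ N R.≈ x i)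
        tooManyRoots {suc zero} (ℕ.s≤s ()) _ _ _
        tooManyRoots {suc (suc m)} _ x x-inj fixed = 1≢0
          (trans (sym (-‿involutive 1#)) (trans (cong -_ (proj₁ -1≈0)) -0#≈0#))
          where
          -- X^N - X
          a : Fin (suc (suc (suc m))) → R.Carrier
          a = R.0# ∷ (R.- R.1#) ∷ monomial m
          eval-a : ∀ u → u RExp.^ suc (suc m) R.≈ u → eval a u R.≈ R.0#
          eval-a u fixed = R.trans (R.+-identityˡ _) (R.trans (R.distribˡ u _ _)
            (R.trans (R.+-cong (R.trans (R.sym (RingProperties.-‿distribʳ-* R.ring u R.1#)) (R.-‿cong (R.*-identityʳ u)))
                               (R.trans (R.*-congˡ (R.*-congˡ (eval-monomial m u))) fixed))
                     (R.-‿inverseˡ u)))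
          -1≈0 : R.- R.1# R.≈ R.0#
          -1≈0 = distinctRoots a x x-inj (λ i → eval-a (x i) (fixed i)) (suc zero)

        order>1 : ∀ {N} → (Fin N → Carrier) → (f : Carrier → Fin N) → (∀ {x y} → f x ≡ f y → x ≡ y) → 1 ℕ.< N
        order>1 {zero} _ f _ = contradiction (f 0#) Fin.¬Fin0
        order>1 {suc zero} _ f f-inj = contradiction (f-inj (trans (only _) (sym (only _)))) 1≢0
          where
          only : (i : Fin 1) → i ≡ zero
          only zero = refl
        order>1 {suc (suc _)} _ _ _ = ℕ.s≤s (ℕ.s≤s ℕ.z≤n)

        absurd : ∀ {A : Set} → A
        absurd = contradiction points-fixed (tooManyRoots
          (order>1 elements index λ {x} {y} eq → trans (sym (elements-index x)) (trans (cong elements eq) (elements-index y)))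
          points points-injective)

    abstract
      -- A search through the field either finds a root or yields the hypothesis `rootless`. The
      -- result is opaque, so conversion checking never runs the search.
      quadraticRoot : ∃ λ t → t * t ≡ b * t + c
      quadraticRoot with Fin.any? (λ i → elements i * elements i ≟ b * elements i + c)
      ... | yes (i , eq) = elements i , eq
      ... | no  ¬root = NoRoot.absurd λ t eq →
        ¬root (index t , subst (λ s → s * s ≡ b * s + c) (sym (elements-index t)) eq)

-- The pigeonhole principle, and linear algebra derived from it.

-- A missed value could be punched out, leaving an injection of `Fin (suc n)` into `Fin n`.
injective⇒surjective : ∀ {n} (f : Fin n → Fin n) → (∀ {i j} → f i ≡ f j → i ≡ j) → ∀ j → ∃ λ i → f i ≡ j
injective⇒surjective {suc n} f f-inj j with Fin.any? (λ i → f i Fin.≟ j)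
... | yes hit = hit
... | no miss = contradiction
  (Fin.injective⇒≤ λ {i} {i′} eq → f-inj (Fin.punchOut-injective (j≢f i) (j≢f i′) eq)) ℕ.1+n≰n
  where
  j≢f : ∀ i → j ≢ f i
  j≢f i j≡fi = miss (i , sym j≡fi)

funToFin-cong : ∀ {m n} {f g : Fin m → Fin n} → f ≗ g → funToFin f ≡ funToFin g
funToFin-cong {zero}  f≗g = refl
funToFin-cong {suc m} f≗g = cong₂ combine (f≗g zero) (funToFin-cong (f≗g ∘ suc))

module LinearAlgebra (q : ℕ) (K : FiniteField (q ℕ.^ 6)) where
  open Geometry q K
  open FieldProperties K
  open Sum semiring using (sum-cong-≗; ∑-distrib-+; ∑-comm; *-distribˡ-sum; *-distribʳ-sum; sum-replicate-zero)
  open ≡-Reasoning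

  private
    variable
      n d e : ℕ

  infixl 6 _⊕_
  infixr 7 _⊙_

  _⊕_ : Vec n → Vec n → Vec n
  (v ⊕ w) i = v i + w i

  _⊙_ : Carrier → Vec n → Vec n
  (s ⊙ v) i = s * v i

  𝟎 : Vec n
  𝟎 _ = 0#

  δ : Fin n → Vec n
  δ zero    = 1# ∷ 𝟎
  δ (suc i) = 0# ∷ δ i

  combination-cong : {b b′ : Vector (Vec n) d} {c c′ : Vec d} → (∀ j → b j ≗ b′ j) → c ≗ c′ →
                     combination b c ≗ combination b′ c′
  combination-cong b≗b′ c≗c′ i = sum-cong-≗ (λ j → cong₂ _*_ (c≗c′ j) (b≗b′ j i))

  combination-congʳ : (b : Vector (Vec n) d) {c c′ : Vec d} → c ≗ c′ → combination b c ≗ combination b c′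
  combination-congʳ b = combination-cong {b = b} (λ _ _ → refl)

  combination-congˡ : (b b′ : Vector (Vec n) d) (c : Vec d) → (∀ j → b j ≗ b′ j) →
                      combination b c ≗ combination b′ c
  combination-congˡ b b′ c b≗b′ = combination-cong {b = b} {b′} {c} b≗b′ (λ _ → refl)

  combination-⊕ : (b : Vector (Vec n) d) (c c′ : Vec d) →
                  combination b (c ⊕ c′) ≗ combination b c ⊕ combination b c′
  combination-⊕ b c c′ i = trans (sum-cong-≗ (λ j → distribʳ (b j i) (c j) (c′ j)))
                                 (∑-distrib-+ (λ j → c j * b j i) (λ j → c′ j * b j i))

  combination-⊙ : (b : Vector (Vec n) d) (s : Carrier) (c : Vec d) →
                  combination b (s ⊙ c) ≗ s ⊙ combination b c
  combination-⊙ b s c i = trans (sum-cong-≗ (λ j → *-assoc s (c j) (b j i)))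
                                (sym (*-distribˡ-sum s (λ j → c j * b j i)))

  combination-𝟎 : (b : Vector (Vec n) d) → combination b 𝟎 ≗ 𝟎
  combination-𝟎 {d = d} b i = trans (sum-cong-≗ (λ j → zeroˡ (b j i))) (sum-replicate-zero d)

  combination-combination : (b : Vector (Vec n) e) (A : Vector (Vec e) d) (c : Vec d) →
    combination (combination b ∘ A) c ≗ combination b (combination A c)
  combination-combination b A c i = begin
    sum (λ j → c j * sum (λ k → A j k * b k i))
      ≡⟨ sum-cong-≗ (λ j → *-distribˡ-sum (c j) (λ k → A j k * b k i)) ⟩
    sum (λ j → sum (λ k → c j * (A j k * b k i)))
      ≡⟨ ∑-comm (λ j k → c j * (A j k * b k i)) ⟩
    sum (λ k → sum (λ j → c j * (A j k * b k i)))
      ≡⟨ sum-cong-≗ (λ k → sum-cong-≗ (λ j → *-assoc (c j) (A j k) (b k i))) ⟨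
    sum (λ k → sum (λ j → c j * A j k * b k i))
      ≡⟨ sum-cong-≗ (λ k → *-distribʳ-sum (b k i) (λ j → c j * A j k)) ⟨
    sum (λ k → sum (λ j → c j * A j k) * b k i) ∎

  combination-δ : (b : Vector (Vec n) d) (j : Fin d) → combination b (δ j) ≗ b j
  combination-δ b zero i = trans (cong₂ _+_ (*-identityˡ _) (combination-𝟎 (b ∘ suc) i)) (+-identityʳ _)
  combination-δ b (suc j) i = trans (cong₂ _+_ (zeroˡ _) (combination-δ (b ∘ suc) j i)) (+-identityˡ _)

  combination-of-δ : (c : Vec d) → combination δ c ≗ c
  combination-of-δ {d = suc d} c zero = trans (cong₂ _+_ (*-identityʳ _)
    (trans (sum-cong-≗ (λ j → zeroʳ (c (suc j)))) (sum-replicate-zero d))) (+-identityʳ _)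
  combination-of-δ c (suc i) = trans (cong₂ _+_ (zeroʳ _) (combination-of-δ (c ∘ suc) i)) (+-identityˡ _)

  combination-++ : (a : Vector (Vec n) d) (b : Vector (Vec n) e) (c : Vec (d ℕ.+ e)) →
    combination (a ++ b) c ≗ combination a (c ∘ (_↑ˡ e)) ⊕ combination b (c ∘ (d ↑ʳ_))
  combination-++ {d = zero}  a b c i = sym (+-identityˡ _)
  combination-++ {d = suc d} {e = e} a b c i = begin
    c zero * a zero i + sum (λ j → c (suc j) * (a ++ b) (suc j) i)
      ≡⟨ cong (c zero * a zero i +_) (sum-cong-≗ (λ j → cong (λ v → c (suc j) * v i) (++-suc j))) ⟩
    c zero * a zero i + combination ((a ∘ suc) ++ b) (c ∘ suc) i
      ≡⟨ cong (c zero * a zero i +_) (combination-++ (a ∘ suc) b (c ∘ suc) i) ⟩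
    c zero * a zero i + (combination (a ∘ suc) (c ∘ suc ∘ (_↑ˡ e)) i + combination b (c ∘ suc ∘ (d ↑ʳ_)) i)
      ≡⟨ +-assoc _ _ _ ⟨
    combination a (c ∘ (_↑ˡ e)) i + combination b (c ∘ (suc d ↑ʳ_)) i ∎
    where
    ++-suc : ∀ j → (a ++ b) (suc j) ≡ ((a ∘ suc) ++ b) j
    ++-suc j with splitAt d j
    ... | inj₁ _ = refl
    ... | inj₂ _ = refl

  combination-++-++ : (a : Vector (Vec n) d) (b : Vector (Vec n) e) (x : Vec d) (y : Vec e) →
    combination (a ++ b) (x ++ y) ≗ combination a x ⊕ combination b y
  combination-++-++ {d = d} {e = e} a b x y i = trans (combination-++ a b (x ++ y) i)
    (cong₂ _+_ (combination-congʳ a (lookup-++ˡ x y) i) (combination-congʳ b (lookup-++ʳ x y) i))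

  zero⊎nonzero : (v : Vec n) → v ≗ 𝟎 ⊎ ∃ λ i → v i ≢ 0#
  zero⊎nonzero v with Fin.all? (λ i → v i ≟ 0#)
  ... | yes v≗𝟎 = inj₁ v≗𝟎
  ... | no v≢𝟎  = inj₂ (Fin.¬∀⟶∃¬ _ _ (λ i → v i ≟ 0#) v≢𝟎)

  point : (v : Vec n) → ¬ v ≗ 𝟎 → Point n
  point v v≢𝟎 = record { coords = v ; nonzero = Fin.¬∀⟶∃¬ _ _ (λ i → v i ≟ 0#) v≢𝟎 }

  coords≢𝟎 : (X : Point n) → ¬ coords X ≗ 𝟎
  coords≢𝟎 X X≗𝟎 = proj₂ (nonzero X) (X≗𝟎 (proj₁ (nonzero X)))

  ∼-sym : {v w : Vec n} → v ∼ w → w ∼ v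
  ∼-sym (c , c≢0 , v≗cw) = inv c c≢0 , inv-≢0 c c≢0 , λ i →
    trans (sym (inv-cancel-* c c≢0 _)) (cong (inv c c≢0 *_) (sym (v≗cw i)))

  ∼-trans : {u v w : Vec n} → u ∼ v → v ∼ w → u ∼ w
  ∼-trans (c , c≢0 , u≗cv) (d , d≢0 , v≗dw) = c * d , *-≢0 c≢0 d≢0 , λ i →
    trans (u≗cv i) (trans (cong (c *_) (v≗dw i)) (sym (*-assoc c d _)))

  ≗⇒∼ : {v w : Vec n} → v ≗ w → v ∼ w
  ≗⇒∼ v≗w = 1# , 1≢0 , λ i → trans (v≗w i) (sym (*-identityˡ _))

  ∼-≢𝟎 : {v w : Vec n} → v ∼ w → ¬ v ≗ 𝟎 → ¬ w ≗ 𝟎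
  ∼-≢𝟎 (c , _ , v≗cw) v≢𝟎 w≗𝟎 = v≢𝟎 λ i → trans (v≗cw i) (trans (cong (c *_) (w≗𝟎 i)) (zeroʳ c))

  ⊙⇒∼ : {v w : Vec n} (c : Carrier) → ¬ v ≗ 𝟎 → v ≗ c ⊙ w → v ∼ w
  ⊙⇒∼ c v≢𝟎 v≗cw = c , (λ { refl → v≢𝟎 λ i → trans (v≗cw i) (zeroˡ _) }) , v≗cw

  -- The same condition as `⟨_⟩`, but on vectors, so that it includes the zero vector; `Z ∈ ⟨ b ⟩`
  -- unfolds to `Span b (coords Z)`.
  Span : Vector (Vec n) d → Vec n → Set
  Span b v = ∃ λ c → v ≗ combination b c

  Span-member : (b : Vector (Vec n) d) (j : Fin d) → Span b (b j)
  Span-member b j = δ j , λ i → sym (combination-δ b j i)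

  Span-cong : (b : Vector (Vec n) d) {v w : Vec n} → v ≗ w → Span b v → Span b w
  Span-cong b v≗w (c , v≗bc) = c , λ i → trans (sym (v≗w i)) (v≗bc i)

  Span-⊕ : (b : Vector (Vec n) d) {v w : Vec n} → Span b v → Span b w → Span b (v ⊕ w)
  Span-⊕ b (c , v≗) (c′ , w≗) = c ⊕ c′ , λ i → trans (cong₂ _+_ (v≗ i) (w≗ i)) (sym (combination-⊕ b c c′ i))

  Span-⊙ : (b : Vector (Vec n) d) (s : Carrier) {v : Vec n} → Span b v → Span b (s ⊙ v)
  Span-⊙ b s (c , v≗) = s ⊙ c , λ i → trans (cong (s *_) (v≗ i)) (sym (combination-⊙ b s c i))

  Span-∼ : (b : Vector (Vec n) d) {v w : Vec n} → v ∼ w → Span b w → Span b v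
  Span-∼ b (s , _ , v≗sw) w∈b = Span-cong b (λ i → sym (v≗sw i)) (Span-⊙ b s w∈b)

  Span-trans : (b : Vector (Vec n) e) (a : Vector (Vec n) d) {v : Vec n} →
               (∀ j → Span b (a j)) → Span a v → Span b v
  Span-trans b a {v} a⊆b (c , v≗ac) = combination A c , λ i → begin
    v i                                 ≡⟨ v≗ac i ⟩
    combination a c i                   ≡⟨ combination-cong (λ j → proj₂ (a⊆b j)) (λ _ → refl) i ⟩
    combination (combination b ∘ A) c i ≡⟨ combination-combination b A c i ⟩
    combination b (combination A c) i   ∎
    where A = proj₁ ∘ a⊆b

  independent-injective : (b : Vector (Vec n) d) → Independent b → ∀ c c′ →
                          combination b c ≗ combination b c′ → c ≗ c′
  independent-injective b b-ind c c′ eq j =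
    x∙y⁻¹≈ε⇒x≈y _ _ (trans (cong (c j +_) (sym (-1*x≈-x (c′ j)))) (b-ind (c ⊕ - 1# ⊙ c′) (λ i → begin
      combination b (c ⊕ - 1# ⊙ c′) i                   ≡⟨ combination-⊕ b c (- 1# ⊙ c′) i ⟩
      combination b c i + combination b (- 1# ⊙ c′) i   ≡⟨ cong₂ _+_ (eq i) (combination-⊙ b (- 1#) c′ i) ⟩
      combination b c′ i + - 1# * combination b c′ i    ≡⟨ cong (combination b c′ i +_) (-1*x≈-x _) ⟩
      combination b c′ i - combination b c′ i           ≡⟨ -‿inverseʳ _ ⟩
      0# ∎) j))

  private
    encode : Vec d → Fin ((q ℕ.^ 6) ℕ.^ d)
    encode v = funToFin (index ∘ v)

    decode : Fin ((q ℕ.^ 6) ℕ.^ d) → Vec d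
    decode i = elements ∘ finToFun i

    decode-encode : (v : Vec d) → decode (encode v) ≗ v
    decode-encode v i = trans (cong elements (Fin.finToFun-funToFin (index ∘ v) i)) (elements-index (v i))

    encode-decode : (i : Fin ((q ℕ.^ 6) ℕ.^ d)) → encode {d} (decode i) ≡ i
    encode-decode {d} i = trans (funToFin-cong {d} (λ j → index-elements (finToFun i j))) (Fin.funToFin-finToFin {d} i)

    encode-cong : {v w : Vec d} → v ≗ w → encode v ≡ encode w
    encode-cong v≗w = funToFin-cong (cong index ∘ v≗w)

    encode-injective : {v w : Vec d} → encode v ≡ encode w → v ≗ w
    encode-injective {v = v} {w} eq i =
      trans (sym (decode-encode v i)) (trans (cong (λ e → decode e i) eq) (decode-encode w i))

  abstract
    -- K^d has (q⁶)^d elements; numbering them turns `f` into an injective self-map of a finite set.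
    endo-surjective : (f : Vec d → Vec d) → (∀ {v w} → f v ≗ f w → v ≗ w) → ∀ v → ∃ λ w → f w ≗ v
    endo-surjective {d} f f-inj v
      with injective⇒surjective {(q ℕ.^ 6) ℕ.^ d} (λ i → encode (f (decode i)))
        (λ {i} {j} eq → trans (sym (encode-decode {d} i)) (trans (encode-cong (f-inj (encode-injective eq))) (encode-decode {d} j)))
        (encode v)
    ... | i , eq = decode i , encode-injective eq

  abstract
    -- All (q⁶)^d coefficient vectors are tried.
    span? : (b : Vector (Vec n) d) (v : Vec n) → Dec (Span b v)
    span? {d = d} b v = map′
      (λ { (i , eq) → decode {d} i , eq })
      (λ { (c , eq) → encode c , λ i → trans (eq i) (combination-congʳ b (λ j → sym (decode-encode c j)) i) })
      (Fin.any? λ i → Fin.all? λ k → v k ≟ combination b (decode {d} i) k)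

  abstract
    -- This replaces the comparison of dimensions. The matrix `A` writing `a` in terms of `b` is
    -- injective on K^d because `a` is independent, hence surjective; a preimage of the j-th unit
    -- vector writes `b j` in terms of `a`.
    exchange : ∀ {n d} (a b : Vector (Vec n) d) → Independent a → (∀ j → Span b (a j)) →
               Independent b × (∀ j → Span a (b j))
    exchange {n} {d} a b a-ind a⊆b = b-ind , b⊆a
      where
      A : Fin d → Vec d
      A = proj₁ ∘ a⊆b
      a≗bA : ∀ c → combination a c ≗ combination b (combination A c)
      a≗bA c i = trans (combination-cong (λ j → proj₂ (a⊆b j)) (λ _ → refl) i) (combination-combination b A c i)
      A-onto : ∀ v → ∃ λ c → combination A c ≗ v
      A-onto = endo-surjective (combination A) (λ {c} {c′} eq → independent-injective a a-ind c c′
        λ i → trans (a≗bA c i) (trans (combination-congʳ b eq i) (sym (a≗bA c′ i))))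
      b⊆a : ∀ j → Span a (b j)
      b⊆a j with A-onto (δ j)
      ... | c , Ac≗δ = c , λ i → trans (sym (combination-δ b j i)) (trans (combination-congʳ b (sym ∘ Ac≗δ) i) (sym (a≗bA c i)))
      b-ind : Independent b
      b-ind c bc≗𝟎 j with A-onto c
      ... | c′ , Ac′≗c = trans (sym (Ac′≗c j)) (trans
        (combination-cong {b = A} (λ _ _ → refl) (a-ind c′ λ i → trans (a≗bA c′ i) (trans (combination-congʳ b Ac′≗c i) (bc≗𝟎 i))) j)
        (combination-𝟎 A j))

  independent-tail : (a : Vector (Vec n) (suc d)) → Independent a → Independent (a ∘ suc)
  independent-tail a a-ind c ac≗𝟎 j =
    a-ind (0# ∷ c) (λ i → trans (cong₂ _+_ (zeroˡ _) (ac≗𝟎 i)) (+-identityˡ 0#)) (suc j)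

  head∉tail : (a : Vector (Vec n) (suc d)) → Independent a → ¬ Span (a ∘ suc) (a zero)
  head∉tail a a-ind (c , a₀≗) = 1≢0 (a-ind (1# ∷ - 1# ⊙ c) (λ i → begin
    1# * a zero i + combination (a ∘ suc) (- 1# ⊙ c) i ≡⟨ cong₂ _+_ (trans (*-identityˡ _) (a₀≗ i))
                                                            (trans (combination-⊙ (a ∘ suc) (- 1#) c i) (-1*x≈-x _)) ⟩
    combination (a ∘ suc) c i - combination (a ∘ suc) c i ≡⟨ -‿inverseʳ _ ⟩
    0# ∎) zero)

  abstract
    -- If all d + 1 vectors were in the span of `b`, then by `exchange` the last d of them would
    -- span `b`, and the first would depend on them.
    outside : (a : Vector (Vec n) (suc d)) (b : Vector (Vec n) d) → Independent a → ∃ λ j → ¬ Span b (a j)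
    outside a b a-ind = Fin.¬∀⟶∃¬ _ _ (λ j → span? b (a j)) λ a⊆b →
      head∉tail a a-ind (Span-trans (a ∘ suc) b (proj₂ (exchange (a ∘ suc) b (independent-tail a a-ind) (a⊆b ∘ suc))) (a⊆b zero))

  independent-∷ : (b : Vector (Vec n) d) (w : Vec n) → Independent b → ¬ Span b w → Independent (w ∷ b)
  independent-∷ b w b-ind w∉b c cwb≗𝟎 = λ { zero → c₀≡0 ; (suc j) → b-ind (c ∘ suc) rest j }
    where
    c₀≡0 : c zero ≡ 0#
    c₀≡0 with c zero ≟ 0#
    ... | yes eq = eq
    ... | no c₀≢0 = contradiction (Span-cong b solved (Span-⊙ b (- inv _ c₀≢0) (c ∘ suc , λ _ → refl))) w∉b
      where
      solved : - inv _ c₀≢0 ⊙ combination b (c ∘ suc) ≗ w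
      solved i = begin
        - inv _ c₀≢0 * combination b (c ∘ suc) i   ≡⟨ -‿distribˡ-* _ _ ⟨
        - (inv _ c₀≢0 * combination b (c ∘ suc) i) ≡⟨ -‿distribʳ-* _ _ ⟩
        inv _ c₀≢0 * - combination b (c ∘ suc) i   ≡⟨ cong (inv _ c₀≢0 *_) (+-inverseˡ-unique _ _ (cwb≗𝟎 i)) ⟨
        inv _ c₀≢0 * (c zero * w i)                ≡⟨ inv-cancel-* _ c₀≢0 _ ⟩
        w i ∎
    rest : combination b (c ∘ suc) ≗ 𝟎
    rest i = trans (sym (trans (cong (λ s → s * w i + combination b (c ∘ suc) i) c₀≡0)
      (trans (cong (_+ combination b (c ∘ suc) i) (zeroˡ (w i))) (+-identityˡ _)))) (cwb≗𝟎 i)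

  δ-independent : Independent (δ {n})
  δ-independent c δc≗𝟎 j = trans (sym (combination-of-δ c j)) (δc≗𝟎 j)

  δ≢𝟎 : (j : Fin n) → ¬ δ j ≗ 𝟎
  δ≢𝟎 zero    δ≗𝟎 = 1≢0 (δ≗𝟎 zero)
  δ≢𝟎 (suc j) δ≗𝟎 = δ≢𝟎 j (δ≗𝟎 ∘ suc)

  independent⇒≢𝟎 : (b : Vector (Vec n) d) → Independent b → ∀ j → ¬ b j ≗ 𝟎
  independent⇒≢𝟎 b b-ind j bj≗𝟎 = δ≢𝟎 j (b-ind (δ j) (λ i → trans (combination-δ b j i) (bj≗𝟎 i)))

-- Subfields, quadratic forms, and a frame adapted to π and ℓ∞.

module Conics {q : ℕ} (q-primePower : IsPrimePower q) (K : FiniteField (q ℕ.^ 6)) where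
  open Geometry q K
  open FieldProperties K
  open LinearAlgebra q K
  open FrobeniusMap q-primePower K
  open Sum semiring using (sum-cong-≗; *-distribˡ-sum; sum-replicate-zero)
  open ≡-Reasoning

  private
    variable
      n d e k : ℕ

  𝔽-+ : ∀ k {x y} → x ∈ 𝔽 k → y ∈ 𝔽 k → x + y ∈ 𝔽 k
  𝔽-+ k x∈ y∈ = trans (fr-+ k _ _) (cong₂ _+_ x∈ y∈)

  𝔽-* : ∀ k {x y} → x ∈ 𝔽 k → y ∈ 𝔽 k → x * y ∈ 𝔽 k
  𝔽-* k x∈ y∈ = trans (fr-* k _ _) (cong₂ _*_ x∈ y∈)

  𝔽-neg : ∀ k {x} → x ∈ 𝔽 k → - x ∈ 𝔽 k
  𝔽-neg k x∈ = trans (fr-neg k _) (cong -_ x∈)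

  𝔽-inv : ∀ k {x} (x≢0 : x ≢ 0#) → x ∈ 𝔽 k → inv x x≢0 ∈ 𝔽 k
  𝔽-inv k {x} x≢0 x∈ = *-cancelˡ-≢0 x≢0 (begin
    x * fr k (inv x x≢0)      ≡⟨ cong (_* fr k (inv x x≢0)) x∈ ⟨
    fr k x * fr k (inv x x≢0) ≡⟨ fr-* k x _ ⟨
    fr k (x * inv x x≢0)      ≡⟨ cong (fr k) (inv-inverseʳ x x≢0) ⟩
    fr k 1#                   ≡⟨ fr-1# k ⟩
    1#                        ≡⟨ inv-inverseʳ x x≢0 ⟨
    x * inv x x≢0             ∎)

  𝔽-sum : ∀ k (f : Vec n) → EntriesIn k f → sum f ∈ 𝔽 k
  𝔽-sum k f f∈ = trans (fr-sum k f) (sum-cong-≗ f∈)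

  𝔽₁⊆𝔽 : ∀ k {x} → x ∈ 𝔽 1 → x ∈ 𝔽 k
  𝔽₁⊆𝔽 zero    {x} x∈ = *-identityʳ x
  𝔽₁⊆𝔽 (suc k) {x} x∈ = trans (sym (fr-fr 1 k x)) (trans (cong (fr k) x∈) (𝔽₁⊆𝔽 k x∈))

  frob-combination : ∀ m (b : Vector (Vec n) d) (c : Vec d) →
    frob m (combination b c) ≗ combination (frob m ∘ b) (frob m c)
  frob-combination m b c i = trans (fr-sum m (λ j → c j * b j i)) (sum-cong-≗ (λ j → fr-* m (c j) (b j i)))

  combination-rational : ∀ k (b : Vector (Vec n) d) (c : Vec d) →
    (∀ j → EntriesIn k (b j)) → EntriesIn k c → EntriesIn k (combination b c)
  combination-rational k b c b∈ c∈ i = 𝔽-sum k (λ j → c j * b j i) (λ j → 𝔽-* k (c∈ j) (b∈ j i))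

  δ-rational : ∀ k (i : Fin n) → EntriesIn k (δ i)
  δ-rational k zero    zero    = fr-1# k
  δ-rational k zero    (suc j) = fr-0# k
  δ-rational k (suc i) zero    = fr-0# k
  δ-rational k (suc i) (suc j) = δ-rational k i j

  -- By uniqueness of coordinates these are fixed by the Frobenius map.
  coefficients-rational : ∀ k (b : Vector (Vec n) d) (c : Vec d) → Independent b →
    (∀ j → EntriesIn k (b j)) → EntriesIn k (combination b c) → EntriesIn k c
  coefficients-rational k b c b-ind b∈ bc∈ = independent-injective b b-ind (frob k c) c λ i → begin
    combination b (frob k c) i            ≡⟨ combination-cong (λ j i → sym (b∈ j i)) (λ _ → refl) i ⟩
    combination (frob k ∘ b) (frob k c) i ≡⟨ frob-combination k b c i ⟨
    frob k (combination b c) i            ≡⟨ bc∈ i ⟩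
    combination b c i                     ∎

  spans : (b : Vector (Vec n) n) → Independent b → ∀ v → Span b v
  spans b b-ind v = Span-trans b δ (proj₂ (exchange b δ b-ind (λ j → b j , sym ∘ combination-of-δ (b j))))
                                     (v , sym ∘ combination-of-δ v)

  bilinear : Matrix n → Vec n → Vec n → Carrier
  bilinear A x y = sum λ k → sum λ l → A k l * x k * y l

  private
    -- A linear functional as a family of vectors of length 1: its linearity then is the
    -- associativity of `combination`.
    dual : Vec n → Vector (Vec 1) n
    dual f k _ = f k

    pairing-combination : (f : Vec n) (b : Vector (Vec n) d) (c : Vec d) →
      sum (λ k → combination b c k * f k) ≡ sum (λ j → c j * sum (λ k → b j k * f k))
    pairing-combination f b c = sym (combination-combination (dual f) b c zero)

  bilinear-expandˡ : (A : Matrix n) (x y : Vec n) → bilinear A x y ≡ sum (λ k → x k * sum (λ l → A k l * y l))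
  bilinear-expandˡ A x y = sum-cong-≗ λ k → trans
    (sum-cong-≗ (λ l → trans (cong (_* y l) (*-comm (A k l) (x k))) (*-assoc (x k) (A k l) (y l))))
    (sym (*-distribˡ-sum (x k) (λ l → A k l * y l)))

  bilinear-combinationˡ : (A : Matrix n) (b : Vector (Vec n) d) (c : Vec d) (y : Vec n) →
    bilinear A (combination b c) y ≡ sum (λ j → c j * bilinear A (b j) y)
  bilinear-combinationˡ A b c y = begin
    bilinear A (combination b c) y                     ≡⟨ bilinear-expandˡ A _ y ⟩
    sum (λ k → combination b c k * sum (λ l → A k l * y l))
      ≡⟨ pairing-combination (λ k → sum (λ l → A k l * y l)) b c ⟩
    sum (λ j → c j * sum (λ k → b j k * sum (λ l → A k l * y l)))
      ≡⟨ sum-cong-≗ (λ j → cong (c j *_) (bilinear-expandˡ A (b j) y)) ⟨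
    sum (λ j → c j * bilinear A (b j) y)               ∎

  bilinear-swap : (A : Matrix n) (x y : Vec n) → bilinear A x y ≡ bilinear (λ i j → A j i) y x
  bilinear-swap A x y = trans (∑-comm (λ k l → A k l * x k * y l))
    (sum-cong-≗ λ l → sum-cong-≗ λ k → trans (*-assoc _ _ _) (trans (cong (A k l *_) (*-comm (x k) (y l))) (sym (*-assoc _ _ _))))
    where open Sum semiring using (∑-comm)

  bilinear-combinationʳ : (A : Matrix n) (x : Vec n) (b : Vector (Vec n) d) (c : Vec d) →
    bilinear A x (combination b c) ≡ sum (λ j → c j * bilinear A x (b j))
  bilinear-combinationʳ A x b c = trans (bilinear-swap A x _) (trans (bilinear-combinationˡ _ b c x)
    (sum-cong-≗ (λ j → cong (c j *_) (sym (bilinear-swap A x (b j))))))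

  quadratic-cong : (A : Matrix n) {x y : Vec n} → x ≗ y → quadratic A x ≡ quadratic A y
  quadratic-cong A x≗y = sum-cong-≗ λ i → sum-cong-≗ λ j → cong₂ _*_ (cong (A i j *_) (x≗y i)) (x≗y j)

  infixl 8 _∘ᶠ_
  -- The congruent matrix TᵗAT, where the vectors `T j` are the columns of T.
  _∘ᶠ_ : Matrix n → Vector (Vec n) d → Matrix d
  (A ∘ᶠ T) i j = bilinear A (T i) (T j)

  quadratic-∘ᶠ : (A : Matrix n) (T : Vector (Vec n) d) (y : Vec d) →
    quadratic (A ∘ᶠ T) y ≡ quadratic A (combination T y)
  quadratic-∘ᶠ A T y = begin
    sum (λ i → sum (λ j → bilinear A (T i) (T j) * y i * y j))
      ≡⟨ bilinear-expandˡ (A ∘ᶠ T) y y ⟩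
    sum (λ i → y i * sum (λ j → bilinear A (T i) (T j) * y j))
      ≡⟨ sum-cong-≗ (λ i → cong (y i *_) (sum-cong-≗ (λ j → *-comm _ (y j)))) ⟩
    sum (λ i → y i * sum (λ j → y j * bilinear A (T i) (T j)))
      ≡⟨ sum-cong-≗ (λ i → cong (y i *_) (bilinear-combinationʳ A (T i) T y)) ⟨
    sum (λ i → y i * bilinear A (T i) (combination T y))
      ≡⟨ bilinear-combinationˡ A T y (combination T y) ⟨
    quadratic A (combination T y) ∎

  quadratic-⊙ : (A : Matrix n) (s : Carrier) (x : Vec n) → quadratic A (s ⊙ x) ≡ s * (s * quadratic A x)
  quadratic-⊙ A s x = begin
    bilinear A (s ⊙ x) (s ⊙ x)
      ≡⟨ bilinear-expandˡ A _ _ ⟩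
    sum (λ k → s * x k * sum (λ l → A k l * (s * x l)))
      ≡⟨ sum-cong-≗ (λ k → trans (*-assoc s (x k) _) (cong (λ e → s * (x k * e)) (pull k))) ⟩
    sum (λ k → s * (x k * (s * sum (λ l → A k l * x l))))
      ≡⟨ sum-cong-≗ (λ k → cong (s *_) (x∙yz≈y∙xz (x k) s _)) ⟩
    sum (λ k → s * (s * (x k * sum (λ l → A k l * x l))))
      ≡⟨ *-distribˡ-sum s (λ k → s * (x k * sum (λ l → A k l * x l))) ⟨
    s * sum (λ k → s * (x k * sum (λ l → A k l * x l)))
      ≡⟨ cong (s *_) (*-distribˡ-sum s (λ k → x k * sum (λ l → A k l * x l))) ⟨
    s * (s * sum (λ k → x k * sum (λ l → A k l * x l)))
      ≡⟨ cong (λ e → s * (s * e)) (bilinear-expandˡ A x x) ⟨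
    s * (s * quadratic A x) ∎
    where
    open CommutativeSemigroupProperties *-commutativeSemigroup using (x∙yz≈y∙xz)
    pull : ∀ k → sum (λ l → A k l * (s * x l)) ≡ s * sum (λ l → A k l * x l)
    pull k = trans (sum-cong-≗ (λ l → x∙yz≈y∙xz (A k l) s (x l))) (sym (*-distribˡ-sum s (λ l → A k l * x l)))

  quadratic-∼ : (A : Matrix n) {x y : Vec n} → x ∼ y → quadratic A y ≡ 0# → quadratic A x ≡ 0#
  quadratic-∼ A {x} {y} (s , _ , x≗sy) Ay≡0 = begin
    quadratic A x           ≡⟨ quadratic-cong A x≗sy ⟩
    quadratic A (s ⊙ y)     ≡⟨ quadratic-⊙ A s y ⟩
    s * (s * quadratic A y) ≡⟨ cong (λ e → s * (s * e)) Ay≡0 ⟩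
    s * (s * 0#)            ≡⟨ trans (cong (s *_) (zeroʳ s)) (zeroʳ s) ⟩
    0#                      ∎

  combination-≢𝟎 : (b : Vector (Vec n) d) → Independent b → ∀ y → ¬ y ≗ 𝟎 → ¬ combination b y ≗ 𝟎
  combination-≢𝟎 b b-ind y y≢𝟎 by≗𝟎 = y≢𝟎 (b-ind y by≗𝟎)

  -- A vertex V of the pulled-back form would give the vertex TV of the original one: TV is nonzero
  -- since `T` is independent, and every x has the form Ty.
  transformConic : (D : Conic k) (T : Vector (Vec 3) 3) → Independent T →
                   (∀ j → EntriesIn k (T j)) → (∀ i j → form D i j ∈ 𝔽 k) → Conic k
  transformConic {k} D T T-ind T∈ D∈ = record
    { form = form D ∘ᶠ T
    ; rational = λ i j → 𝔽-sum k _ λ m → 𝔽-sum k _ λ l → 𝔽-* k (𝔽-* k (D∈ m l) (T∈ i m)) (T∈ j l)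
    ; nondegenerate = λ V V-vertex → Conic.nondegenerate D
        (point (combination T (coords V)) (combination-≢𝟎 T T-ind (coords V) (coords≢𝟎 V)))
        λ x → let y , x≗Ty = spans T T-ind x in begin
          quadratic (form D) (x ⊕ combination T (coords V))
            ≡⟨ quadratic-cong (form D) (λ i → cong (_+ combination T (coords V) i) (x≗Ty i)) ⟩
          quadratic (form D) (combination T y ⊕ combination T (coords V))
            ≡⟨ quadratic-cong (form D) (combination-⊕ T y (coords V)) ⟨
          quadratic (form D) (combination T (y ⊕ coords V))
            ≡⟨ quadratic-∘ᶠ (form D) T (y ⊕ coords V) ⟨
          quadratic (form D ∘ᶠ T) (y ⊕ coords V)
            ≡⟨ V-vertex y ⟩
          quadratic (form D ∘ᶠ T) y
            ≡⟨ quadratic-∘ᶠ (form D) T y ⟩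
          quadratic (form D) (combination T y)
            ≡⟨ quadratic-cong (form D) x≗Ty ⟨
          quadratic (form D) x ∎
    }

  -- A coordinate frame F of PG(2, q³) in which π is PG(2, q), C is a conic
  -- with equation N, and ℓ∞ is the line y₀ = 0.
  record Frame (π C : PointSet 3) (ℓ∞ : Line) : Set₁ where
    field
      F             : Vector (Vec 3) 3
      F-independent : Independent F
      F-rational    : ∀ j → EntriesIn 3 (F j)
      N             : Conic 1
      π⇒            : ∀ {X} → X ∈ π → ∃ λ y → EntriesIn 1 y × coords X ∼ combination F y
      ⇒π            : ∀ {X} y → EntriesIn 1 y → coords X ∼ combination F y → X ∈ π
      C⇒            : ∀ {X} → X ∈ C → ∃ λ y → coords X ∼ combination F y × quadratic (form N) y ≡ 0#
      ℓ∞⊆           : ∀ j → Span (F ∘ suc) (basis ℓ∞ j)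

  -- Two points of π on ℓ∞ have 𝔽_q-coordinates u, v with respect to `M`. A unit vector completes
  -- them to an 𝔽_q-basis `T`, and F = MT. A change of basis over 𝔽_q keeps π equal to the points
  -- with 𝔽_q-coordinates, while the last two frame vectors now lie on ℓ∞.
  frame : ∀ {π C ℓ∞} → IsConicOfSubplane π C → ∃₂ (λ X Y → X ∈ π ∩ ⟦ ℓ∞ ⟧ × Y ∈ π ∩ ⟦ ℓ∞ ⟧ × ¬ X ≈ₚ Y) →
          Frame π C ℓ∞
  frame {π} {C} {ℓ∞} conicOf (X , Y , (X∈π , X∈ℓ∞) , (Y∈π , Y∈ℓ∞) , X≉Y) = record
    { F = F
    ; F-independent = F-ind
    ; F-rational = λ j → combination-rational 3 M′ (T j) (λ j i → proj₁ inGL i j) (λ i → 𝔽₁⊆𝔽 3 (T∈ j i))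
    ; N = transformConic conic T T-ind T∈ (Conic.rational conic)
    ; π⇒ = λ X∈π → let u , u∈ , X∼ = π-coordinates X∈π
                       y , u≗Ty = spans T T-ind u
                   in y , coefficients-rational 1 T y T-ind T∈ (λ i → trans (cong (fr 1) (sym (u≗Ty i))) (trans (u∈ i) (u≗Ty i)))
                    , ∼-trans X∼ (≗⇒∼ (λ i → trans (combination-congʳ M′ u≗Ty i) (F-combination y i)))
    ; ⇒π = λ {X} y y∈ X∼ →
        let y≢𝟎 = λ y≗𝟎 → ∼-≢𝟎 X∼ (coords≢𝟎 X) (λ i → trans (combination-congʳ F y≗𝟎 i) (combination-𝟎 F i))
            Ty = combination T y
        in proj₂ plane (point Ty (combination-≢𝟎 T T-ind y y≢𝟎)
             , (Ty , combination-rational 1 T y T∈ y∈ , ≗⇒∼ (λ _ → refl))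
             , ∼-trans X∼ (≗⇒∼ (λ i → trans (sym (F-combination y i)) (sym (M·≗ Ty i)))))
    ; C⇒ = λ X∈C → let Z , (Z∈conic , _) , X∼MZ = proj₁ points X∈C
                       y , Z≗Ty = spans T T-ind (coords Z)
                   in y , ∼-trans X∼MZ (≗⇒∼ (λ i → trans (M·≗ (coords Z) i) (trans (combination-congʳ M′ Z≗Ty i) (F-combination y i))))
                    , trans (quadratic-∘ᶠ (form conic) T y) (trans (quadratic-cong (form conic) (sym ∘ Z≗Ty)) Z∈conic)
    -- Two independent frame vectors lie in the span of the two basis vectors of ℓ∞, so `exchange`
    -- reverses the inclusion.
    ; ℓ∞⊆ = proj₂ (exchange (F ∘ suc) (basis ℓ∞) (independent-tail F F-ind)
        λ { zero → F∈ℓ∞ zero {X} X∈ℓ∞ X∼Mu ; (suc zero) → F∈ℓ∞ (suc zero) {Y} Y∈ℓ∞ Y∼Mv })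
    }
    where
    open IsConicOfSubplane conicOf
    M′ : Vector (Vec 3) 3
    M′ j i = M i j

    M·≗ : ∀ x → M · x ≗ combination M′ x
    M·≗ x i = sum-cong-≗ (λ j → *-comm (M i j) (x j))

    M′-ind : Independent M′
    M′-ind c Mc≗𝟎 j = begin
      c j                                ≡⟨ proj₁ (proj₂ (proj₂ inGL)) c j ⟨
      (proj₁ (proj₂ inGL) · M · c) j     ≡⟨ sum-cong-≗ (λ i → trans (cong (proj₁ (proj₂ inGL) j i *_) (trans (M·≗ c i) (Mc≗𝟎 i))) (zeroʳ _)) ⟩
      sum (λ (_ : Fin 3) → 0#)           ≡⟨ sum-replicate-zero 3 ⟩
      0#                                 ∎

    π-coordinates : ∀ {X} → X ∈ π → ∃ λ u → EntriesIn 1 u × coords X ∼ combination M′ u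
    π-coordinates X∈π = let Z , (u , u∈ , (s , s≢0 , Z≗su)) , X∼MZ = proj₁ plane X∈π in
      u , u∈ , ∼-trans X∼MZ (s , s≢0 , λ i →
        trans (M·≗ (coords Z) i) (trans (combination-congʳ M′ Z≗su i) (combination-⊙ M′ s u i)))

    u v : Vec 3
    u = proj₁ (π-coordinates X∈π)
    v = proj₁ (π-coordinates Y∈π)
    X∼Mu : coords X ∼ combination M′ u
    X∼Mu = proj₂ (proj₂ (π-coordinates X∈π))
    Y∼Mv : coords Y ∼ combination M′ v
    Y∼Mv = proj₂ (proj₂ (π-coordinates Y∈π))

    uv : Vector (Vec 3) 2
    uv = u ∷ v ∷ []

    v∷[]-ind : Independent (v ∷ [])
    v∷[]-ind c cv≗𝟎 zero with zero⊎nonzero v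
    ... | inj₁ v≗𝟎 = contradiction (λ i → trans (combination-congʳ M′ v≗𝟎 i) (combination-𝟎 M′ i))
                                   (∼-≢𝟎 Y∼Mv (coords≢𝟎 Y))
    ... | inj₂ (i , vᵢ≢0) = noZeroDivisors (trans (*-comm (v i) (c zero)) (trans (sym (+-identityʳ _)) (cv≗𝟎 i))) vᵢ≢0

    uv-ind : Independent uv
    -- A relation u = c v would identify the points X and Y.
    uv-ind = independent-∷ (v ∷ []) u v∷[]-ind λ { (c , u≗cv) → X≉Y (∼-trans (∼-trans X∼Mu
      (⊙⇒∼ (c zero) (∼-≢𝟎 X∼Mu (coords≢𝟎 X)) λ i →
        trans (combination-congʳ M′ (λ i → trans (u≗cv i) (+-identityʳ _)) i) (combination-⊙ M′ (c zero) v i)))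
      (∼-sym Y∼Mv)) }

    w : ∃ λ j → ¬ Span uv (δ j)
    w = outside δ uv δ-independent

    T : Vector (Vec 3) 3
    T = δ (proj₁ w) ∷ uv
    T-ind : Independent T
    T-ind = independent-∷ uv (δ (proj₁ w)) uv-ind (proj₂ w)
    T∈ : ∀ j → EntriesIn 1 (T j)
    T∈ zero             = δ-rational 1 (proj₁ w)
    T∈ (suc zero)       = proj₁ (proj₂ (π-coordinates X∈π))
    T∈ (suc (suc zero)) = proj₁ (proj₂ (π-coordinates Y∈π))

    F : Vector (Vec 3) 3
    F j = combination M′ (T j)
    F-combination : ∀ y → combination M′ (combination T y) ≗ combination F y
    F-combination y i = sym (combination-combination M′ T y i)
    F-ind : Independent F
    F-ind c Fc≗𝟎 = T-ind c (M′-ind (combination T c) (λ i → trans (F-combination c i) (Fc≗𝟎 i)))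

    F∈ℓ∞ : ∀ j {X} → X ∈ ⟦ ℓ∞ ⟧ → coords X ∼ combination M′ (uv j) → Span (basis ℓ∞) (F (suc j))
    F∈ℓ∞ j X∈ℓ∞ X∼ = Span-∼ (basis ℓ∞) (∼-sym X∼) X∈ℓ∞

-- Matrix coordinates on PG(8, q⁶), and the shapes of spread planes and scroll-planes.

module Coordinates {q : ℕ} (q-primePower : IsPrimePower q) (K : FiniteField (q ℕ.^ 6)) where
  open Geometry q K
  open FieldProperties K
  open LinearAlgebra q K
  open FrobeniusMap q-primePower K
  open Conics q-primePower K
  open Sum semiring using (sum-cong-≗; *-distribˡ-sum; sum-replicate-zero; ∑-distrib-+)
  open ≡-Reasoning

  private
    variable
      n d e k : ℕ

  ∼-frob : ∀ m {v w : Vec n} → v ∼ w → frob m v ∼ frob m w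
  ∼-frob m (s , s≢0 , v≗sw) = fr m s , fr-≢0 m s≢0 , λ i → trans (cong (fr m) (v≗sw i)) (fr-* m s _)

  ∼-combination : (b : Vector (Vec n) d) {v w : Vec d} → v ∼ w → combination b v ∼ combination b w
  ∼-combination b (s , s≢0 , v≗sw) = s , s≢0 , λ i → trans (combination-congʳ b v≗sw i) (combination-⊙ b s _ i)

  Span-family : (a b : Vector (Vec n) d) → (∀ j → a j ∼ b j) → ∀ {v} → Span a v → Span b v
  Span-family a b a∼b = Span-trans b a (λ j → Span-∼ b (a∼b j) (Span-member b j))

  Span-++ˡ : (a : Vector (Vec n) d) (b : Vector (Vec n) e) {v : Vec n} → Span a v → Span (a ++ b) v
  Span-++ˡ a b (c , v≗) = c ++ 𝟎 , λ i → trans (v≗ i) (sym (trans (combination-++-++ a b c 𝟎 i)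
    (trans (cong (combination a c i +_) (combination-𝟎 b i)) (+-identityʳ _))))

  Span-++ʳ : (a : Vector (Vec n) d) (b : Vector (Vec n) e) {v : Vec n} → Span b v → Span (a ++ b) v
  Span-++ʳ {d = d} a b (c , v≗) = _++_ {m = d} 𝟎 c , λ i → trans (v≗ i) (sym (trans (combination-++-++ a b 𝟎 c i)
    (trans (cong (_+ combination b c i) (combination-𝟎 a i)) (+-identityˡ _))))

  Span-frob : ∀ m (a : Vector (Vec n) d) {v : Vec n} → Span a v → Span (map (frob m) a) (frob m v)
  Span-frob m a (c , v≗) = frob m c , λ i → trans (cong (fr m) (v≗ i)) (frob-combination m a c i)

  Span-conjugates : (a : Vector (Vec n) d) (b : Vector (Vec n) e) → (∀ j → Span b (a j)) →
                    ∀ j → Span (conjugates b) (conjugates a j)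
  Span-conjugates a b a⊆b = ++⁺ (Span (conjugates b))
    (λ j → Span-++ˡ b _ (a⊆b j))
    (++⁺ (Span (conjugates b))
      (λ j → Span-++ʳ b _ (Span-++ˡ (map (frob 1) b) (map (frob 2) b) (Span-frob 1 b (a⊆b j))))
      (λ j → Span-++ʳ b _ (Span-++ʳ (map (frob 1) b) (map (frob 2) b) (Span-frob 2 b (a⊆b j)))))

  -- The map x ↦ x^{qⁱ}. Index 0 is `id` and not `fr 0`, since `fr 0 x` computes to x * 1#.
  σ : Fin 3 → Carrier → Carrier
  σ zero             = id
  σ (suc zero)       = fr 1
  σ (suc (suc zero)) = fr 2

  conj : Fin 3 → Vec n → Vec n
  conj i v = σ i ∘ v

  σ-* : ∀ i x y → σ i (x * y) ≡ σ i x * σ i y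
  σ-* zero             x y = refl
  σ-* (suc zero)       x y = fr-* 1 x y
  σ-* (suc (suc zero)) x y = fr-* 2 x y

  σ-0# : ∀ i → σ i 0# ≡ 0#
  σ-0# zero             = refl
  σ-0# (suc zero)       = fr-0# 1
  σ-0# (suc (suc zero)) = fr-0# 2

  σ-≢0 : ∀ i {x} → x ≢ 0# → σ i x ≢ 0#
  σ-≢0 zero             x≢0 = x≢0
  σ-≢0 (suc zero)       x≢0 = fr-≢0 1 x≢0
  σ-≢0 (suc (suc zero)) x≢0 = fr-≢0 2 x≢0

  σ-𝔽₁ : ∀ i {x} → x ∈ 𝔽 1 → σ i x ≡ x
  σ-𝔽₁ zero             x∈ = refl
  σ-𝔽₁ (suc zero)       x∈ = x∈
  σ-𝔽₁ (suc (suc zero)) x∈ = 𝔽₁⊆𝔽 2 x∈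

  conj-combination : ∀ i (b : Vector (Vec n) d) (c : Vec d) →
    conj i (combination b c) ≗ combination (conj i ∘ b) (conj i c)
  conj-combination zero             b c k = refl
  conj-combination (suc zero)       b c = frob-combination 1 b c
  conj-combination (suc (suc zero)) b c = frob-combination 2 b c

  ∼-conj : ∀ i {v w : Vec n} → v ∼ w → conj i v ∼ conj i w
  ∼-conj zero             = id
  ∼-conj (suc zero)       = ∼-frob 1
  ∼-conj (suc (suc zero)) = ∼-frob 2

  part : Fin 3 → Vec (d ℕ.+ (d ℕ.+ d)) → Vec d
  part {d} zero             c = c ∘ (_↑ˡ (d ℕ.+ d))
  part {d} (suc zero)       c = c ∘ (d ↑ʳ_) ∘ (_↑ˡ d)
  part {d} (suc (suc zero)) c = c ∘ (d ↑ʳ_) ∘ (d ↑ʳ_)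

  join : (Fin 3 → Vec d) → Vec (d ℕ.+ (d ℕ.+ d))
  join z = z zero ++ (z (suc zero) ++ z (suc (suc zero)))

  part-join : (z : Fin 3 → Vec d) → ∀ i → part i (join z) ≗ z i
  part-join z zero             j = lookup-++ˡ (z zero) _ j
  part-join {d} z (suc zero)   j = trans (lookup-++ʳ (z zero) _ (j ↑ˡ d)) (lookup-++ˡ (z (suc zero)) _ j)
  part-join {d} z (suc (suc zero)) j = trans (lookup-++ʳ (z zero) _ (d ↑ʳ j)) (lookup-++ʳ (z (suc zero)) _ j)

  combination-conjugates : (a : Vector (Vec n) d) (c : Vec (d ℕ.+ (d ℕ.+ d))) →
    combination (conjugates a) c ≗ λ k → sum (λ i → combination (conj i ∘ a) (part i c) k)
  combination-conjugates {d = d} a c k = begin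
    combination (conjugates a) c k
      ≡⟨ combination-++ a (map (frob 1) a ++ map (frob 2) a) c k ⟩
    combination a (part zero c) k + combination (map (frob 1) a ++ map (frob 2) a) (c ∘ (d ↑ʳ_)) k
      ≡⟨ cong (combination a (part zero c) k +_) (combination-++ (map (frob 1) a) (map (frob 2) a) (c ∘ (d ↑ʳ_)) k) ⟩
    combination a (part zero c) k + (combination (map (frob 1) a) (part (suc zero) c) k
      + combination (map (frob 2) a) (part (suc (suc zero)) c) k)
      ≡⟨ cong (λ e → combination a (part zero c) k + (combination (map (frob 1) a) (part (suc zero) c) k + e)) (+-identityʳ _) ⟨
    sum (λ i → combination (conj i ∘ a) (part i c) k) ∎

  infix 8 _⊛_
  _⊛_ : Vec 3 → Vec 3 → Fin 3 → Vec 3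
  (s ⊛ y) i = s i ⊙ y

  module Bose (F : Vector (Vec 3) 3) (F-independent : Independent F) (F-rational : ∀ j → EntriesIn 3 (F j))
              (bose : BoseRepresentation) where
    open BoseRepresentation bose

    β : Vector (Vec 9) 3
    β = toΓ ∘ F

    toΓ-F : ∀ y → toΓ (combination F y) ≗ combination β y
    toΓ-F y k = sym (combination-combination (basis Γ) F y k)

    β-rational : ∀ j → EntriesIn 3 (β j)
    β-rational j = combination-rational 3 (basis Γ) (F j) (Subspace.rational Γ) (F-rational j)

    β^ : Fin 3 → Vector (Vec 9) 3
    β^ i = conj i ∘ β

    -- The linear isomorphism that sends a matrix to the vector having these rows as coordinates in
    -- the frames `β^ i` of the conjugates of Γ.
    E : (Fin 3 → Vec 3) → Vec 9
    E z k = sum (λ i → combination (β^ i) (z i) k)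

    E-cong : ∀ z z′ → (∀ i → z i ≗ z′ i) → E z ≗ E z′
    E-cong z z′ z≗z′ k = sum-cong-≗ (λ i → combination-congʳ (β^ i) (z≗z′ i) k)

    E-⊕ : ∀ z z′ → E (λ i → z i ⊕ z′ i) ≗ E z ⊕ E z′
    E-⊕ z z′ k = trans (sum-cong-≗ (λ i → combination-⊕ (β^ i) (z i) (z′ i) k))
      (∑-distrib-+ (λ i → combination (β^ i) (z i) k) (λ i → combination (β^ i) (z′ i) k))

    E-⊙ : ∀ s z → E (λ i → s ⊙ z i) ≗ s ⊙ E z
    E-⊙ s z k = trans (sum-cong-≗ (λ i → combination-⊙ (β^ i) s (z i) k))
      (sym (*-distribˡ-sum s (λ i → combination (β^ i) (z i) k)))

    E-join : ∀ z → combination (conjugates β) (join z) ≗ E z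
    E-join z k = trans (combination-conjugates β (join z) k) (E-cong _ z (part-join z) k)

    Γ⊆β : ∀ j → Span β (basis Γ j)
    Γ⊆β j = let y , δ≗Fy = spans F F-independent (δ j) in
      y , λ k → trans (sym (combination-δ (basis Γ) j k)) (trans (combination-congʳ (basis Γ) δ≗Fy k) (toΓ-F y k))

    conjugates-β-spans : ∀ v → Span (conjugates β) v
    conjugates-β-spans v = Span-trans (conjugates β) (conjugates (basis Γ))
      (Span-conjugates (basis Γ) β Γ⊆β) (go (zero⊎nonzero v))
      where
      go : v ≗ 𝟎 ⊎ (∃ λ i → v i ≢ 0#) → Span (conjugates (basis Γ)) v
      go (inj₁ v≗𝟎) = 𝟎 , λ k → trans (v≗𝟎 k) (sym (combination-𝟎 (conjugates (basis Γ)) k))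
      go (inj₂ v≢𝟎) = spanning (record { coords = v ; nonzero = v≢𝟎 })

    -- Nine vectors spanning a space of dimension nine: `exchange`, with the unit vectors as the
    -- independent family.
    conjugates-β-independent : Independent (conjugates β)
    conjugates-β-independent = proj₁ (exchange δ (conjugates β) δ-independent (λ j → conjugates-β-spans (δ j)))

    E-injective : ∀ z z′ → E z ≗ E z′ → ∀ i → z i ≗ z′ i
    E-injective z z′ eq i j = begin
      z i j                ≡⟨ part-join z i j ⟨
      part i (join z) j    ≡⟨ part-cong i (independent-injective (conjugates β) conjugates-β-independent (join z) (join z′)
                                (λ k → trans (E-join z k) (trans (eq k) (sym (E-join z′ k))))) j ⟩
      part i (join z′) j   ≡⟨ part-join z′ i j ⟩
      z′ i j               ∎
      where
      part-cong : ∀ i {c c′ : Vec 9} → c ≗ c′ → part {3} i c ≗ part i c′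
      part-cong zero             c≗c′ j = c≗c′ _
      part-cong (suc zero)       c≗c′ j = c≗c′ _
      part-cong (suc (suc zero)) c≗c′ j = c≗c′ _

    E-onto : ∀ v → ∃ λ z → v ≗ E z
    E-onto v = let c , v≗ = conjugates-β-spans v in
      (λ i → part i c) , λ k → trans (v≗ k) (combination-conjugates β c k)

    -- The q-power map of K⁹ in matrix coordinates. Row 2 returns to row 0 because `β` has entries
    -- in 𝔽_{q³}.
    shift : (Fin 3 → Vec 3) → Fin 3 → Vec 3
    shift z zero             = frob 1 (z (suc (suc zero)))
    shift z (suc zero)       = frob 1 (z zero)
    shift z (suc (suc zero)) = frob 1 (z (suc zero))

    frob-E : ∀ z → frob 1 (E z) ≗ E (shift z)
    frob-E z k = begin
      fr 1 (E z k)
        ≡⟨ fr-sum 1 (λ i → combination (β^ i) (z i) k) ⟩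
      fr 1 (combination (β^ zero) (z zero) k) + (fr 1 (combination (β^ (suc zero)) (z (suc zero)) k)
        + (fr 1 (combination (β^ (suc (suc zero))) (z (suc (suc zero))) k) + 0#))
        ≡⟨ cong₂ _+_ (frob-combination 1 (β^ zero) (z zero) k) (cong₂ _+_
             (trans (frob-combination 1 (β^ (suc zero)) (z (suc zero)) k)
               (combination-congˡ (frob 1 ∘ β^ (suc zero)) (β^ (suc (suc zero))) (shift z (suc (suc zero))) (λ j l → fr-fr 1 1 (β j l)) k))
             (cong (_+ 0#) (trans (frob-combination 1 (β^ (suc (suc zero))) (z (suc (suc zero))) k)
               (combination-congˡ (frob 1 ∘ β^ (suc (suc zero))) β (shift z zero) (λ j l → trans (fr-fr 2 1 (β j l)) (β-rational j l)) k)))) ⟩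
      s₁ + (s₂ + (s₀ + 0#))
        ≡⟨ cong (λ e → s₁ + (s₂ + e)) (+-identityʳ s₀) ⟩
      s₁ + (s₂ + s₀)
        ≡⟨ +-assoc s₁ s₂ s₀ ⟨
      s₁ + s₂ + s₀
        ≡⟨ +-comm _ s₀ ⟩
      s₀ + (s₁ + s₂)
        ≡⟨ cong (λ e → s₀ + (s₁ + e)) (+-identityʳ s₂) ⟨
      E (shift z) k ∎
      where
      s : Fin 3 → Carrier
      s i = combination (β^ i) (shift z i) k
      s₀ = s zero
      s₁ = s (suc zero)
      s₂ = s (suc (suc zero))

    -- The q-power map fixes `E z`, so `shift z` and z agree by uniqueness of coordinates. Each row
    -- is then the q-power of the preceding one, and one full turn puts the first row over 𝔽_{q³}.
    rational⇒conj : ∀ z → EntriesIn 1 (E z) → (∀ i → z i ≗ conj i (z zero)) × EntriesIn 3 (z zero)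
    rational⇒conj z Ez∈ = coordinates , λ j → begin
      fr 3 (z zero j)                ≡⟨ fr-fr 2 1 _ ⟨
      fr 1 (fr 2 (z zero j))         ≡⟨ cong (fr 1) (coordinates (suc (suc zero)) j) ⟨
      fr 1 (z (suc (suc zero)) j)    ≡⟨ shifted zero j ⟩
      z zero j                       ∎
      where
      shifted : ∀ i → shift z i ≗ z i
      shifted = E-injective (shift z) z (λ k → trans (sym (frob-E z k)) (Ez∈ k))
      coordinates : ∀ i → z i ≗ conj i (z zero)
      coordinates zero             j = refl
      coordinates (suc zero)       j = sym (shifted (suc zero) j)
      coordinates (suc (suc zero)) j = trans (sym (shifted (suc (suc zero)) j))
        (trans (cong (fr 1) (coordinates (suc zero) j)) (fr-fr 1 1 _))

    conj⇒rational : ∀ w → EntriesIn 3 w → EntriesIn 1 (E (λ i → conj i w))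
    conj⇒rational w w∈ k = trans (frob-E (λ i → conj i w) k) (E-cong (shift (λ i → conj i w)) (λ i → conj i w) shifted k)
      where
      shifted : ∀ i → shift (λ i → conj i w) i ≗ conj i w
      shifted zero             j = trans (fr-fr 2 1 (w j)) (w∈ j)
      shifted (suc zero)       j = refl
      shifted (suc (suc zero)) j = fr-fr 1 1 (w j)

    E-⊛ : ∀ s y → E (s ⊛ y) ≗ combination (λ i → combination (β^ i) y) s
    E-⊛ s y k = sum-cong-≗ (λ i → combination-⊙ (β^ i) (s i) y k)

    -- With `tail-E`, this identifies the span of the last two frame vectors and their conjugates
    -- with the matrices of zero first column; this is the extension of Σ∞.
    E-tail : ∀ {v} → Span (conjugates (β ∘ suc)) v → ∃ λ z → (∀ i → z i zero ≡ 0#) × v ≗ E z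
    E-tail {v} (c , v≗) = (λ i → 0# ∷ part i c) , (λ _ → refl) , λ k →
      trans (v≗ k) (trans (combination-conjugates (β ∘ suc) c k)
        (sum-cong-≗ (λ i → sym (trans (cong (_+ combination (conj i ∘ β ∘ suc) (part i c) k) (zeroˡ (β^ i zero k)))
          (+-identityˡ (combination (conj i ∘ β ∘ suc) (part i c) k))))))

    tail-E : ∀ z → (∀ i → z i zero ≡ 0#) → Span (conjugates (β ∘ suc)) (E z)
    tail-E z z₀≡0 = join (λ i → z i ∘ suc) , λ k → begin
      E z k
        ≡⟨ sum-cong-≗ (λ i → trans (cong (_+ combination (β^ i ∘ suc) (z i ∘ suc) k)
             (trans (cong (_* β^ i zero k) (z₀≡0 i)) (zeroˡ _))) (+-identityˡ _)) ⟩
      sum (λ i → combination (β^ i ∘ suc) (z i ∘ suc) k)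
        ≡⟨ sum-cong-≗ (λ i → combination-congʳ (β^ i ∘ suc) (part-join (λ i → z i ∘ suc) i) k) ⟨
      sum (λ i → combination (β^ i ∘ suc) (part i (join (λ i → z i ∘ suc))) k)
        ≡⟨ combination-conjugates (β ∘ suc) (join (λ i → z i ∘ suc)) k ⟨
      combination (conjugates (β ∘ suc)) (join (λ i → z i ∘ suc)) k ∎

    -- X^{qⁱ} has coordinates y^{qⁱ} in the frame of Γ^{qⁱ}, so the rows are multiples of the
    -- conjugates of y and not of y itself.
    spread⇒ : ∀ X Z y → coords X ∼ combination F y → Z ∈ ⟨ conjugates (toΓ (coords X) ∷ []) ⟩ →
              ∃ λ s → coords Z ≗ E (λ i → s i ⊙ conj i y)
    spread⇐ : ∀ X Z y → coords X ∼ combination F y → ∀ s → coords Z ≗ E (λ i → s i ⊙ conj i y) →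
              Z ∈ ⟨ conjugates (toΓ (coords X) ∷ []) ⟩
    private
      spread∼ : ∀ X y → coords X ∼ combination F y →
                ∀ i → conjugates (toΓ (coords X) ∷ []) i ∼ combination (β^ i) (conj i y)
      spread∼ X y X∼Fy i = ∼-trans (≗⇒∼ (conjugates-i i)) (∼-trans
        (∼-conj i (∼-trans (∼-combination (basis Γ) X∼Fy) (≗⇒∼ (toΓ-F y))))
        (≗⇒∼ (conj-combination i β y)))
        where
        conjugates-i : ∀ i → conjugates (toΓ (coords X) ∷ []) i ≗ conj i (toΓ (coords X))
        conjugates-i zero             k = refl
        conjugates-i (suc zero)       k = refl
        conjugates-i (suc (suc zero)) k = refl

      E-⊙conj : ∀ s y → E (λ i → s i ⊙ conj i y) ≗ combination (λ i → combination (β^ i) (conj i y)) s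
      E-⊙conj s y k = sum-cong-≗ (λ i → combination-⊙ (β^ i) (s i) (conj i y) k)

    spread⇒ X Z y X∼Fy Z∈ = let s , Z≗ = Span-family (conjugates (toΓ (coords X) ∷ []))
                                         (λ i → combination (β^ i) (conj i y)) (spread∼ X y X∼Fy) Z∈ in
      s , λ k → trans (Z≗ k) (sym (E-⊙conj s y k))
    spread⇐ X Z y X∼Fy s Z≗ = Span-family (λ i → combination (β^ i) (conj i y)) (conjugates (toΓ (coords X) ∷ []))
      (λ i → ∼-sym (spread∼ X y X∼Fy i)) (s , λ k → trans (Z≗ k) (E-⊙conj s y k))

    module Scroll {π : PointSet 3} (κ : Conjugacy π)
                  (⇒π : ∀ {X} y → EntriesIn 1 y → coords X ∼ combination F y → X ∈ π) where
      open Conjugacy κ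

      private
        B′ : Vector (Vec 3) 3
        B′ j i = B i j

        c≗ : ∀ x → c x ≗ combination B′ (frob 1 x)
        c≗ x i = sum-cong-≗ (λ j → *-comm (B i j) (fr 1 (x j)))

        c-cong : ∀ x x′ → x ≗ x′ → c x ≗ c x′
        c-cong x x′ x≗x′ i = sum-cong-≗ (λ j → cong (λ e → B i j * fr 1 e) (x≗x′ j))

        c-combination : ∀ y → c (combination F y) ≗ combination (c ∘ F) (frob 1 y)
        c-combination y i = begin
          c (combination F y) i                                    ≡⟨ c≗ (combination F y) i ⟩
          combination B′ (frob 1 (combination F y)) i              ≡⟨ combination-congʳ B′ (frob-combination 1 F y) i ⟩
          combination B′ (combination (frob 1 ∘ F) (frob 1 y)) i   ≡⟨ combination-combination B′ (frob 1 ∘ F) (frob 1 y) i ⟨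
          combination (combination B′ ∘ frob 1 ∘ F) (frob 1 y) i   
            ≡⟨ combination-congˡ (combination B′ ∘ frob 1 ∘ F) (c ∘ F) (frob 1 y) (λ j k → sym (c≗ (F j) k)) i ⟩
          combination (c ∘ F) (frob 1 y) i                         ∎

        fixed : ∀ y → EntriesIn 1 y → ¬ y ≗ 𝟎 → c (combination F y) ∼ combination F y
        fixed y y∈ y≢𝟎 = fixes P (⇒π {P} y y∈ (≗⇒∼ (λ _ → refl)))
          where P = point (combination F y) (combination-≢𝟎 F F-independent y y≢𝟎)

        fixed-F : ∀ j → c (F j) ∼ F j
        fixed-F j = ∼-trans (≗⇒∼ (c-cong (F j) (combination F (δ j)) (λ k → sym (combination-δ F j k))))
          (∼-trans (fixed (δ j) (δ-rational 1 j) (δ≢𝟎 j)) (≗⇒∼ (combination-δ F j)))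

        𝟏 : Vec 3
        𝟏 _ = 1#

        fixed-𝟏 : c (combination F 𝟏) ∼ combination F 𝟏
        fixed-𝟏 = fixed 𝟏 (λ _ → fr-1# 1) (λ 𝟏≗𝟎 → 1≢0 (𝟏≗𝟎 zero))

        ν : Vec 3
        ν j = proj₁ (fixed-F j)

        μ : Carrier
        μ = proj₁ fixed-𝟏

        -- c fixes the four points of a frame, so the proportionality factors
        -- at the three vertices agree.
        cF≗ν : ∀ z → combination (c ∘ F) z ≗ combination F (λ j → z j * ν j)
        cF≗ν z i = sum-cong-≗ (λ j → trans (cong (z j *_) (proj₂ (proj₂ (fixed-F j)) i)) (sym (*-assoc (z j) (ν j) (F j i))))

        ν≡μ : ∀ j → ν j ≡ μ
        ν≡μ j = trans (sym (*-identityˡ _)) (trans (independent-injective F F-independent (λ j → 1# * ν j) (μ ⊙ 𝟏) (λ i → begin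
          combination F (λ j → 1# * ν j) i        ≡⟨ cF≗ν 𝟏 i ⟨
          combination (c ∘ F) 𝟏 i                 ≡⟨ combination-congʳ (c ∘ F) (λ _ → fr-1# 1) i ⟨
          combination (c ∘ F) (frob 1 𝟏) i        ≡⟨ c-combination 𝟏 i ⟨
          c (combination F 𝟏) i                   ≡⟨ proj₂ (proj₂ fixed-𝟏) i ⟩
          μ * combination F 𝟏 i                   ≡⟨ combination-⊙ F μ 𝟏 i ⟨
          combination F (μ ⊙ 𝟏) i                 ∎) j) (*-identityʳ μ))

      -- `c` is semilinear for x ↦ x^q and multiplies each frame vector by the same scalar `μ`.
      c-F : ∀ y → c (combination F y) ∼ combination F (frob 1 y)
      c-F y = μ , proj₁ (proj₂ fixed-𝟏) , λ i → begin
        c (combination F y) i                   ≡⟨ c-combination y i ⟩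
        combination (c ∘ F) (frob 1 y) i        ≡⟨ cF≗ν (frob 1 y) i ⟩
        combination F (λ j → frob 1 y j * ν j) i ≡⟨ combination-congʳ F (λ j → trans (cong (frob 1 y j *_) (ν≡μ j)) (*-comm _ μ)) i ⟩
        combination F (μ ⊙ frob 1 y) i          ≡⟨ combination-⊙ F μ (frob 1 y) i ⟩
        μ * combination F (frob 1 y) i          ∎

      c-∼ : ∀ x x′ → x ∼ x′ → c x ∼ c x′
      c-∼ x x′ x∼x′ = ∼-trans (≗⇒∼ (c≗ x)) (∼-trans (∼-combination B′ (∼-frob 1 x∼x′)) (≗⇒∼ (λ i → sym (c≗ x′ i))))

      c^-F : ∀ m x y → x ∼ combination F y → c^ m x ∼ combination F (frob m y)
      c^-F zero    x y x∼Fy = ∼-trans x∼Fy (≗⇒∼ (combination-congʳ F {y} {frob 0 y} (λ j → sym (*-identityʳ _))))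
      c^-F (suc m) x y x∼Fy = ∼-trans (c-∼ _ _ (c^-F m x y x∼Fy)) (∼-trans (c-F (frob m y))
        (≗⇒∼ (combination-congʳ F {frob 1 (frob m y)} {frob (suc m) y} λ j →
          trans (fr-fr m 1 (y j)) (cong (λ l → fr l (y j)) (ℕ.+-comm m 1)))))

      private
        scroll : Vec 3 → Vector (Vec 9) 3
        scroll x = toΓ x ∷ frob 1 (toΓ (c^ 5 x)) ∷ frob 2 (toΓ (c^ 4 x)) ∷ []

        -- `c` applied m times raises the coordinates to the power q^m, and the outer conjugation
        -- adds q^l. With m + l = 6 the total power is the identity on K; hence the pairings 5, 1
        -- and 4, 2 in the scroll-plane.
        frob-toΓ-c^ : ∀ m l x y → m ℕ.+ l ≡ 6 → x ∼ combination F y →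
                      frob l (toΓ (c^ m x)) ∼ combination (frob l ∘ β) y
        frob-toΓ-c^ m l x y m+l≡6 x∼Fy = ∼-trans
          (∼-frob l (∼-trans (∼-combination (basis Γ) (c^-F m x y x∼Fy)) (≗⇒∼ (toΓ-F (frob m y)))))
          (≗⇒∼ λ k → trans (frob-combination l β (frob m y) k)
            (combination-congʳ (frob l ∘ β) (λ j → trans (fr-fr m l (y j)) (trans (cong (λ e → fr e (y j)) m+l≡6) (fr-6 (y j)))) k))

        scroll∼ : ∀ x y → x ∼ combination F y → ∀ i → scroll x i ∼ combination (β^ i) y
        scroll∼ x y x∼Fy zero       = ∼-trans (∼-combination (basis Γ) x∼Fy) (≗⇒∼ (toΓ-F y))
        scroll∼ x y x∼Fy (suc zero)         = frob-toΓ-c^ 5 1 x y refl x∼Fy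
        scroll∼ x y x∼Fy (suc (suc zero))   = frob-toΓ-c^ 4 2 x y refl x∼Fy

      scroll⇒ : ∀ X Z y → coords X ∼ combination F y → Z ∈ scrollPlane κ X → ∃ λ s → coords Z ≗ E (s ⊛ y)
      scroll⇒ X Z y X∼Fy Z∈ = let s , Z≗ = Span-family (scroll (coords X)) (λ i → combination (β^ i) y) (scroll∼ (coords X) y X∼Fy) Z∈ in
        s , λ k → trans (Z≗ k) (sym (E-⊛ s y k))

      scroll⇐ : ∀ X Z y → coords X ∼ combination F y → ∀ s → coords Z ≗ E (s ⊛ y) → Z ∈ scrollPlane κ X
      scroll⇐ X Z y X∼Fy s Z≗ = Span-family (λ i → combination (β^ i) y) (scroll (coords X))
        (λ i → ∼-sym (scroll∼ (coords X) y X∼Fy i)) (s , λ k → trans (Z≗ k) (E-⊛ s y k))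

-- Zeros of a binary quadratic form over 𝔽_q: the points of the conic at infinity.

module BinaryForms {q : ℕ} (q-primePower : IsPrimePower q) (K : FiniteField (q ℕ.^ 6)) where
  open Geometry q K
  open FieldProperties K
  open LinearAlgebra q K
  open FrobeniusMap q-primePower K
  open Conics q-primePower K
  open Solver commutativeSemiring
  open ≡-Reasoning

  binary : (A B C : Carrier) → Vec 2 → Carrier
  binary A B C r = A * (a * a) + B * (a * b) + C * (b * b)
    where
    a = r zero
    b = r (suc zero)

  -- With the second coordinate normalised to 1, a first coordinate outside 𝔽_q means that no
  -- multiple of the vector is over 𝔽_q.
  Irrational : Vec 2 → Set
  Irrational r = ¬ (r zero ∈ 𝔽 1) × r (suc zero) ≡ 1#

  -- The zeros `r₁` and `r₂` may be proportional, which is the source of a repeated plane. Either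
  -- both are over 𝔽_q or both are irrational.
  record Splitting (A B C : Carrier) : Set where
    field
      r₁ r₂     : Vec 2
      r₁≢𝟎      : ¬ r₁ ≗ 𝟎
      r₂≢𝟎      : ¬ r₂ ≗ 𝟎
      r₁-root   : binary A B C r₁ ≡ 0#
      r₂-root   : binary A B C r₂ ≡ 0#
      complete  : ∀ r → binary A B C r ≡ 0# → (∃ λ s → r ≗ s ⊙ r₁) ⊎ (∃ λ s → r ≗ s ⊙ r₂)
      rationality : (EntriesIn 1 r₁ × EntriesIn 1 r₂) ⊎ (Irrational r₁ × Irrational r₂)

  private
    swap-sign : ∀ {x y} → x + y ≡ 0# → x ≡ - y
    swap-sign = +-inverseˡ-unique _ _

  -- The form factors as b (B a + C b).
  splitting-linear : ∀ {B C} → B ∈ 𝔽 1 → C ∈ 𝔽 1 → ¬ (B ≡ 0# × C ≡ 0#) → Splitting 0# B C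
  splitting-linear {B} {C} B∈ C∈ BC≢0 = record
    { r₁ = 1# ∷ 0# ∷ []
    ; r₂ = C ∷ - B ∷ []
    ; r₁≢𝟎 = λ r₁≗𝟎 → 1≢0 (r₁≗𝟎 zero)
    ; r₂≢𝟎 = λ r₂≗𝟎 → BC≢0 (trans (sym (-‿involutive B)) (trans (cong -_ (r₂≗𝟎 (suc zero))) -0#≈0#) , r₂≗𝟎 zero)
    ; r₁-root = solve 2 (λ B C → con 0 :* (con 1 :* con 1) :+ B :* (con 1 :* con 0) :+ C :* (con 0 :* con 0) := con 0) refl B C
    ; r₂-root = begin
        0# * (C * C) + B * (C * - B) + C * (- B * - B)
          ≡⟨ solve 3 (λ B B′ C → con 0 :* (C :* C) :+ B :* (C :* B′) :+ C :* (B′ :* B′) := (B :+ B′) :* (C :* B′)) refl B (- B) C ⟩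
        (B - B) * (C * - B) ≡⟨ trans (cong (_* (C * - B)) (-‿inverseʳ B)) (zeroˡ _) ⟩
        0# ∎
    ; complete = complete
    ; rationality = inj₁ ((λ { zero → fr-1# 1 ; (suc zero) → fr-0# 1 }) , λ { zero → C∈ ; (suc zero) → 𝔽-neg 1 B∈ })
    }
    where
    complete : ∀ r → binary 0# B C r ≡ 0# →
      (∃ λ s → r ≗ s ⊙ (1# ∷ 0# ∷ [])) ⊎ (∃ λ s → r ≗ s ⊙ (C ∷ - B ∷ []))
    complete r r-root with r (suc zero) ≟ 0#
    ... | yes b≡0 = inj₁ (r zero , λ { zero → sym (*-identityʳ _) ; (suc zero) → trans b≡0 (sym (zeroʳ _)) })
    ... | no b≢0 = solution (B ≟ 0#)
      where
      a = r zero
      b = r (suc zero)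
      Ba+Cb≡0 : B * a + C * b ≡ 0#
      Ba+Cb≡0 = noZeroDivisors (trans
        (solve 4 (λ B C a b → b :* (B :* a :+ C :* b) := con 0 :* (a :* a) :+ B :* (a :* b) :+ C :* (b :* b)) refl B C a b)
        r-root) b≢0
      solution : Dec (B ≡ 0#) → (∃ λ s → r ≗ s ⊙ (1# ∷ 0# ∷ [])) ⊎ (∃ λ s → r ≗ s ⊙ (C ∷ - B ∷ []))
      solution (yes refl) = contradiction (refl , noZeroDivisors
        (trans (solve 3 (λ a b C → b :* C := con 0 :* a :+ C :* b) refl a b C) Ba+Cb≡0) b≢0) BC≢0
      solution (no B≢0) = inj₂ (- (inv B B≢0 * b) , λ
        { zero → *-cancelˡ-≢0 B≢0 $ begin
            B * a                        ≡⟨ swap-sign Ba+Cb≡0 ⟩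
            - (C * b)                    ≡⟨ cong -_ (*-cancel-inv B B≢0 (C * b)) ⟨
            - (B * (inv B B≢0 * (C * b))) ≡⟨ cong -_ (solve 4 (λ B i C b → B :* (i :* (C :* b)) := B :* (i :* b :* C)) refl B (inv B B≢0) C b) ⟩
            - (B * (inv B B≢0 * b * C))  ≡⟨ -‿distribʳ-* B _ ⟩
            B * - (inv B B≢0 * b * C)    ≡⟨ cong (B *_) (-‿distribˡ-* _ C) ⟩
            B * (- (inv B B≢0 * b) * C)  ∎
        ; (suc zero) → begin
            b                            ≡⟨ inv-cancel-* B B≢0 b ⟨
            inv B B≢0 * (B * b)          ≡⟨ solve 3 (λ B i b → i :* (B :* b) := i :* b :* B) refl B (inv B B≢0) b ⟩
            inv B B≢0 * b * B            ≡⟨ -‿involutive _ ⟨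
            - - (inv B B≢0 * b * B)      ≡⟨ cong -_ (-‿distribˡ-* _ B) ⟩
            - (- (inv B B≢0 * b) * B)    ≡⟨ -‿distribʳ-* _ B ⟩
            - (inv B B≢0 * b) * - B      ∎ })

  -- Division by A leads to t² = b t + c with b = -B/A and c = -C/A. One root t comes from
  -- `quadraticRoot`, the other is b - t; as b is in 𝔽_q, they lie in 𝔽_q together or not at all.
  splitting-quadratic : ∀ {A B C} → A ≢ 0# → A ∈ 𝔽 1 → B ∈ 𝔽 1 → C ∈ 𝔽 1 → Splitting A B C
  splitting-quadratic {A} {B} {C} A≢0 A∈ B∈ C∈ = record
    { r₁ = t ∷ 1# ∷ []
    ; r₂ = t′ ∷ 1# ∷ []
    ; r₁≢𝟎 = λ r₁≗𝟎 → 1≢0 (r₁≗𝟎 (suc zero))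
    ; r₂≢𝟎 = λ r₂≗𝟎 → 1≢0 (r₂≗𝟎 (suc zero))
    ; r₁-root = root⇒ t-root
    ; r₂-root = root⇒ t′-root
    ; complete = complete
    ; rationality = rationality (fr 1 t ≟ t)
    }
    where
    b c : Carrier
    b = - (inv A A≢0 * B)
    c = - (inv A A≢0 * C)
    Ab+B≡0 : A * b + B ≡ 0#
    Ab+B≡0 = trans (cong (_+ B) (trans (sym (-‿distribʳ-* A _)) (cong -_ (*-cancel-inv A A≢0 B)))) (-‿inverseˡ B)
    Ac+C≡0 : A * c + C ≡ 0#
    Ac+C≡0 = trans (cong (_+ C) (trans (sym (-‿distribʳ-* A _)) (cong -_ (*-cancel-inv A A≢0 C)))) (-‿inverseˡ C)
    b∈ : fr 1 b ≡ b
    b∈ = 𝔽-neg 1 (𝔽-* 1 (𝔽-inv 1 A≢0 A∈) B∈)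
    c∈ : fr 1 c ≡ c
    c∈ = 𝔽-neg 1 (𝔽-* 1 (𝔽-inv 1 A≢0 A∈) C∈)
    module Roots = QuadraticRoots commutativeRing noZeroDivisors _≟_ b c
    t t′ : Carrier
    t = proj₁ (quadraticRoot b∈ c∈)
    t′ = b - t
    t-root : t * t ≡ b * t + c
    t-root = proj₂ (quadraticRoot b∈ c∈)
    t′+t≡b : t′ + t ≡ b
    t′+t≡b = //-rightDividesˡ t b

    t′-root : t′ * t′ ≡ b * t′ + c
    t′-root = +-cancelʳ (t′ * t + t * t) _ _ (begin
      t′ * t′ + (t′ * t + t * t)  ≡⟨ solve 2 (λ t t′ → t′ :* t′ :+ (t′ :* t :+ t :* t) := (t′ :+ t) :* t′ :+ t :* t) refl t t′ ⟩
      (t′ + t) * t′ + t * t       ≡⟨ cong₂ _+_ (cong (_* t′) t′+t≡b) t-root ⟩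
      b * t′ + (b * t + c)        ≡⟨ solve 4 (λ b c t t′ → b :* t′ :+ (b :* t :+ c) := b :* t′ :+ c :+ b :* t) refl b c t t′ ⟩
      b * t′ + c + b * t          ≡⟨ cong (λ e → b * t′ + c + e * t) t′+t≡b ⟨
      b * t′ + c + (t′ + t) * t   ≡⟨ cong (b * t′ + c +_) (distribʳ t t′ t) ⟩
      b * t′ + c + (t′ * t + t * t) ∎)

    root⇒ : ∀ {x} → x * x ≡ b * x + c → binary A B C (x ∷ 1# ∷ []) ≡ 0#
    root⇒ {x} x-root = begin
      A * (x * x) + B * (x * 1#) + C * (1# * 1#)
        ≡⟨ cong (λ e → A * e + B * (x * 1#) + C * (1# * 1#)) x-root ⟩
      A * (b * x + c) + B * (x * 1#) + C * (1# * 1#)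
        ≡⟨ solve 6 (λ A B C b c x → A :* (b :* x :+ c) :+ B :* (x :* con 1) :+ C :* (con 1 :* con 1)
             := (A :* b :+ B) :* x :+ (A :* c :+ C)) refl A B C b c x ⟩
      (A * b + B) * x + (A * c + C)
        ≡⟨ cong₂ _+_ (trans (cong (_* x) Ab+B≡0) (zeroˡ x)) Ac+C≡0 ⟩
      0# + 0#
        ≡⟨ +-identityˡ 0# ⟩
      0# ∎

    complete : ∀ r → binary A B C r ≡ 0# → (∃ λ s → r ≗ s ⊙ (t ∷ 1# ∷ [])) ⊎ (∃ λ s → r ≗ s ⊙ (t′ ∷ 1# ∷ []))
    complete r r-root with r (suc zero) ≟ 0#
    ... | yes y≡0 = inj₁ (0# , λ { zero → trans x≡0 (sym (zeroˡ t)) ; (suc zero) → trans y≡0 (sym (zeroˡ 1#)) })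
      where
      x≡0 : r zero ≡ 0#
      x≡0 with r zero ≟ 0#
      ... | yes eq = eq
      ... | no x≢0 = noZeroDivisors (noZeroDivisors (trans
        (solve 4 (λ A B C x → A :* (x :* x) := A :* (x :* x) :+ B :* (x :* con 0) :+ C :* (con 0 :* con 0)) refl A B C (r zero))
        (trans (cong (λ y → A * (r zero * r zero) + B * (r zero * y) + C * (y * y)) (sym y≡0)) r-root)) A≢0) x≢0
    ... | no y≢0 = map⊎ (proportional t) (λ s+t≡b → proportional t′ (+-cancelʳ t s t′ (trans s+t≡b (sym t′+t≡b))))
        (Roots.roots s-root t-root)
      where
      y = r (suc zero)
      s = inv y y≢0 * r zero
      ys≡x : y * s ≡ r zero
      ys≡x = *-cancel-inv y y≢0 (r zero)
      proportional : ∀ u → s ≡ u → ∃ λ k → r ≗ k ⊙ (u ∷ 1# ∷ [])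
      proportional u refl = y , λ { zero → sym ys≡x ; (suc zero) → sym (*-identityʳ y) }
      s-root : s * s ≡ b * s + c
      -- After multiplication by A y², the equation follows from `r-root` once a multiple of A b + B
      -- and A c + C, both zero, is added to each side.
      s-root = *-cancelˡ-≢0 (*-≢0 A≢0 (*-≢0 y≢0 y≢0)) (+-cancelʳ (y * y * ((A * b + B) * s + (A * c + C))) _ _ (begin
        A * (y * y) * (s * s) + y * y * ((A * b + B) * s + (A * c + C))
          ≡⟨ solve 7 (λ A B C b c s y → A :* (y :* y) :* (s :* s) :+ y :* y :* ((A :* b :+ B) :* s :+ (A :* c :+ C))
               := A :* (y :* y) :* (b :* s :+ c) :+ (A :* (y :* s :* (y :* s)) :+ B :* (y :* s :* y) :+ C :* (y :* y))) refl A B C b c s y ⟩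
        A * (y * y) * (b * s + c) + (A * (y * s * (y * s)) + B * (y * s * y) + C * (y * y))
          ≡⟨ cong (A * (y * y) * (b * s + c) +_) (trans (cong (λ e → A * (e * e) + B * (e * y) + C * (y * y)) ys≡x) r-root) ⟩
        A * (y * y) * (b * s + c) + 0#
          ≡⟨ cong (A * (y * y) * (b * s + c) +_) (trans (cong₂ (λ e f → y * y * (e * s + f)) Ab+B≡0 Ac+C≡0)
               (solve 2 (λ s y → y :* y :* (con 0 :* s :+ con 0) := con 0) refl s y)) ⟨
        A * (y * y) * (b * s + c) + y * y * ((A * b + B) * s + (A * c + C)) ∎))

    rationality : Dec (fr 1 t ≡ t) → (EntriesIn 1 (t ∷ 1# ∷ []) × EntriesIn 1 (t′ ∷ 1# ∷ []))
                                   ⊎ (Irrational (t ∷ 1# ∷ []) × Irrational (t′ ∷ 1# ∷ []))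
    rationality (yes t∈) = inj₁ ((λ { zero → t∈ ; (suc zero) → fr-1# 1 })
      , λ { zero → 𝔽-+ 1 b∈ (𝔽-neg 1 t∈) ; (suc zero) → fr-1# 1 })
    rationality (no t∉) = inj₂ ((t∉ , refl) , ((λ t′∈ → t∉ (+-cancelˡ t′ _ _ (begin
      t′ + fr 1 t       ≡⟨ cong (_+ fr 1 t) t′∈ ⟨
      fr 1 t′ + fr 1 t  ≡⟨ fr-+ 1 t′ t ⟨
      fr 1 (t′ + t)     ≡⟨ cong (fr 1) t′+t≡b ⟩
      fr 1 b            ≡⟨ b∈ ⟩
      b                 ≡⟨ t′+t≡b ⟨
      t′ + t            ∎))) , refl))

  splitting : ∀ {A B C} → A ∈ 𝔽 1 → B ∈ 𝔽 1 → C ∈ 𝔽 1 → ¬ (A ≡ 0# × B ≡ 0# × C ≡ 0#) → Splitting A B C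
  splitting {A} A∈ B∈ C∈ ABC≢0 with A ≟ 0#
  ... | yes refl = splitting-linear B∈ C∈ (λ { (B≡0 , C≡0) → ABC≢0 (refl , B≡0 , C≡0) })
  ... | no A≢0   = splitting-quadratic A≢0 A∈ B∈ C∈

  module _ (D : Conic 1) where
    private
      a = form D zero zero
      m₁ = form D zero (suc zero) + form D (suc zero) zero
      m₂ = form D zero (suc (suc zero)) + form D (suc (suc zero)) zero
      A = form D (suc zero) (suc zero)
      B = form D (suc zero) (suc (suc zero)) + form D (suc (suc zero)) (suc zero)
      C = form D (suc (suc zero)) (suc (suc zero))

    quadratic-expand : ∀ x → quadratic (form D) x ≡
      x zero * (a * x zero + (m₁ * x (suc zero) + m₂ * x (suc (suc zero)))) + binary A B C (x ∘ suc)
    quadratic-expand x = solve 12 (λ a₀₀ a₀₁ a₀₂ a₁₀ a₁₁ a₁₂ a₂₀ a₂₁ a₂₂ x y z →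
        (a₀₀ :* x :* x :+ (a₀₁ :* x :* y :+ (a₀₂ :* x :* z :+ con 0)))
        :+ ((a₁₀ :* y :* x :+ (a₁₁ :* y :* y :+ (a₁₂ :* y :* z :+ con 0)))
        :+ ((a₂₀ :* z :* x :+ (a₂₁ :* z :* y :+ (a₂₂ :* z :* z :+ con 0))) :+ con 0))
        := x :* (a₀₀ :* x :+ ((a₀₁ :+ a₁₀) :* y :+ (a₀₂ :+ a₂₀) :* z))
          :+ (a₁₁ :* (y :* y) :+ (a₁₂ :+ a₂₁) :* (y :* z) :+ a₂₂ :* (z :* z)))
      refl
      (M zero zero) (M zero (suc zero)) (M zero (suc (suc zero)))
      (M (suc zero) zero) (M (suc zero) (suc zero)) (M (suc zero) (suc (suc zero)))
      (M (suc (suc zero)) zero) (M (suc (suc zero)) (suc zero)) (M (suc (suc zero)) (suc (suc zero)))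
      (x zero) (x (suc zero)) (x (suc (suc zero)))
      where M = form D

    quadratic-at-infinity : ∀ x → x zero ≡ 0# → quadratic (form D) x ≡ binary A B C (x ∘ suc)
    quadratic-at-infinity x x₀≡0 = trans (quadratic-expand x)
      (trans (cong (_+ binary A B C (x ∘ suc)) (trans (cong (_* (a * x zero + (m₁ * x (suc zero) + m₂ * x (suc (suc zero))))) x₀≡0) (zeroˡ _)))
             (+-identityˡ _))

    -- Otherwise the form is a product of x₀ with a linear form, and the meet of
    -- the two lines is a vertex.
    binary≢0 : ¬ (A ≡ 0# × B ≡ 0# × C ≡ 0#)
    binary≢0 (A≡0 , B≡0 , C≡0) = meet (m₁ ≟ 0#) (m₂ ≟ 0#)
      where
      binary≡0 : ∀ r → binary A B C r ≡ 0#
      binary≡0 r = trans (cong₂ (λ A C → A * (r zero * r zero) + B * (r zero * r (suc zero)) + C * (r (suc zero) * r (suc zero))) A≡0 C≡0)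
        (trans (cong (λ B → 0# * (r zero * r zero) + B * (r zero * r (suc zero)) + 0# * (r (suc zero) * r (suc zero))) B≡0)
        (solve 2 (λ x y → con 0 :* (x :* x) :+ con 0 :* (x :* y) :+ con 0 :* (y :* y) := con 0) refl (r zero) (r (suc zero))))
      reducible : ∀ x → quadratic (form D) x ≡ x zero * (a * x zero + (m₁ * x (suc zero) + m₂ * x (suc (suc zero))))
      reducible x = trans (quadratic-expand x) (trans
        (cong (x zero * (a * x zero + (m₁ * x (suc zero) + m₂ * x (suc (suc zero)))) +_)
              (binary≡0 (x ∘ suc)))
        (+-identityʳ _))
      neg≡0 : ∀ {x} → - x ≡ 0# → x ≡ 0#
      neg≡0 {x} -x≡0 = trans (sym (-‿involutive x)) (trans (cong -_ -x≡0) -0#≈0#)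
      orthogonal : m₁ * m₂ + m₂ * - m₁ ≡ 0#
      orthogonal = trans (cong (m₁ * m₂ +_) (trans (sym (-‿distribʳ-* m₂ m₁)) (cong -_ (*-comm m₂ m₁)))) (-‿inverseʳ _)
      vertex : ∀ v w → m₁ * v + m₂ * w ≡ 0# → ¬ ¬ (v ≡ 0# × w ≡ 0#)
      vertex v w mv≡0 vw≢0 = Conic.nondegenerate D
        (point (0# ∷ v ∷ w ∷ []) (λ V≗𝟎 → vw≢0 (V≗𝟎 (suc zero) , V≗𝟎 (suc (suc zero)))))
        λ x → begin
          quadratic (form D) (x ⊕ (0# ∷ v ∷ w ∷ []))
            ≡⟨ reducible (x ⊕ (0# ∷ v ∷ w ∷ [])) ⟩
          (x zero + 0#) * (a * (x zero + 0#) + (m₁ * (x (suc zero) + v) + m₂ * (x (suc (suc zero)) + w)))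
            ≡⟨ solve 8 (λ a m₁ m₂ x y z v w →
                 (x :+ con 0) :* (a :* (x :+ con 0) :+ (m₁ :* (y :+ v) :+ m₂ :* (z :+ w)))
                 := x :* (a :* x :+ (m₁ :* y :+ m₂ :* z)) :+ x :* (m₁ :* v :+ m₂ :* w))
               refl a m₁ m₂ (x zero) (x (suc zero)) (x (suc (suc zero))) v w ⟩
          x zero * (a * x zero + (m₁ * x (suc zero) + m₂ * x (suc (suc zero)))) + x zero * (m₁ * v + m₂ * w)
            ≡⟨ cong₂ _+_ (sym (reducible x)) (trans (cong (x zero *_) mv≡0) (zeroʳ _)) ⟩
          quadratic (form D) x + 0#
            ≡⟨ +-identityʳ _ ⟩
          quadratic (form D) x ∎
      meet : Dec (m₁ ≡ 0#) → ¬ Dec (m₂ ≡ 0#)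
      -- For m₁ = m₂ = 0 the form is a x₀², and any point of x₀ = 0 is a vertex; otherwise (0, m₂,
      -- -m₁) lies on both lines.
      meet (yes m₁≡0) (yes m₂≡0) = vertex 1# 0# (trans (cong₂ _+_ (trans (cong (_* 1#) m₁≡0) (zeroˡ 1#)) (zeroʳ m₂)) (+-identityˡ 0#))
        (1≢0 ∘ proj₁)
      meet (no m₁≢0) _ = vertex m₂ (- m₁) orthogonal (m₁≢0 ∘ neg≡0 ∘ proj₂)
      meet (yes _) (no m₂≢0) = vertex m₂ (- m₁) orthogonal (m₂≢0 ∘ proj₁)

    splitting-at-infinity : Splitting A B C
    splitting-at-infinity = splitting
      (Conic.rational D _ _) (𝔽-+ 1 (Conic.rational D _ _) (Conic.rational D _ _)) (Conic.rational D _ _) binary≢0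

-- Equations of C⁺⁺, Σ∞ and Σ₆ in the frame, and the components of the curve.

module Decomposition {q : ℕ} (q-primePower : IsPrimePower q) (K : FiniteField (q ℕ.^ 6)) where
  open Geometry q K
  open FieldProperties K
  open LinearAlgebra q K
  open FrobeniusMap q-primePower K
  open Conics q-primePower K
  open Coordinates q-primePower K
  open BinaryForms q-primePower K
  open Sum semiring using (sum-cong-≗; *-distribˡ-sum; sum-replicate-zero; ∑-comm)
  open ≡-Reasoning

  private
    variable
      n d : ℕ

  basisPoint : ∀ {k} (S : Subspace k n d) (j : Fin d) → Point n
  basisPoint S j = point (basis S j) (independent⇒≢𝟎 (basis S) (independent S) j)

  basisPoint∈ : ∀ {k} (S : Subspace k n d) (j : Fin d) → basisPoint S j ∈ ⟦ S ⟧ ∩ PG k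
  basisPoint∈ S j = Span-member (basis S) j , basis S j , Subspace.rational S j , ≗⇒∼ (λ _ → refl)

  ⊛-combinationʳ : ∀ s (b : Vector (Vec 3) d) y i →
    combination (λ j → (s ⊛ b j) i) y ≗ (s ⊛ combination b y) i
  ⊛-combinationʳ s b y i k = trans
    (sum-cong-≗ λ j → trans (sym (*-assoc (y j) (s i) (b j k))) (trans (cong (_* b j k) (*-comm (y j) (s i))) (*-assoc (s i) (y j) (b j k))))
    (sym (*-distribˡ-sum (s i) (λ j → y j * b j k)))

  ⊛-combinationˡ : ∀ (a : Vector (Vec 3) d) y s i →
    combination (λ j → (a j ⊛ y) i) s ≗ (combination a s ⊛ y) i
  ⊛-combinationˡ a y s i k = trans (sum-cong-≗ λ j → sym (*-assoc (s j) (a j i) (y k)))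
    (sym (*-distribʳ-sum (y k) (λ j → s j * a j i)))
    where open Sum semiring using (*-distribʳ-sum)

  -- Both uniqueness hypotheses are applied to the conic N pulled back along F⁻¹.
  module _ {π C : PointSet 3} {ℓ∞ : Line} (frm : Frame π C ℓ∞) where
    open Frame frm

    private
      -- The columns of F⁻¹.
      W : Vector (Vec 3) 3
      W j = proj₁ (spans F F-independent (δ j))

      FW≗δ : ∀ j → combination F (W j) ≗ δ j
      FW≗δ j = sym ∘ proj₂ (spans F F-independent (δ j))

      FW : ∀ x → combination F (combination W x) ≗ x
      FW x i = begin
        combination F (combination W x) i   ≡⟨ combination-combination F W x i ⟨
        combination (combination F ∘ W) x i ≡⟨ combination-congˡ (combination F ∘ W) δ x FW≗δ i ⟩
        combination δ x i                   ≡⟨ combination-of-δ x i ⟩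
        x i                                 ∎

      W-independent : Independent W
      W-independent x Wx≗𝟎 i = trans (sym (FW x i)) (trans (combination-congʳ F Wx≗𝟎 i) (combination-𝟎 F i))

      W-rational : ∀ j → EntriesIn 3 (W j)
      W-rational j = coefficients-rational 3 F (W j) F-independent F-rational
        (λ i → trans (cong (fr 3) (FW≗δ j i)) (trans (δ-rational 3 j i) (sym (FW≗δ j i))))

      N₃ : Conic 3
      N₃ = record { form = form N ; rational = λ i j → 𝔽₁⊆𝔽 3 (Conic.rational N i j) ; nondegenerate = Conic.nondegenerate N }

      D₃ : Conic 3
      D₃ = transformConic N₃ W W-independent W-rational (Conic.rational N₃)

      D₆ : Conic 6
      D₆ = record { form = form D₃ ; rational = λ i j → fr-6 _ ; nondegenerate = Conic.nondegenerate D₃ }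

      D-form : ∀ {x} y → x ≗ combination F y → quadratic (form D₃) x ≡ quadratic (form N) y
      D-form {x} y x≗Fy = trans (quadratic-∘ᶠ (form N) W x) (quadratic-cong (form N)
        (independent-injective F F-independent (combination W x) y (λ i → trans (FW x i) (x≗Fy i))))

      everywhere : ∀ (X : Point 3) → X ∈ PG 6
      everywhere X = coords X , (λ i → fr-6 (coords X i)) , ≗⇒∼ (λ _ → refl)

    C⁺⁺-equation : (C⁺ : Conic 3) → IsUniqueConicThrough C C⁺ →
      (C⁺⁺ : Conic 6) → IsUniqueConicThrough (pts C⁺ ∩ PG 3) C⁺⁺ →
      ∀ X y → coords X ≗ combination F y →
      (X ∈ pts C⁺⁺ → quadratic (form N) y ≡ 0#) × (quadratic (form N) y ≡ 0# → X ∈ pts C⁺⁺)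
    C⁺⁺-equation C⁺ C⁺-unique C⁺⁺ C⁺⁺-unique X y X≗Fy =
      (λ X∈ → trans (sym (D-form y X≗Fy)) (proj₁ (proj₁ C⁺⁺≐D₆ {X} (X∈ , everywhere X)))) ,
      (λ y∈ → proj₁ (proj₂ C⁺⁺≐D₆ {X} (trans (D-form y X≗Fy) y∈ , everywhere X)))
      where
      C⊆D₃ : C ⊆ pts D₃
      C⊆D₃ X∈C = let y , X∼Fy , y∈ = C⇒ X∈C in
        quadratic-∼ (form D₃) X∼Fy (trans (D-form y (λ _ → refl)) y∈)
      C⁺≐D₃ : pts C⁺ ∩ PG 3 ≐ pts D₃ ∩ PG 3
      C⁺≐D₃ = IsUniqueConicThrough.unique C⁺-unique D₃ (λ {X} → C⊆D₃ {X})
      -- `D₆` has the equation of `D₃`, which the 𝔽_{q³}-points of C⁺ satisfy by the preceding step.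
      C⁺⁺≐D₆ : pts C⁺⁺ ∩ PG 6 ≐ pts D₆ ∩ PG 6
      C⁺⁺≐D₆ = IsUniqueConicThrough.unique C⁺⁺-unique D₆ (λ {X} X∈ → proj₁ (proj₁ C⁺≐D₃ {X} X∈))

  module _ {π C : PointSet 3} {ℓ∞ : Line} (frm : Frame π C ℓ∞) (bose : BoseRepresentation) (bb : BruckBose bose ℓ∞) where
    open Frame frm
    open BoseRepresentation bose
    open BruckBose bb
    open Bose F F-independent F-rational bose

    E-𝟎 : E (λ _ → 𝟎) ≗ 𝟎
    E-𝟎 k = trans (sum-cong-≗ (λ i → combination-𝟎 (β^ i) k)) (sum-replicate-zero 3)

    E-kernel : ∀ z → E z ≗ 𝟎 → ∀ i → z i ≗ 𝟎
    E-kernel z Ez≗𝟎 = E-injective z (λ _ → 𝟎) (λ k → trans (Ez≗𝟎 k) (sym (E-𝟎 k)))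

    E-combination : ∀ (z : Vector (Fin 3 → Vec 3) d) c →
      combination (E ∘ z) c ≗ E (λ i → combination (λ j → z j i) c)
    E-combination z c k = begin
      sum (λ j → c j * sum (λ i → combination (β^ i) (z j i) k))
        ≡⟨ sum-cong-≗ (λ j → *-distribˡ-sum (c j) (λ i → combination (β^ i) (z j i) k)) ⟩
      sum (λ j → sum (λ i → c j * combination (β^ i) (z j i) k))
        ≡⟨ ∑-comm (λ j i → c j * combination (β^ i) (z j i) k) ⟩
      sum (λ i → combination (λ j → combination (β^ i) (z j i)) c k)
        ≡⟨ sum-cong-≗ (λ i → combination-combination (β^ i) (λ j → z j i) c k) ⟩
      sum (λ i → combination (β^ i) (combination (λ j → z j i) c) k) ∎

    E-combinationʳ : ∀ s (b : Vector (Vec 3) d) y →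
      combination (λ j → E (s ⊛ b j)) y ≗ E (s ⊛ combination b y)
    E-combinationʳ s b y k = trans (E-combination (λ j → s ⊛ b j) y k) (E-cong _ (s ⊛ combination b y) (⊛-combinationʳ s b y) k)

    E-combinationˡ : ∀ (a : Vector (Vec 3) d) y s →
      combination (λ j → E (a j ⊛ y)) s ≗ E (combination a s ⊛ y)
    E-combinationˡ a y s k = trans (E-combination (λ j → a j ⊛ y) s k) (E-cong _ (combination a s ⊛ y) (⊛-combinationˡ a y s) k)

    ⊛-cong : ∀ s s′ y y′ → s ≗ s′ → y ≗ y′ → E (s ⊛ y) ≗ E (s′ ⊛ y′)
    ⊛-cong s s′ y y′ s≗s′ y≗y′ = E-cong (s ⊛ y) (s′ ⊛ y′) (λ i j → cong₂ _*_ (s≗s′ i) (y≗y′ j))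

    conjugate : Carrier → Vec 3
    conjugate x i = σ i x

    -- For y over 𝔽_q the rows x^{qⁱ} y are the conjugates of x y, the shape of an 𝔽_q-point.
    ⊛-rational : ∀ x y → x ∈ 𝔽 3 → EntriesIn 1 y → EntriesIn 1 (E (conjugate x ⊛ y))
    ⊛-rational x y x∈ y∈ k = trans (cong (fr 1) (sym (eq k)))
      (trans (conj⇒rational (x ⊙ y) (λ j → 𝔽-* 3 x∈ (𝔽₁⊆𝔽 3 (y∈ j))) k) (eq k))
      where
      eq : E (λ i → conj i (x ⊙ y)) ≗ E (conjugate x ⊛ y)
      eq = E-cong _ (conjugate x ⊛ y) (λ i j → trans (σ-* i x (y j)) (cong (σ i x *_) (σ-𝔽₁ i (y∈ j))))

    private
      line⊆tail : ∀ {v} → Span (conjugates (map toΓ (basis ℓ∞))) v → Span (conjugates (β ∘ suc)) v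
      line⊆tail = Span-trans (conjugates (β ∘ suc)) (conjugates (map toΓ (basis ℓ∞)))
        (Span-conjugates (map toΓ (basis ℓ∞)) (β ∘ suc) λ j → let c , eq = ℓ∞⊆ j in
          c , λ k → trans (combination-congʳ (basis Γ) eq k) (sym (combination-combination (basis Γ) (F ∘ suc) c k)))

      Σ∞⊆tail : ∀ j → Span (conjugates (β ∘ suc)) (basis Σ∞ j)
      Σ∞⊆tail j = line⊆tail (proj₁ (proj₁ Σ∞-def {basisPoint Σ∞ j} (basisPoint∈ Σ∞ j)))

    Σ∞⇒ : ∀ {v} → Span (basis Σ∞) v → ∃ λ z → (∀ i → z i zero ≡ 0#) × v ≗ E z
    Σ∞⇒ v∈ = E-tail (Span-trans (conjugates (β ∘ suc)) (basis Σ∞) Σ∞⊆tail v∈)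

    -- Σ∞ has six independent vectors inside the span of the six vectors `conjugates (β ∘ suc)`; by
    -- `exchange` both spans are equal.
    Σ∞⇐ : ∀ z → (∀ i → z i zero ≡ 0#) → Span (basis Σ∞) (E z)
    Σ∞⇐ z z₀≡0 = Span-trans (basis Σ∞) (conjugates (β ∘ suc))
      (proj₂ (exchange (basis Σ∞) (conjugates (β ∘ suc)) (independent Σ∞) Σ∞⊆tail)) (tail-E z z₀≡0)

    private
      -- Σ₆ is spanned by Σ∞ and one further 𝔽_q-vector `e`. Modulo Σ∞ only the first column of its
      -- matrix `ζ` counts, and rationality makes this column (θ, θ^q, θ^{q²}).
      extra : ∃ λ j → ¬ Span (basis Σ∞) (basis Σ₆ j)
      extra = outside (basis Σ₆) (basis Σ∞) (independent Σ₆)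

      e : Vec 9
      e = basis Σ₆ (proj₁ extra)

      ζ : Fin 3 → Vec 3
      ζ = proj₁ (E-onto e)

      e≗Eζ : e ≗ E ζ
      e≗Eζ = proj₂ (E-onto e)

      ζ-conj : (∀ i → ζ i ≗ conj i (ζ zero)) × EntriesIn 3 (ζ zero)
      ζ-conj = rational⇒conj ζ (λ k → trans (cong (fr 1) (sym (e≗Eζ k)))
        (trans (Subspace.rational Σ₆ (proj₁ extra) k) (e≗Eζ k)))

    θ : Carrier
    θ = ζ zero zero

    θ∈ : θ ∈ 𝔽 3
    θ∈ = proj₂ ζ-conj zero

    τ : Vec 3
    τ = conjugate θ

    private
      ζ₀≡τ : ∀ i → ζ i zero ≡ τ i
      ζ₀≡τ i = proj₁ ζ-conj i zero

    θ≢0 : θ ≢ 0#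
    θ≢0 θ≡0 = proj₂ extra (Span-cong (basis Σ∞) (λ k → sym (e≗Eζ k))
      (Σ∞⇐ ζ (λ i → trans (ζ₀≡τ i) (trans (cong (σ i) θ≡0) (σ-0# i)))))

    τ≢0 : ∀ i → τ i ≢ 0#
    τ≢0 i = σ-≢0 i θ≢0

    private
      Σ∞⊆Σ₆′ : ∀ j → Span (basis Σ₆) (basis Σ∞ j)
      Σ∞⊆Σ₆′ j = Σ∞⊆Σ₆ {basisPoint Σ∞ j} (basisPoint∈ Σ∞ j)

      Σ₆⊆eΣ∞ : ∀ j → Span (e ∷ basis Σ∞) (basis Σ₆ j)
      Σ₆⊆eΣ∞ = proj₂ (exchange (e ∷ basis Σ∞) (basis Σ₆)
        (independent-∷ (basis Σ∞) e (independent Σ∞) (proj₂ extra))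
        λ { zero → Span-member (basis Σ₆) (proj₁ extra) ; (suc j) → Σ∞⊆Σ₆′ j })

    Σ₆⇒ : ∀ z → Span (basis Σ₆) (E z) → ∃ λ l → ∀ i → z i zero ≡ l * τ i
    Σ₆⇒ z Ez∈ = l , λ i → begin
        z i zero                      ≡⟨ E-injective z (λ i → l ⊙ ζ i ⊕ z′ i) Ez≗ i zero ⟩
        l * ζ i zero + z′ i zero      ≡⟨ cong₂ _+_ (cong (l *_) (ζ₀≡τ i)) (proj₁ (proj₂ rest) i) ⟩
        l * τ i + 0#                  ≡⟨ +-identityʳ _ ⟩
        l * τ i                       ∎
      where
      inSpan : Span (e ∷ basis Σ∞) (E z)
      inSpan = Span-trans (e ∷ basis Σ∞) (basis Σ₆) Σ₆⊆eΣ∞ Ez∈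
      c = proj₁ inSpan
      l = c zero
      rest : ∃ λ z′ → (∀ i → z′ i zero ≡ 0#) × combination (basis Σ∞) (c ∘ suc) ≗ E z′
      rest = Σ∞⇒ (c ∘ suc , λ _ → refl)
      z′ = proj₁ rest
      Ez≗ : E z ≗ E (λ i → l ⊙ ζ i ⊕ z′ i)
      Ez≗ k = begin
        E z k                                            ≡⟨ proj₂ inSpan k ⟩
        l * e k + combination (basis Σ∞) (c ∘ suc) k     ≡⟨ cong₂ _+_ (cong (l *_) (e≗Eζ k)) (proj₂ (proj₂ rest) k) ⟩
        l * E ζ k + E z′ k                               ≡⟨ cong (_+ E z′ k) (E-⊙ l ζ k) ⟨
        E (λ i → l ⊙ ζ i) k + E z′ k                     ≡⟨ E-⊕ (λ i → l ⊙ ζ i) z′ k ⟨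
        E (λ i → l ⊙ ζ i ⊕ z′ i) k                       ∎

    Σ₆⇐ : ∀ z l → (∀ i → z i zero ≡ l * τ i) → Span (basis Σ₆) (E z)
    Σ₆⇐ z l z₀≡lτ = Span-cong (basis Σ₆) {l ⊙ E ζ ⊕ E z′} {E z}
      (λ k → begin
        l * E ζ k + E z′ k                  ≡⟨ cong (_+ E z′ k) (E-⊙ l ζ k) ⟨
        E (λ i → l ⊙ ζ i) k + E z′ k        ≡⟨ E-⊕ (λ i → l ⊙ ζ i) z′ k ⟨
        E (λ i → l ⊙ ζ i ⊕ z′ i) k          ≡⟨ E-cong (λ i → l ⊙ ζ i ⊕ z′ i) z (λ i j → trans (+-comm _ _) (//-rightDividesˡ (l * ζ i j) (z i j))) k ⟩
        E z k                               ∎)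
      (Span-⊕ (basis Σ₆)
        (Span-⊙ (basis Σ₆) l (Span-cong (basis Σ₆) e≗Eζ (Span-member (basis Σ₆) (proj₁ extra))))
        (Span-trans (basis Σ₆) (basis Σ∞) Σ∞⊆Σ₆′ (Σ∞⇐ z′ λ i →
          trans (cong₂ _-_ (z₀≡lτ i) (cong (l *_) (ζ₀≡τ i))) (-‿inverseʳ _))))
      where
      z′ : Fin 3 → Vec 3
      z′ i j = z i j - l * ζ i j

    private
      E-combination-δ : ∀ y → combination (λ j → E (τ ⊛ δ j)) y ≗ E (τ ⊛ y)
      E-combination-δ y k = trans (E-combinationʳ τ δ y k) (⊛-cong τ τ (combination δ y) y (λ _ → refl) (combination-of-δ y) k)

    -- The plane of the points τ ⊗ y. With this basis the coordinates used by `conicIn` are the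
    -- frame coordinates y, so the conic `N` of the frame serves unchanged.
    Π : Subspace 1 9 3
    Π = record
      { basis = λ j → E (τ ⊛ δ j)
      ; rational = λ j → ⊛-rational θ (δ j) θ∈ (δ-rational 1 j)
      ; independent = λ y Πy≗𝟎 j → noZeroDivisors (E-kernel (τ ⊛ y)
          (λ k → trans (sym (E-combination-δ y k)) (Πy≗𝟎 k)) zero j) θ≢0
      }

    Π-combination : ∀ y → combination (basis Π) y ≗ E (τ ⊛ y)
    Π-combination = E-combination-δ

    Π⊆Σ₆ : ⟦ Π ⟧ ⊆ ⟦ Σ₆ ⟧
    Π⊆Σ₆ {Z} (y , Z≗) = Span-cong (basis Σ₆) (λ k → sym (trans (Z≗ k) (Π-combination y k)))
      (Σ₆⇐ (τ ⊛ y) (y zero) (λ i → *-comm (τ i) (y zero)))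

    Π⊈Σ∞ : ⟦ Π ⟧ ∩ PG 1 ⊈ ⟦ Σ∞ ⟧
    Π⊈Σ∞ Π⊆Σ∞ = absurd (Σ∞⇒ (Π⊆Σ∞ {basisPoint Π zero} (basisPoint∈ Π zero)))
      where
      absurd : ¬ (∃ λ z → (∀ i → z i zero ≡ 0#) × E (τ ⊛ δ zero) ≗ E z)
      absurd (z , z₀≡0 , Πδ≗Ez) = θ≢0 (begin
        θ               ≡⟨ *-identityʳ θ ⟨
        τ zero * 1#     ≡⟨ E-injective (τ ⊛ δ zero) z Πδ≗Ez zero zero ⟩
        z zero zero     ≡⟨ z₀≡0 zero ⟩
        0#              ∎)

    -- The points s ⊗ r with r fixed: the scroll-plane of the point with frame coordinates r. It is
    -- defined over 𝔽_{q⁶}, where r may lie.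
    ⊛-plane : ∀ r → ¬ r ≗ 𝟎 → Subspace 6 9 3
    ⊛-plane r r≢𝟎 = record
      { basis = λ i → E (δ i ⊛ r)
      ; rational = λ i k → fr-6 _
      ; independent = λ s Es≗𝟎 i → s≡0 s (E-kernel (combination δ s ⊛ r) (λ k → trans (sym (E-combinationˡ δ r s k)) (Es≗𝟎 k))) i
      }
      where
      s≡0 : ∀ s → (∀ i j → combination δ s i * r j ≡ 0#) → ∀ i → s i ≡ 0#
      s≡0 s eq i with zero⊎nonzero r
      ... | inj₁ r≗𝟎 = contradiction r≗𝟎 r≢𝟎
      ... | inj₂ (j , rⱼ≢0) = trans (sym (combination-of-δ s i))
        (noZeroDivisors (trans (*-comm (r j) _) (eq i j)) rⱼ≢0)

    ⊛-plane⇒ : ∀ r r≢𝟎 {v} → Span (basis (⊛-plane r r≢𝟎)) v → ∃ λ s → v ≗ E (s ⊛ r)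
    ⊛-plane⇒ r r≢𝟎 (s , v≗) = combination δ s , λ k → trans (v≗ k) (E-combinationˡ δ r s k)

    ⊛-plane⇐ : ∀ r r≢𝟎 s → Span (basis (⊛-plane r r≢𝟎)) (E (s ⊛ r))
    ⊛-plane⇐ r r≢𝟎 s = s , λ k → trans (⊛-cong s (combination δ s) r r (λ i → sym (combination-of-δ s i)) (λ _ → refl) k)
      (sym (E-combinationˡ δ r s k))

    ⊛-plane⊆Σ∞ : ∀ r r≢𝟎 → r zero ≡ 0# → ⟦ ⊛-plane r r≢𝟎 ⟧ ⊆ ⟦ Σ∞ ⟧
    ⊛-plane⊆Σ∞ r r≢𝟎 r₀≡0 {Z} Z∈ = let s , Z≗ = ⊛-plane⇒ r r≢𝟎 Z∈ in
      Span-cong (basis Σ∞) (sym ∘ Z≗) (Σ∞⇐ (s ⊛ r) (λ i → trans (cong (s i *_) r₀≡0) (zeroʳ _)))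

    private
      -- If every entry of a basis vector of Γ were in 𝔽_q, then Γ would meet PG(8, q).
      generator : ∃ λ ω → ω ∈ 𝔽 3 × ¬ ω ∈ 𝔽 1
      generator with Fin.all? (λ k → fr 1 (basis Γ zero k) ≟ basis Γ zero k)
      ... | yes Γ₀∈ = contradiction (Span-member (basis Γ) zero , basis Γ zero , Γ₀∈ , ≗⇒∼ (λ _ → refl))
                        (λ inΓ∩PG1 → disjoint {basisPoint Γ zero} inΓ∩PG1)
      ... | no Γ₀∉ = let k , ∉ = Fin.¬∀⟶∃¬ _ _ (λ k → fr 1 (basis Γ zero k) ≟ basis Γ zero k) Γ₀∉ in
        basis Γ zero k , Subspace.rational Γ zero k , ∉

    -- An 𝔽_q-rational basis comes from the powers of ω: the Vandermonde matrix of
    -- ω, ω^q, ω^{q²} is invertible.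
    ⊛-plane-real : ∀ r r≢𝟎 → EntriesIn 1 r → IsRealPlane (⊛-plane r r≢𝟎)
    ⊛-plane-real r r≢𝟎 r∈ = Π₀ , (λ {Z} → to {Z}) , (λ {Z} → from {Z})
      where
      ω = proj₁ generator
      ω∈ = proj₁ (proj₂ generator)
      ω∉ = proj₂ (proj₂ generator)
      powers : Vec 3
      powers = 1# ∷ ω ∷ ω * ω ∷ []
      powers∈ : ∀ j → powers j ∈ 𝔽 3
      powers∈ zero             = fr-1# 3
      powers∈ (suc zero)       = ω∈
      powers∈ (suc (suc zero)) = 𝔽-* 3 ω∈ ω∈
      a : Vector (Vec 3) 3
      a j = conjugate (powers j)
      fr3 : fr 1 (fr 1 (fr 1 ω)) ≡ ω
      fr3 = trans (cong (fr 1) (fr-fr 1 1 ω)) (trans (fr-fr 2 1 ω) ω∈)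
      -- Any coincidence among ω, ω^q, ω^{q²}, after a further q-power and with ω^{q³} = ω, yields
      -- ω^q = ω.
      distinct : ∀ {i j} → σ i ω ≡ σ j ω → i ≡ j
      distinct {zero} {zero} _ = refl
      distinct {suc zero} {suc zero} _ = refl
      distinct {suc (suc zero)} {suc (suc zero)} _ = refl
      distinct {zero} {suc zero} eq = contradiction (sym eq) ω∉
      distinct {suc zero} {zero} eq = contradiction eq ω∉
      distinct {zero} {suc (suc zero)} eq = contradiction (trans (cong (fr 1) (trans eq (sym (fr-fr 1 1 ω)))) fr3) ω∉
      distinct {suc (suc zero)} {zero} eq = contradiction (trans (cong (fr 1) (trans (sym eq) (sym (fr-fr 1 1 ω)))) fr3) ω∉
      distinct {suc zero} {suc (suc zero)} eq = contradiction
        (trans (sym (trans (fr-fr 2 2 ω) (trans (sym (fr-fr 3 1 ω)) (cong (fr 1) ω∈))))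
          (trans (cong (fr 2) (sym eq)) (trans (fr-fr 1 2 ω) ω∈))) ω∉
      distinct {suc (suc zero)} {suc zero} eq = sym (distinct (sym eq))
      open Polynomials commutativeRing noZeroDivisors using (eval; distinctRoots)
      a-independent : Independent a
      -- The relation says that the polynomial with coefficients c vanishes at the three conjugates
      -- of ω.
      a-independent c ac≗𝟎 = distinctRoots c (λ i → σ i ω) distinct λ i →
        trans (horner i) (ac≗𝟎 i)
        where
        σ-1# : ∀ i → σ i 1# ≡ 1#
        σ-1# i = σ-𝔽₁ i (fr-1# 1)
        horner : ∀ i → eval c (σ i ω) ≡ combination a c i
        horner i = begin
          c zero + x * (c (suc zero) + x * (c (suc (suc zero)) + x * 0#))
            ≡⟨ solve 4 (λ c₀ c₁ c₂ x → c₀ :+ x :* (c₁ :+ x :* (c₂ :+ x :* con 0))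
                 := c₀ :* con 1 :+ (c₁ :* x :+ (c₂ :* (x :* x) :+ con 0))) refl (c zero) (c (suc zero)) (c (suc (suc zero))) x ⟩
          c zero * 1# + (c (suc zero) * x + (c (suc (suc zero)) * (x * x) + 0#))
            ≡⟨ cong₂ (λ e f → c zero * e + (c (suc zero) * x + (c (suc (suc zero)) * f + 0#))) (sym (σ-1# i)) (sym (σ-* i ω ω)) ⟩
          combination a c i ∎
          where
          open Solver commutativeSemiring using (solve; con; _:=_; _:+_; _:*_)
          x = σ i ω
      Π₀ : Subspace 1 9 3
      Π₀ = record
        { basis = λ j → E (a j ⊛ r)
        ; rational = λ j → ⊛-rational (powers j) r (powers∈ j) r∈
        ; independent = λ c Ec≗𝟎 → a-independent c (λ i → trans (sym (combination-of-δ (combination a c) i))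
            (independent (⊛-plane r r≢𝟎) (combination δ (combination a c)) (λ k → trans
              (E-combinationˡ δ r (combination δ (combination a c)) k)
              (trans (⊛-cong _ (combination a c) r r
                (λ i → trans (combination-of-δ (combination δ (combination a c)) i) (combination-of-δ (combination a c) i)) (λ _ → refl) k)
                (trans (sym (E-combinationˡ a r c k)) (Ec≗𝟎 k)))) i))
        }
      to : ⟦ ⊛-plane r r≢𝟎 ⟧ ⊆ ⟦ Π₀ ⟧
      to {Z} Z∈ = let s , Z≗ = ⊛-plane⇒ r r≢𝟎 Z∈
                      c , s≗ac = spans a a-independent s
                  in c , λ k → trans (Z≗ k) (trans (⊛-cong s (combination a c) r r s≗ac (λ _ → refl) k) (sym (E-combinationˡ a r c k)))
      from : ⟦ Π₀ ⟧ ⊆ ⟦ ⊛-plane r r≢𝟎 ⟧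
      from {Z} (c , Z≗) = Span-cong (basis (⊛-plane r r≢𝟎)) (λ k → sym (trans (Z≗ k) (E-combinationˡ a r c k)))
        (⊛-plane⇐ r r≢𝟎 (combination a c))

    -- Let r = (0, t, 1). In an 𝔽_q-point s ⊗ r row 1 is the q-power of row 0: the last column gives
    -- s₁ = s₀^q, the middle one s₁ t = s₁ t^q. As t^q ≠ t, this forces s₁ = 0.
    ⊛-plane-irrational : ∀ r r≢𝟎 → Irrational (r ∘ suc) → ⟦ ⊛-plane r r≢𝟎 ⟧ ⊥ PG 1
    ⊛-plane-irrational r r≢𝟎 (t∉ , r₂≡1) {Z} (Z∈ , v , v∈ , Z∼v) = s₁≢0 (noZeroDivisors s₁-relation t-differs)
      where
      t = r (suc zero)
      v-span : ∃ λ s → v ≗ E (s ⊛ r)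
      v-span = ⊛-plane⇒ r r≢𝟎 (Span-∼ (basis (⊛-plane r r≢𝟎)) (∼-sym Z∼v) Z∈)
      s = proj₁ v-span
      v≗ = proj₂ v-span
      s₀ = s zero
      s₁ = s (suc zero)
      coordinates : ∀ i → (s ⊛ r) i ≗ conj i ((s ⊛ r) zero)
      coordinates = proj₁ (rational⇒conj (s ⊛ r) (λ k → trans (cong (fr 1) (sym (v≗ k))) (trans (v∈ k) (v≗ k))))
      s₁≡ : s₁ ≡ fr 1 s₀
      s₁≡ = begin
        s₁                               ≡⟨ *-identityʳ s₁ ⟨
        s₁ * 1#                          ≡⟨ cong (s₁ *_) r₂≡1 ⟨
        s₁ * r (suc (suc zero))          ≡⟨ coordinates (suc zero) (suc (suc zero)) ⟩
        fr 1 (s₀ * r (suc (suc zero)))   ≡⟨ cong (fr 1) (trans (cong (s₀ *_) r₂≡1) (*-identityʳ s₀)) ⟩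
        fr 1 s₀                          ∎
      t-differs : fr 1 t - t ≢ 0#
      t-differs eq = t∉ (x∙y⁻¹≈ε⇒x≈y _ _ eq)
      s₁-relation : (fr 1 t - t) * s₁ ≡ 0#
      s₁-relation = begin
        (fr 1 t - t) * s₁        ≡⟨ *-comm _ s₁ ⟩
        s₁ * (fr 1 t - t)        ≡⟨ x[y-z]≈xy-xz s₁ (fr 1 t) t ⟩
        s₁ * fr 1 t - s₁ * t     ≡⟨ cong (_- s₁ * t) (trans (cong (_* fr 1 t) s₁≡)
                                   (sym (trans (coordinates (suc zero) (suc zero)) (fr-* 1 s₀ t)))) ⟩
        s₁ * t - s₁ * t          ≡⟨ -‿inverseʳ _ ⟩
        0#                       ∎
      s₁≢0 : s₁ ≢ 0#
      s₁≢0 s₁≡0 with s₀ ≟ 0#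
      -- Since s₁ = s₀^q, vanishing of s₁ makes row 0 zero, and with it its conjugates, the other
      -- rows.
      ... | no s₀≢0 = fr-≢0 1 s₀≢0 (trans (sym s₁≡) s₁≡0)
      ... | yes s₀≡0 = ∼-≢𝟎 Z∼v (coords≢𝟎 Z) (λ k → trans (v≗ k)
        (trans (E-cong (s ⊛ r) (λ _ → 𝟎) (λ i j → trans (coordinates i j)
          (trans (cong (σ i) (trans (cong (_* r j) s₀≡0) (zeroˡ (r j)))) (σ-0# i))) k) (E-𝟎 k)))

    private
      spread-∼ : ∀ {X Y} → X ≈ₚ Y → ⟦[ X ]⟧ ⊆ ⟦[ Y ]⟧
      spread-∼ {X} {Y} X∼Y {Z} (Z∈X , Z∈PG) = let y , Y≗Fy = spans F F-independent (coords Y)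
                                                  s , Z≗ = spread⇒ X Z y (∼-trans X∼Y (≗⇒∼ Y≗Fy)) Z∈X
                                              in spread⇐ Y Z y (≗⇒∼ Y≗Fy) s Z≗ , Z∈PG

      meetingPoint : ∀ y → ¬ y ≗ 𝟎 → Point 9
      meetingPoint y y≢𝟎 = point (E (τ ⊛ y)) λ E≗𝟎 → y≢𝟎 λ j → noZeroDivisors (E-kernel (τ ⊛ y) E≗𝟎 zero j) θ≢0

      frame-≢𝟎 : ∀ X y → coords X ∼ combination F y → ¬ y ≗ 𝟎
      frame-≢𝟎 X y X∼Fy y≗𝟎 = ∼-≢𝟎 X∼Fy (coords≢𝟎 X) (λ i → trans (combination-congʳ F y≗𝟎 i) (combination-𝟎 F i))

      -- A vector y over 𝔽_q is its own conjugate, so τ ⊗ y has the shape of a point of the spread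
      -- plane as well.
      meetingPoint∈ : ∀ X y → EntriesIn 1 y → (X∼Fy : coords X ∼ combination F y) →
        meetingPoint y (frame-≢𝟎 X y X∼Fy) ∈ ⟦[ X ]⟧ ∩ ⟦ Π ⟧
      meetingPoint∈ X y y∈ X∼Fy =
        ( spread⇐ X (meetingPoint y (frame-≢𝟎 X y X∼Fy)) y X∼Fy τ
            (E-cong (τ ⊛ y) _ (λ i j → cong (τ i *_) (sym (σ-𝔽₁ i (y∈ j)))))
        , E (τ ⊛ y) , ⊛-rational θ y θ∈ y∈ , ≗⇒∼ (λ _ → refl))
        , y , λ k → sym (Π-combination y k)

      -- Row 0 alone determines the point: it reads θ y on Π and s₀ y′ on the plane of X.
      meet⇒∼ : ∀ X y′ Z y → coords X ∼ combination F y′ → Z ∈ ⟦[ X ]⟧ → coords Z ≗ E (τ ⊛ y) →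
        ∃ λ u → θ ⊙ y ≗ u ⊙ y′
      meet⇒∼ X y′ Z y X∼Fy′ (Z∈X , _) Z≗ = let s , Z≗′ = spread⇒ X Z y′ X∼Fy′ Z∈X in
        s zero , E-injective (τ ⊛ y) (λ i → s i ⊙ conj i y′) (λ k → trans (sym (Z≗ k)) (Z≗′ k)) zero

      ⊙∼ : ∀ {y y′ : Vec 3} → ¬ y ≗ 𝟎 → (∃ λ u → θ ⊙ y ≗ u ⊙ y′) → y ∼ y′
      ⊙∼ {y} {y′} y≢𝟎 (u , eq) = ⊙⇒∼ (inv θ θ≢0 * u) y≢𝟎 λ j →
        trans (sym (inv-cancel-* θ θ≢0 (y j))) (trans (cong (inv θ θ≢0 *_) (eq j)) (sym (*-assoc _ u (y′ j))))

    module _ (secant : Secant π ℓ∞) where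
      private
        f = proj₁ secant
        f∈ = proj₁ (proj₂ secant)
        f-injective = proj₁ (proj₂ (proj₂ secant))
        f-onto = proj₂ (proj₂ (proj₂ secant))

      -- The planes correspond to the q + 1 points of π on ℓ∞. Each of these has coordinates over
      -- 𝔽_q, giving a common point with Π; conversely an 𝔽_q-point of Π on the plane of X shows
      -- that X is in π.
      spreadPlanesMeetingΠ : HasCardinality _≐_ (SpreadPlaneMeeting ⟦ Π ⟧) (suc q)
      spreadPlanesMeetingΠ = (λ i → ⟦[ f i ]⟧) , meets , injective , onto
        where
        y : ∀ i → Vec 3
        y i = proj₁ (π⇒ {f i} (proj₁ (f∈ i)))
        y∈ : ∀ i → EntriesIn 1 (y i)
        y∈ i = proj₁ (proj₂ (π⇒ {f i} (proj₁ (f∈ i))))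
        f∼Fy : ∀ i → coords (f i) ∼ combination F (y i)
        f∼Fy i = proj₂ (proj₂ (π⇒ {f i} (proj₁ (f∈ i))))
        y≢𝟎 : ∀ i → ¬ y i ≗ 𝟎
        y≢𝟎 i = frame-≢𝟎 (f i) (y i) (f∼Fy i)

        meets : ∀ i → SpreadPlaneMeeting ⟦ Π ⟧ ⟦[ f i ]⟧
        meets i = (f i , proj₂ (f∈ i) , (λ Z∈ → Z∈) , (λ Z∈ → Z∈))
                , meetingPoint (y i) (y≢𝟎 i) , meetingPoint∈ (f i) (y i) (y∈ i) (f∼Fy i)

        injective : ∀ i j → ⟦[ f i ]⟧ ≐ ⟦[ f j ]⟧ → i ≡ j
        injective i j (fi⊆fj , _) = f-injective i j (∼-trans (f∼Fy i) (∼-trans (∼-combination F y∼y) (∼-sym (f∼Fy j))))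
          where
          Z = meetingPoint (y i) (y≢𝟎 i)
          y∼y : y i ∼ y j
          y∼y = ⊙∼ (y≢𝟎 i) (meet⇒∼ (f j) (y j) Z (y i) (f∼Fy j)
            (fi⊆fj {Z} (proj₁ (meetingPoint∈ (f i) (y i) (y∈ i) (f∼Fy i)))) (λ _ → refl))

        onto : ∀ S → SpreadPlaneMeeting ⟦ Π ⟧ S → ∃ λ i → S ≐ ⟦[ f i ]⟧
        onto S ((X , (X∈ℓ∞ , X∈PG) , S⊆X , X⊆S) , Z , Z∈S , (w , Z≗)) =
          proj₁ X≈f , (λ {Z} Z∈ → spread-∼ {X} {f (proj₁ X≈f)} (proj₂ X≈f) {Z} (S⊆X Z∈))
                      , (λ {Z} Z∈ → X⊆S (spread-∼ {f (proj₁ X≈f)} {X} (∼-sym (proj₂ X≈f)) {Z} Z∈))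
          where
          x : Vec 3
          x = proj₁ (spans F F-independent (coords X))
          X≗Fx : coords X ≗ combination F x
          X≗Fx = proj₂ (spans F F-independent (coords X))
          Z≗E : coords Z ≗ E (τ ⊛ w)
          Z≗E k = trans (Z≗ k) (Π-combination w k)
          w≢𝟎 : ¬ w ≗ 𝟎
          w≢𝟎 w≗𝟎 = coords≢𝟎 Z (λ k → trans (Z≗ k) (trans (combination-congʳ (basis Π) w≗𝟎 k) (combination-𝟎 (basis Π) k)))
          w∼x : w ∼ x
          w∼x = ⊙∼ w≢𝟎 (meet⇒∼ X x Z w (≗⇒∼ X≗Fx) (S⊆X Z∈S) Z≗E)
          -- Z = κ v with v over 𝔽_q; comparing coordinates, κ⁻¹ w is over 𝔽_q.
          Z-rational = proj₂ (S⊆X Z∈S)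
          v = proj₁ Z-rational
          κ = proj₁ (proj₂ (proj₂ Z-rational))
          κ≢0 = proj₁ (proj₂ (proj₂ (proj₂ Z-rational)))
          u : Vec 3
          u = inv κ κ≢0 ⊙ w
          v≗ : v ≗ E (τ ⊛ u)
          v≗ k = begin
            v k                            ≡⟨ inv-cancel-* κ κ≢0 (v k) ⟨
            inv κ κ≢0 * (κ * v k)          ≡⟨ cong (inv κ κ≢0 *_) (proj₂ (proj₂ (proj₂ (proj₂ Z-rational))) k) ⟨
            inv κ κ≢0 * coords Z k         ≡⟨ cong (inv κ κ≢0 *_) (Z≗ k) ⟩
            inv κ κ≢0 * combination (basis Π) w k ≡⟨ combination-⊙ (basis Π) (inv κ κ≢0) w k ⟨
            combination (basis Π) u k      ≡⟨ Π-combination u k ⟩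
            E (τ ⊛ u) k                    ∎
          u∈ : EntriesIn 1 u
          -- Row 1 of the 𝔽_q-point τ ⊗ u is the q-power of row 0, that is θ^q u = (θ u)^q, and θ^q
          -- cancels.
          u∈ j = *-cancelˡ-≢0 (τ≢0 (suc zero)) (begin
            fr 1 θ * fr 1 (u j)    ≡⟨ fr-* 1 θ (u j) ⟨
            fr 1 (θ * u j)         ≡⟨ proj₁ (rational⇒conj (τ ⊛ u) (λ k → trans (cong (fr 1) (sym (v≗ k)))
                                        (trans (proj₁ (proj₂ Z-rational) k) (v≗ k)))) (suc zero) j ⟨
            fr 1 θ * u j           ∎)
          u∼w : u ∼ w
          u∼w = inv κ κ≢0 , inv-≢0 κ κ≢0 , λ _ → refl
          X∈π : X ∈ π
          X∈π = ⇒π {X} u u∈ (∼-trans (≗⇒∼ X≗Fx) (∼-combination F (∼-sym (∼-trans u∼w w∼x))))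
          X≈f : ∃ λ i → X ≈ₚ f i
          X≈f = f-onto X (X∈π , X∈ℓ∞ , X∈PG)

    module _ (C⁺ : Conic 3) (C⁺-unique : IsUniqueConicThrough C C⁺)
             (C⁺⁺ : Conic 6) (C⁺⁺-unique : IsUniqueConicThrough (pts C⁺ ∩ PG 3) C⁺⁺)
             (κ : Conjugacy π) (V : BoseVariety bose κ C C⁺ C⁺⁺) where
      open BoseVariety V using (𝒱; points⋆⋆)
      open Scroll κ ⇒π

      𝒱⇒ : ∀ Z → Z ∈ 𝒱 → ∃₂ λ s y → ¬ y ≗ 𝟎 × quadratic (form N) y ≡ 0# × coords Z ≗ E (s ⊛ y)
      𝒱⇒ Z Z∈ = let X , X∈C⁺⁺ , Z∈X = proj₁ points⋆⋆ {Z} Z∈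
                    y , X≗Fy = spans F F-independent (coords X)
                    s , Z≗ = scroll⇒ X Z y (≗⇒∼ X≗Fy) Z∈X
                in s , y , frame-≢𝟎 X y (≗⇒∼ X≗Fy)
                 , proj₁ (C⁺⁺-equation frm C⁺ C⁺-unique C⁺⁺ C⁺⁺-unique X y X≗Fy) X∈C⁺⁺ , Z≗

      𝒱⇐ : ∀ Z s y → ¬ y ≗ 𝟎 → quadratic (form N) y ≡ 0# → coords Z ≗ E (s ⊛ y) → Z ∈ 𝒱
      𝒱⇐ Z s y y≢𝟎 y∈ Z≗ = proj₂ points⋆⋆ {Z}
        (X , proj₂ (C⁺⁺-equation frm C⁺ C⁺-unique C⁺⁺ C⁺⁺-unique X y (λ _ → refl)) y∈
           , scroll⇐ X Z y (≗⇒∼ (λ _ → refl)) s Z≗)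
        where X = point (combination F y) (combination-≢𝟎 F F-independent y y≢𝟎)

      open Splitting (splitting-at-infinity N)

      private
        ρ₁ ρ₂ : Vec 3
        ρ₁ = 0# ∷ r₁
        ρ₂ = 0# ∷ r₂
        ρ₁≢𝟎 : ¬ ρ₁ ≗ 𝟎
        ρ₁≢𝟎 ρ₁≗𝟎 = r₁≢𝟎 (ρ₁≗𝟎 ∘ suc)
        ρ₂≢𝟎 : ¬ ρ₂ ≗ 𝟎
        ρ₂≢𝟎 ρ₂≗𝟎 = r₂≢𝟎 (ρ₂≗𝟎 ∘ suc)

      Π₁ Π₂ : Subspace 6 9 3
      Π₁ = ⊛-plane ρ₁ ρ₁≢𝟎
      Π₂ = ⊛-plane ρ₂ ρ₂≢𝟎

      decomposition : 𝒱 ∩ ⟦ Σ₆ ⟧ ≐ conicIn Π N ∪ ⟦ Π₁ ⟧ ∪ ⟦ Π₂ ⟧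
      decomposition = (λ {Z} → to {Z}) , (λ {Z} → from {Z})
        where
        to : 𝒱 ∩ ⟦ Σ₆ ⟧ ⊆ conicIn Π N ∪ ⟦ Π₁ ⟧ ∪ ⟦ Π₂ ⟧
        to {Z} (Z∈𝒱 , Z∈Σ₆) = let s , y , y≢𝟎 , y∈ , Z≗ = 𝒱⇒ Z Z∈𝒱
                                  l , sy₀≡lτ = Σ₆⇒ (s ⊛ y) (Span-cong (basis Σ₆) Z≗ Z∈Σ₆)
                              in branch s y y≢𝟎 y∈ Z≗ l sy₀≡lτ (y zero ≟ 0#)
          where
          branch : ∀ s y → ¬ y ≗ 𝟎 → quadratic (form N) y ≡ 0# → coords Z ≗ E (s ⊛ y) →
            ∀ l → (∀ i → s i * y zero ≡ l * τ i) → Dec (y zero ≡ 0#) → Z ∈ conicIn Π N ∪ ⟦ Π₁ ⟧ ∪ ⟦ Π₂ ⟧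
          -- Dividing s y₀ = l τ by y₀ gives s = κ′ τ; that κ′ is nonzero follows from Z being a
          -- point.
          branch s y y≢𝟎 y∈ Z≗ l sy₀≡lτ (no y₀≢0) = inj₁ (point y y≢𝟎 , y∈ , ⊙⇒∼ κ′ (coords≢𝟎 Z) λ k → begin
              coords Z k                 ≡⟨ Z≗ k ⟩
              E (s ⊛ y) k                ≡⟨ E-cong (s ⊛ y) (λ i → κ′ ⊙ (τ ⊛ y) i)
                                              (λ i j → trans (cong (_* y j) (s≡ i)) (*-assoc κ′ (τ i) (y j))) k ⟩
              E (λ i → κ′ ⊙ (τ ⊛ y) i) k ≡⟨ E-⊙ κ′ (τ ⊛ y) k ⟩
              κ′ * E (τ ⊛ y) k           ≡⟨ cong (κ′ *_) (Π-combination y k) ⟨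
              κ′ * combination (basis Π) y k ∎)
            where
            κ′ = inv (y zero) y₀≢0 * l
            s≡ : ∀ i → s i ≡ κ′ * τ i
            s≡ i = begin
              s i                                ≡⟨ inv-cancel-* (y zero) y₀≢0 (s i) ⟨
              inv (y zero) y₀≢0 * (y zero * s i) ≡⟨ cong (inv (y zero) y₀≢0 *_) (trans (*-comm (y zero) (s i)) (sy₀≡lτ i)) ⟩
              inv (y zero) y₀≢0 * (l * τ i)      ≡⟨ *-assoc _ l (τ i) ⟨
              κ′ * τ i                           ∎
          -- Now y is a multiple of (0, r₁) or (0, r₂), and the factor is moved into s.
          branch s y y≢𝟎 y∈ Z≗ l sy₀≡lτ (yes y₀≡0) = inj₂ (map⊎ (onPlane r₁ ρ₁≢𝟎) (onPlane r₂ ρ₂≢𝟎)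
                (complete (y ∘ suc) (trans (sym (quadratic-at-infinity N y y₀≡0)) y∈)))
            where
            onPlane : ∀ r (r≢𝟎 : ¬ (0# ∷ r) ≗ 𝟎) → (∃ λ u → y ∘ suc ≗ u ⊙ r) → Z ∈ ⟦ ⊛-plane (0# ∷ r) r≢𝟎 ⟧
            onPlane r r≢𝟎 (u , y≗ur) = Span-cong (basis (⊛-plane (0# ∷ r) r≢𝟎)) {E ((λ i → s i * u) ⊛ (0# ∷ r))}
              (λ k → sym (trans (Z≗ k) (E-cong (s ⊛ y) ((λ i → s i * u) ⊛ (0# ∷ r)) entries k)))
              (⊛-plane⇐ (0# ∷ r) r≢𝟎 (λ i → s i * u))
              where
              entries : ∀ i j → s i * y j ≡ s i * u * (0# ∷ r) j
              entries i zero    = trans (cong (s i *_) y₀≡0) (trans (zeroʳ (s i)) (sym (zeroʳ _)))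
              entries i (suc j) = trans (cong (s i *_) (y≗ur j)) (sym (*-assoc (s i) u (r j)))

        fromPlane : ∀ {Z ρ} (ρ≢𝟎 : ¬ ρ ≗ 𝟎) → ρ zero ≡ 0# → quadratic (form N) ρ ≡ 0# →
          Z ∈ ⟦ ⊛-plane ρ ρ≢𝟎 ⟧ → Z ∈ 𝒱 ∩ ⟦ Σ₆ ⟧
        fromPlane {Z} {ρ} ρ≢𝟎 ρ₀≡0 ρ∈ Z∈ = let s , Z≗ = ⊛-plane⇒ ρ ρ≢𝟎 Z∈ in
            𝒱⇐ Z s ρ ρ≢𝟎 ρ∈ Z≗
          -- A zero first column is the case l = 0 of the condition for Σ₆.
          , Span-cong (basis Σ₆) (sym ∘ Z≗) (Σ₆⇐ (s ⊛ ρ) 0# (λ i →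
              trans (cong (s i *_) ρ₀≡0) (trans (zeroʳ _) (sym (zeroˡ _)))))

        from : conicIn Π N ∪ ⟦ Π₁ ⟧ ∪ ⟦ Π₂ ⟧ ⊆ 𝒱 ∩ ⟦ Σ₆ ⟧
        from {Z} (inj₁ (Y , Y∈N , (s , s≢0 , Z≗))) =
            𝒱⇐ Z (s ⊙ τ) y (coords≢𝟎 Y) Y∈N Z≗E
          , Span-cong (basis Σ₆) (sym ∘ Z≗E) (Σ₆⇐ ((s ⊙ τ) ⊛ y) (s * y zero) (λ i →
              trans (*-assoc s (τ i) (y zero)) (trans (cong (s *_) (*-comm (τ i) (y zero))) (sym (*-assoc s (y zero) (τ i))))))
          where
          y = coords Y
          Z≗E : coords Z ≗ E ((s ⊙ τ) ⊛ y)
          Z≗E k = begin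
            coords Z k                     ≡⟨ Z≗ k ⟩
            s * combination (basis Π) y k  ≡⟨ cong (s *_) (Π-combination y k) ⟩
            s * E (τ ⊛ y) k                ≡⟨ E-⊙ s (τ ⊛ y) k ⟨
            E (λ i → s ⊙ (τ ⊛ y) i) k      ≡⟨ E-cong (λ i → s ⊙ (τ ⊛ y) i) ((s ⊙ τ) ⊛ y) (λ i j → sym (*-assoc s (τ i) (y j))) k ⟩
            E ((s ⊙ τ) ⊛ y) k              ∎
        from {Z} (inj₂ (inj₁ Z∈Π₁)) = fromPlane {Z} ρ₁≢𝟎 refl (trans (quadratic-at-infinity N ρ₁ refl) r₁-root) Z∈Π₁
        from {Z} (inj₂ (inj₂ Z∈Π₂)) = fromPlane {Z} ρ₂≢𝟎 refl (trans (quadratic-at-infinity N ρ₂ refl) r₂-root) Z∈Π₂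

      Π₁⊆Σ∞ : ⟦ Π₁ ⟧ ⊆ ⟦ Σ∞ ⟧
      Π₁⊆Σ∞ {Z} = ⊛-plane⊆Σ∞ ρ₁ ρ₁≢𝟎 refl {Z}

      Π₂⊆Σ∞ : ⟦ Π₂ ⟧ ⊆ ⟦ Σ∞ ⟧
      Π₂⊆Σ∞ {Z} = ⊛-plane⊆Σ∞ ρ₂ ρ₂≢𝟎 refl {Z}

      reality : (IsRealPlane Π₁ × IsRealPlane Π₂) ⊎ (⟦ Π₁ ⟧ ⊥ PG 1 × ⟦ Π₂ ⟧ ⊥ PG 1)
      reality = map⊎
        (λ { (r₁∈ , r₂∈) → ⊛-plane-real ρ₁ ρ₁≢𝟎 (0∷ r₁∈) , ⊛-plane-real ρ₂ ρ₂≢𝟎 (0∷ r₂∈) })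
        (λ { (r₁∉ , r₂∉) → (λ {Z} → ⊛-plane-irrational ρ₁ ρ₁≢𝟎 r₁∉ {Z}) , (λ {Z} → ⊛-plane-irrational ρ₂ ρ₂≢𝟎 r₂∉ {Z}) })
        rationality
        where
        0∷ : ∀ {r : Vec 2} → EntriesIn 1 r → EntriesIn 1 (0# ∷ r)
        0∷ r∈ zero    = fr-0# 1
        0∷ r∈ (suc j) = r∈ j

-- Two points of π on ℓ∞, and the assembly of the theorem.

module _ {q : ℕ} (K : FiniteField (q ℕ.^ 6)) where
  open Geometry q K

  twoPoints : {P : PointSet 3} → 0 ℕ.< q → HasCardinality _≈ₚ_ P (suc q) →
              ∃₂ λ X Y → X ∈ P × Y ∈ P × ¬ X ≈ₚ Y
  twoPoints 0<q (f , f∈ , f-injective , _) =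
    f zero , f i , f∈ zero , f∈ i , λ f₀∼fᵢ → Fin.0≢1+n (f-injective zero i f₀∼fᵢ)
    where i = suc (fromℕ< 0<q)

theorem4p1 :
  (q : ℕ) → IsPrimePower q → 6 ℕ.≤ q → (K : FiniteField (q ℕ.^ 6)) →
  let open Geometry q K in
  (ℓ∞ : Line) (π C : PointSet 3) →
  IsSubplane π → IsConicOfSubplane π C → Secant π ℓ∞ →
  (C⁺ : Conic 3) → IsUniqueConicThrough C C⁺ →
  (C⁺⁺ : Conic 6) → IsUniqueConicThrough (pts C⁺ ∩ PG 3) C⁺⁺ →
  (κ : Conjugacy π) (bose : BoseRepresentation) (bb : BruckBose bose ℓ∞) →
  (V : BoseVariety bose κ C C⁺ C⁺⁺) →
  let open BruckBose bb
      open BoseVariety V using (𝒱) in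
  ∃ λ (Π : Subspace 1 9 3) → ∃ λ (N₂ : Conic 1) →
  ∃ λ (Π₁ : Subspace 6 9 3) → ∃ λ (Π₂ : Subspace 6 9 3) →
    (𝒱 ∩ ⟦ Σ₆ ⟧ ≐ conicIn Π N₂ ∪ ⟦ Π₁ ⟧ ∪ ⟦ Π₂ ⟧)
    × ⟦ Π ⟧ ⊆ ⟦ Σ₆ ⟧
    × ⟦ Π ⟧ ∩ PG 1 ⊈ ⟦ Σ∞ ⟧
    × HasCardinality _≐_ (SpreadPlaneMeeting ⟦ Π ⟧) (suc q)
    × ⟦ Π₁ ⟧ ⊆ ⟦ Σ∞ ⟧
    × ⟦ Π₂ ⟧ ⊆ ⟦ Σ∞ ⟧
    × ((IsRealPlane Π₁ × IsRealPlane Π₂) ⊎ (⟦ Π₁ ⟧ ⊥ PG 1 × ⟦ Π₂ ⟧ ⊥ PG 1))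
theorem4p1 q q-primePower 6≤q K ℓ∞ π C _ conicOf secant C⁺ C⁺-unique C⁺⁺ C⁺⁺-unique κ bose bb V =
    Π frm bose bb , N , Π₁ᵥ , Π₂ᵥ
  , ((λ {Z} → proj₁ decomp {Z}) , (λ {Z} → proj₂ decomp {Z}))
  , (λ {Z} → Π⊆Σ₆ frm bose bb {Z})
  , Π⊈Σ∞ frm bose bb
  , spreadPlanesMeetingΠ frm bose bb secant
  , (λ {Z} → Π₁⊆Σ∞ frm bose bb C⁺ C⁺-unique C⁺⁺ C⁺⁺-unique κ V {Z})
  , (λ {Z} → Π₂⊆Σ∞ frm bose bb C⁺ C⁺-unique C⁺⁺ C⁺⁺-unique κ V {Z})
  , reality frm bose bb C⁺ C⁺-unique C⁺⁺ C⁺⁺-unique κ V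
  where
  open Geometry q K
  open Conics q-primePower K
  open Decomposition q-primePower K
  frm : Frame π C ℓ∞
  frm = let X , Y , (X∈π , X∈ℓ∞ , _) , (Y∈π , Y∈ℓ∞ , _) , X≉Y = twoPoints K (ℕ.≤-trans (ℕ.s≤s ℕ.z≤n) 6≤q) secant in
    frame conicOf (X , Y , (X∈π , X∈ℓ∞) , (Y∈π , Y∈ℓ∞) , X≉Y)
  N = Frame.N frm
  Π₁ᵥ = Π₁ frm bose bb C⁺ C⁺-unique C⁺⁺ C⁺⁺-unique κ V
  Π₂ᵥ = Π₂ frm bose bb C⁺ C⁺-unique C⁺⁺ C⁺⁺-unique κ V
  decomp = decomposition frm bose bb C⁺ C⁺-unique C⁺⁺ C⁺⁺-unique κ V
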